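{- Let $a,b,c,d,e,f,g,h$ be indeterminates, let $$ M=\begin{bmatrix} a&d&d&a\\ e&0&g&e\\ f&h&0&f\\ b&c&c&b \end{bmatrix}, $$ and let $R$ denote the irreducible polynomial $R:=abgh+acfg+bdeh+2cdef$. The matching generating functions of the first twelve Aztec diamonds weighted by $\mathrm{wt}_M$ are given by $$ \begin{aligned} M(AD_{0};\mathrm{wt}_M)&=1\\ M(AD_{1};\mathrm{wt}_M)&=de\\ M(AD_{2};\mathrm{wt}_M)&=abR\\ M(AD_{3};\mathrm{wt}_M)&=(de)^2abghR\\ M(AD_{4};\mathrm{wt}_M)&=2(ab)^2cdefR^3\\ M(AD_{5};\mathrm{wt}_M)&=2(de)^4(abgh)^2cfR^3\\ M(AD_{6};\mathrm{wt}_M)&=2^3(ab)^4(cdef)^3ghR^5\\ M(AD_{7};\mathrm{wt}_M)&=2^3(de)^7(abgh)^4(cf)^3R^5\\ M(AD_{8};\mathrm{wt}_M)&=2^5(ab)^7(cdef)^5(gh)^3R^8\\ M(AD_{9};\mathrm{wt}_M)&=2^5(de)^{10}(abgh)^7(cf)^5R^8\\ M(AD_{10};\mathrm{wt}_M)&=2^8(ab)^{10}(cdef)^8(gh)^5R^{12}\\ M(AD_{11};\mathrm{wt}_M)&=2^8(de)^{14}(abgh)^{10}(cf)^8R^{12}, \end{aligned} $$ and for higher orders we have the recurrences $$ M(AD_{2n};\mathrm{wt}_M)=2^{4n-12}(ab)^{4n-10}(cdef)^{4n-12}(gh)^{4n-16}R^{4n-8}M(AD_{2n-12};\mathrm{wt}_M)\qquad(2n\ge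 12) $$ and $$ M(AD_{2n-1};\mathrm{wt}_M)=2^{4n-16}(de)^{4n-10}(abgh)^{4n-14}(cf)^{4n-16}R^{4n-12} M(AD_{2n-13};\mathrm{wt}_M)\qquad(2n-1\ge 13). $$
   Context: For $n\ge0$, the Aztec diamond graph $AD_n$ has vertices $u_{i,j}$ ($0\le i\le n$, $1\le j\le n$) and $v_{i,j}$ ($1\le i\le n$, $0\le j\le n$), and $4n^2$ edges $\epsilon_{r,s}$, $1\le r,s\le 2n$ (the edge centers form a $2n\times2n$ array), where for $1\le i,j\le n$: $\epsilon_{2i-1,2j-1}=u_{i-1,j}v_{i,j-1}$, $\epsilon_{2i-1,2j}=u_{i-1,j}v_{i,j}$, $\epsilon_{2i,2j-1}=u_{i,j}v_{i,j-1}$, $\epsilon_{2i,2j}=u_{i,j}v_{i,j}$. $AD_0$ is the empty graph. For a $k\times l$ matrix $A$ with $k,l$ even, the weight $\mathrm{wt}_A$ on $AD_n$ assigns to the edge $\epsilon_{r,s}$ the entry of $A$ in row $r'$ and column $s'$, where $1\le r'\le k$, $r'\equiv r \pmod k$, $1\le s'\le l$, $s'\equiv s\pmod l$ (the array of edges is filled periodically with copies of $A$ starting from the upper left corner). The weight of a perfect matching is the product of the weights of its edges, and $M(G;\mathrm{wt})$ is the sum of the weights of all perfect matchings of $G$ (equal to $1$ for the empty graph). -}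

module Defs where

open import Algebra.Bundles.Raw using (RawRing)
open import Data.Fin.Base using (Fin; zero; suc; inject₁; remQuot; toℕ)
open import Data.Fin.Patterns using (0F; 1F; 2F; 3F; 4F; 5F; 6F; 7F)
import Data.Fin.Properties as Fin
import Data.Integer.Base as ℤ
open import Data.List.Base
  using (List; []; _∷_; _++_; map; filter; foldr; length; allFin; cartesianProduct)
open import Data.List.Membership.Propositional using (_∈_)
open import Data.List.Membership.Propositional.Properties
  using (∈-allFin; ∈-cartesianProduct⁺; ∈-map⁺; ∈-++⁺ˡ; ∈-++⁺ʳ)
import Data.List.Relation.Unary.All as All
open import Data.List.Relation.Unary.Unique.Propositional using (Unique)
open import Data.List.Relation.Unary.Unique.Propositional.Properties
  using (allFin⁺; cartesianProduct⁺)
open import Data.Nat.Base using (ℕ; zero; suc; NonZero) renaming (_*_ to _ℕ*_)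
open import Data.Nat.DivMod using (_mod_)
import Data.Nat.Properties as ℕ
open import Data.Product.Base using (_×_; _,_; proj₁; proj₂)
import Data.Product.Properties as Product
open import Data.Sum.Base using (_⊎_; inj₁; inj₂)
import Data.Sum.Properties as Sum
open import Data.Vec.Base using (Vec; []; _∷_; lookup)
open import Level using (0ℓ)
open import Relation.Binary.Definitions using (DecidableEquality)
open import Relation.Binary.PropositionalEquality using (_≡_)
open import Relation.Nullary.Decidable using (Dec; map′; _⊎-dec_)

------------------------------------------------------------------------
-- Polynomial rings

-- K[X], a polynomial being the list of its coefficients, constant term
-- first. Trailing zeros are allowed; equality compares all coefficients.
module _ (K : RawRing 0ℓ 0ℓ) where
  open RawRing K

  coeff : List Carrier → ℕ → Carrier
  coeff []      _       = 0#
  coeff (x ∷ _) zero    = x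
  coeff (_ ∷ p) (suc i) = coeff p i

  addPoly : List Carrier → List Carrier → List Carrier
  addPoly []      q       = q
  addPoly (x ∷ p) []      = x ∷ p
  addPoly (x ∷ p) (y ∷ q) = (x + y) ∷ addPoly p q

  -- (x + X p) q = x q + X (p q)
  mulPoly : List Carrier → List Carrier → List Carrier
  mulPoly []      q = []
  mulPoly (x ∷ p) q = addPoly (map (x *_) q) (0# ∷ mulPoly p q)

  polynomialRing : RawRing 0ℓ 0ℓ
  polynomialRing = record
    { Carrier = List Carrier
    ; _≈_     = λ p q → ∀ i → coeff p i ≈ coeff q i
    ; _+_     = addPoly
    ; _*_     = mulPoly
    ; -_      = map (-_)
    ; 0#      = []
    ; 1#      = 1# ∷ []
    }

ℤ[_] : ℕ → RawRing 0ℓ 0ℓ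
ℤ[ zero  ] = ℤ.+-*-rawRing
ℤ[ suc m ] = polynomialRing ℤ[ m ]

-- X m i, for i in Fin m, are the indeterminates; X m zero is the one adjoined last.
X : ∀ m → Fin m → RawRing.Carrier ℤ[ m ]
X (suc m) zero    = RawRing.0# ℤ[ m ] ∷ RawRing.1# ℤ[ m ] ∷ []
X (suc m) (suc i) = X m i ∷ []

------------------------------------------------------------------------
-- Perfect matchings of finite graphs

record FiniteGraph : Set₁ where
  field
    Vertex Edge       : Set
    _≟_               : DecidableEquality Vertex
    ends              : Edge → Vertex × Vertex
    vertices          : List Vertex
    edges             : List Edge
    vertices-complete : ∀ x → x ∈ vertices
    edges-complete    : ∀ e → e ∈ edges
    edges-unique      : Unique edges

  Incident : Vertex → Edge → Set
  Incident x e = x ≡ proj₁ (ends e) ⊎ x ≡ proj₂ (ends e)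

  incident? : ∀ x e → Dec (Incident x e)
  incident? x e = (x ≟ proj₁ (ends e)) ⊎-dec (x ≟ proj₂ (ends e))

  -- For a repetition-free list S of edges: each vertex lies on exactly
  -- one edge of S.
  IsPerfectMatching : List Edge → Set
  IsPerfectMatching S = ∀ x → length (filter (incident? x) S) ≡ 1

  isPerfectMatching? : ∀ S → Dec (IsPerfectMatching S)
  isPerfectMatching? S =
    map′ (λ all x → All.lookup all (vertices-complete x))
         (λ pm → All.tabulate (λ {x} _ → pm x))
         (All.all? (λ x → length (filter (incident? x) S) ℕ.≟ 1) vertices)

-- All sublists; those of a repetition-free list represent each subset
-- exactly once.
subsets : ∀ {A : Set} → List A → List (List A)
subsets []       = [] ∷ []
subsets (x ∷ xs) = map (x ∷_) (subsets xs) ++ subsets xs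

perfectMatchings : (G : FiniteGraph) → List (List (FiniteGraph.Edge G))
perfectMatchings G = filter isPerfectMatching? (subsets edges)
  where open FiniteGraph G

module MatchingGeneratingFunction (K : RawRing 0ℓ 0ℓ) where
  open RawRing K

  weight : ∀ {E : Set} → (E → Carrier) → List E → Carrier
  weight wt S = foldr _*_ 1# (map wt S)

  M : (G : FiniteGraph) → (FiniteGraph.Edge G → Carrier) → Carrier
  M G wt = foldr _+_ 0# (map (weight wt) (perfectMatchings G))

------------------------------------------------------------------------
-- Aztec diamonds

AztecVertex AztecEdge : ℕ → Set
AztecVertex n = (Fin (suc n) × Fin n) ⊎ (Fin n × Fin (suc n))
AztecEdge   n = Fin (n ℕ* 2) × Fin (n ℕ* 2)

-- Indices running from 1 are shifted to run from 0, so
--   u i j  is  u_{i,j+1},  v i j  is  v_{i+1,j},  (r , s)  is  ε_{r+1,s+1}.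
pattern u i j = inj₁ (i , j)
pattern v i j = inj₂ (i , j)

_⊹_ : ∀ {n} → Fin n → Fin 2 → Fin (suc n)
i ⊹ 0F = inject₁ i
i ⊹ 1F = suc i

-- Writing r = 2 i + ρ and s = 2 j + σ with ρ, σ ∈ {0, 1}, the edge
-- ε_{r+1,s+1} joins u_{i+ρ,j+1} and v_{i+1,j+σ}.
aztecEnds : ∀ {n} → AztecEdge n → AztecVertex n × AztecVertex n
aztecEnds (r , s) =
  let (i , ρ) = remQuot 2 r
      (j , σ) = remQuot 2 s
  in  u (i ⊹ ρ) j , v i (j ⊹ σ)

AD : ℕ → FiniteGraph
AD n = record
  { Vertex            = AztecVertex n
  ; Edge              = AztecEdge n
  ; _≟_               = Sum.≡-dec (Product.≡-dec Fin._≟_ Fin._≟_)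
                                  (Product.≡-dec Fin._≟_ Fin._≟_)
  ; ends              = aztecEnds
  ; vertices          = map inj₁ us ++ map inj₂ vs
  ; edges             = cartesianProduct (allFin (n ℕ* 2)) (allFin (n ℕ* 2))
  ; vertices-complete = λ where
      (u i j) → ∈-++⁺ˡ (∈-map⁺ inj₁ (∈-cartesianProduct⁺ (∈-allFin i) (∈-allFin j)))
      (v i j) → ∈-++⁺ʳ (map inj₁ us)
                  (∈-map⁺ inj₂ (∈-cartesianProduct⁺ (∈-allFin i) (∈-allFin j)))
  ; edges-complete    = λ where
      (r , s) → ∈-cartesianProduct⁺ (∈-allFin r) (∈-allFin s)
  ; edges-unique      = cartesianProduct⁺ (allFin⁺ (n ℕ* 2)) (allFin⁺ (n ℕ* 2))
  }
  where
  us : List (Fin (suc n) × Fin n)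
  us = cartesianProduct (allFin (suc n)) (allFin n)
  vs : List (Fin n × Fin (suc n))
  vs = cartesianProduct (allFin n) (allFin (suc n))

-- The m × m edge array (m = 2 n for AD n) filled periodically with copies
-- of A from the upper left corner.
-- (For odd k or l this still makes sense; only even ones are of interest.)
wt : ∀ {C : Set} {k l} .{{_ : NonZero k}} .{{_ : NonZero l}} →
     Vec (Vec C l) k → ∀ {m} → Fin m × Fin m → C
wt {k = k} {l} A (r , s) = lookup (lookup A (toℕ r mod k)) (toℕ s mod l)

------------------------------------------------------------------------
-- The weight matrix

ℤ[a⋯h] : RawRing 0ℓ 0ℓ
ℤ[a⋯h] = ℤ[ 8 ]

open RawRing ℤ[a⋯h] using (Carrier; _+_; _*_; 0#; 1#)

a b c d e f g h : Carrier
a = X 8 0F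
b = X 8 1F
c = X 8 2F
d = X 8 3F
e = X 8 4F
f = X 8 5F
g = X 8 6F
h = X 8 7F

2# : Carrier
2# = 1# + 1#

matrixM : Vec (Vec Carrier 4) 4
matrixM = (a ∷ d  ∷ d  ∷ a ∷ [])
        ∷ (e ∷ 0# ∷ g  ∷ e ∷ [])
        ∷ (f ∷ h  ∷ 0# ∷ f ∷ [])
        ∷ (b ∷ c  ∷ c  ∷ b ∷ [])
        ∷ []

R : Carrier
R = a * b * g * h + a * c * f * g + b * d * e * h + 2# * c * d * e * f

open MatchingGeneratingFunction ℤ[a⋯h] public using (M)

module Submission where

-- Cut AD n into its n² cells, the 4-cycles of edges (2i , 2j), (2i , 2j+1), (2i+1 , 2j),
-- (2i+1 , 2j+1). A perfect matching induces on each cell the set of vertices it covers there: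
-- none of them, the ends of one edge, or all four. Every interior vertex lies on exactly two
-- cells, and complementing all these sets turns the matchings of AD n into those of the copy of
-- AD (n - 1) that avoids the border; the weights correspond if each edge gets the weight of the
-- opposite edge of its cell divided by the cell factor wz + xy. So M (AD n) is the product of
-- the cell factors times M (AD (n - 1)) with the new weights.
--
-- Starting from the matrix M, all entries and all cell factors of the iterated weights are
-- Laurent monomials in a, …, h, 2, R, S = ag + de, T = bh + cf, U = ag + 2de, W = bh + 2cf
-- (or 0), and after 12 steps the matrix M returns up to a scalar. Hence every M (AD n) is a
-- Laurent monomial, whose exponents are quadratic in n on each residue class. The computation
-- is done in ℚ, at positive integer values of the variables, where nothing vanishes; these
-- values determine a polynomial.
--
-- R is linear in a and in b. The matrix (2cdef , deh ; cfg , gh) of its coefficients in these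
-- variables has nonzero determinant, so a factorisation has a factor free of both, and that
-- factor divides the coprime entries of the matrix.

open import Defs hiding (M; R; a; b; c; d; e; f; g; h)
open import Algebra.Bundles using (AbelianGroup; CommutativeRing)
open import Algebra.Bundles.Raw using (RawRing)
open import Algebra.Definitions.RawSemiring (RawRing.rawSemiring ℤ[a⋯h]) using (Irreducible; mkIrred; _∣_; _∤_; _^_)
import Algebra.Solver.Ring.NaturalCoefficients.Default as NaturalSolver
open import Data.Bool.Base using (true; false; if_then_else_)
open import Data.Empty using (⊥; ⊥-elim)
open import Data.Fin using (#_)
open import Data.Fin.Base using (Fin; zero; suc; inject₁; fromℕ; toℕ; combine; remQuot; opposite)
open import Data.Fin.Patterns
import Data.Fin.Properties as Fin
open import Data.Fin.Relation.Unary.Top using (‵fromℕ; ‵inject₁; view)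
open import Data.Integer.Base as ℤ using (ℤ; 0ℤ; 1ℤ; +_; -[1+_])
import Data.Integer.Properties as ℤ
open import Data.Integer.Tactic.RingSolver using (solve-∀)
open import Data.List.Base
  using (List; []; _∷_; _++_; map; filter; foldr; length; drop; tabulate; allFin; cartesianProduct)
import Data.List.Membership.DecPropositional as DecMembership
open import Data.List.Membership.Propositional using (_∈_; _∉_; find)
open import Data.List.Membership.Propositional.Properties
  using (∈-allFin; ∈-cartesianProduct⁺; ∈-map⁺; ∈-filter⁺; ∈-filter⁻; ∈-++⁺ˡ; ∈-++⁺ʳ)
open import Data.List.Membership.Propositional.Properties.WithK using (unique∧set⇒bag)
open import Data.List.Relation.Binary.BagAndSetEquality using (∼bag⇒↭)
open import Data.List.Relation.Binary.Permutation.Propositional as Perm using (_↭_; ↭-sym; ↭-trans)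
open import Data.List.Relation.Unary.All as All using (All; []; _∷_)
open import Data.List.Relation.Unary.AllPairs using ([]; _∷_)
open import Data.List.Relation.Unary.Any as Any using (Any; here; there)
open import Data.List.Relation.Unary.Unique.Propositional using (Unique)
open import Data.List.Relation.Unary.Unique.Propositional.Properties
  using (allFin⁺; cartesianProduct⁺; map⁺; filter⁺; ++⁺)
open import Data.Maybe.Base as Maybe using (Maybe; just; nothing)
open import Data.Maybe.Relation.Binary.Pointwise as Pointwise using (Pointwise; just; nothing)
open import Data.Nat.Base as ℕ using (ℕ; zero; suc; _∸_; _≤_; ⌊_/2⌋; ⌈_/2⌉) renaming (_*_ to _·_)
import Data.Nat.Divisibility as ℕ∣
open import Data.Nat.DivMod using (_mod_)
import Data.Nat.Properties as ℕ
import Data.Nat.Tactic.RingSolver as ℕ-Solver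
open import Data.Product.Base using (_×_; _,_; proj₁; proj₂; ∃)
import Data.Product.Properties as Product
open import Data.Rational.Unnormalised.Base using (ℚᵘ; mkℚᵘ; *≡*; 1/_)
import Data.Rational.Unnormalised.Properties as ℚ
open import Data.Sum.Base as Sum using (_⊎_; inj₁; inj₂; [_,_]′)
open import Data.Sum.Properties using (inj₁-injective; inj₂-injective)
open import Data.Vec.Base as Vec using (Vec; []; _∷_; lookup)
open import Function.Base using (_∘_)
open import Function.Bundles using (_⇔_; mk⇔)
open import Level using (0ℓ)
open import Relation.Binary.Definitions using (DecidableEquality)
open import Relation.Binary.PropositionalEquality as ≡ using (_≡_; _≢_; _≗_)
open import Relation.Nullary using (¬_)
open import Relation.Nullary.Decidable
  using (Dec; does; yes; no; ¬?; _×-dec_; _⊎-dec_; map′; does-⇔; True; toWitness)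
import Algebra.Properties.Group (AbelianGroup.group ℤ.+-0-abelianGroup) as ℤ-group

-- State sums of graphs

-- A cell factor is a sum of two products, so reduced weights have no reason to stay monomial. Here
-- they do, because every such sum with two nonzero terms is a monomial multiple of one of nine
-- identities, such as ST + cdef = R, R + acfg = SW, R + bdeh = TU and UW + abgh = 2R. Checking a
-- reduction thus becomes comparing integer exponent vectors. Only cell factors are ever divided by,
-- so the zero entries do no harm; having no exponent vector, they are kept apart as `nothing`. The
-- auxiliary S, T, U, W occur in the intermediate factors and must cancel in the products. The
-- scalar left over after twelve steps matters: a perfect matching of AD N has N(N + 1) edges, so a
-- scalar t in the weights contributes its N(N + 1)-th power. The polynomial ring is a raw structure
-- on coefficient lists. The laws used for irreducibility are therefore read off from ℤ, by the same
-- principle that values at positive integers determine a polynomial.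

module _ {V E : Set} {Inc : V → E → Set} (inc? : ∀ x e → Dec (Inc x e)) where

  incidence : V → E → ℤ
  incidence x e = if does (inc? x e) then 1ℤ else 0ℤ

  infixl 6 _⊖_
  -- Demands are integers, so that covering a vertex too often shows as a negative demand instead of
  -- being truncated to a met one.
  _⊖_ : (V → ℤ) → E → (V → ℤ)
  (D ⊖ e) x = D x ℤ.- incidence x e

  incidence-nonNeg : ∀ x e → ℤ.NonNegative (incidence x e)
  incidence-nonNeg x e with does (inc? x e)
  ... | true  = _
  ... | false = _

  incidence≡1 : ∀ {x e} → Inc x e → incidence x e ≡ 1ℤ
  incidence≡1 {x} {e} i with inc? x e
  ... | yes _ = ≡.refl
  ... | no ¬i = ⊥-elim (¬i i)

  incidence≡0 : ∀ {x e} → ¬ Inc x e → incidence x e ≡ 0ℤ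
  incidence≡0 {x} {e} ¬i with inc? x e
  ... | yes i = ⊥-elim (¬i i)
  ... | no _  = ≡.refl

  ⊖-≤ : ∀ D e x → (D ⊖ e) x ℤ.≤ D x
  ⊖-≤ D e x = ℤ.i≤j⇒i-k≤j (incidence x e) {{incidence-nonNeg x e}} ℤ.≤-refl

  ⊖-comm : ∀ D e e′ → (D ⊖ e ⊖ e′) ≗ (D ⊖ e′ ⊖ e)
  ⊖-comm D e e′ x = lemma (D x) (incidence x e) (incidence x e′)
    where
    lemma : ∀ p q r → p ℤ.- q ℤ.- r ≡ p ℤ.- r ℤ.- q
    lemma = solve-∀

  ⊖-cong : ∀ {D D′} e → D ≗ D′ → (D ⊖ e) ≗ (D′ ⊖ e)
  ⊖-cong e D≗D′ x = ≡.cong (ℤ._- incidence x e) (D≗D′ x)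

  Meet : List V → E → E → Set
  Meet vs e e′ = ∃ λ x → x ∈ vs × Inc x e × Inc x e′

  degree : V → List E → ℤ
  degree x S = ℤ.+ length (filter (inc? x) S)

  degree-∷ : ∀ x e S → degree x (e ∷ S) ≡ incidence x e ℤ.+ degree x S
  degree-∷ x e S with does (inc? x e)
  ... | true  = ≡.refl
  ... | false = ≡.sym (ℤ.+-identityˡ _)

module StateSum (K : CommutativeRing 0ℓ 0ℓ) {V E : Set} {Inc : V → E → Set}
                (inc? : ∀ x e → Dec (Inc x e)) (vs : List V) where
  open CommutativeRing K
  open import Relation.Binary.Reasoning.Setoid setoid
  open NaturalSolver commutativeSemiring using (solve; _:=_; _:+_; _:*_; con)

  met? : (D : V → ℤ) → Dec (All (λ x → D x ≡ 0ℤ) vs)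
  met? D = All.all? (λ x → D x ℤ.≟ 0ℤ) vs

  indicator : ∀ {P : Set} → Dec P → Carrier
  indicator p = if does p then 1# else 0#

  indicator-cong : ∀ {P Q : Set} → P ⇔ Q → (p : Dec P) (q : Dec Q) → indicator p ≈ indicator q
  indicator-cong eq p q = reflexive (≡.cong (if_then 1# else 0#) (does-⇔ eq p q))

  -- The weighted number of sets of edges covering each vertex x in vs exactly D x times.
  stateSum : (E → Carrier) → List E → (V → ℤ) → Carrier
  stateSum w []       D = indicator (met? D)
  stateSum w (e ∷ es) D = w e * stateSum w es (_⊖_ inc? D e) + stateSum w es D

  private
    infixl 6 _⊝_
    _⊝_ : (V → ℤ) → E → (V → ℤ)
    _⊝_ = _⊖_ inc?

  module _ (w : E → Carrier) where

    stateSum-cong : ∀ es {D D′} → D ≗ D′ → stateSum w es D ≈ stateSum w es D′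
    stateSum-cong []       {D} {D′} eq = indicator-cong
      (mk⇔ (All.map (≡.trans (≡.sym (eq _)))) (All.map (≡.trans (eq _)))) (met? D) (met? D′)
    stateSum-cong (e ∷ es) eq =
      +-cong (*-congˡ (stateSum-cong es (⊖-cong inc? e eq))) (stateSum-cong es eq)

    stateSum-↭ : ∀ {es es′} → es ↭ es′ → ∀ D → stateSum w es D ≈ stateSum w es′ D
    stateSum-↭ Perm.refl         D = refl
    stateSum-↭ (Perm.prep e p)   D = +-cong (*-congˡ (stateSum-↭ p _)) (stateSum-↭ p D)
    stateSum-↭ {e ∷ e′ ∷ es} {_ ∷ _ ∷ es′} (Perm.swap e e′ p) D = begin
      w e * (w e′ * Y es (D ⊝ e ⊝ e′) + Y es (D ⊝ e)) + (w e′ * Y es (D ⊝ e′) + Y es D)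
        ≈⟨ solve 6 (λ a b y₁ y₂ y₃ y₄ → a :* (b :* y₁ :+ y₂) :+ (b :* y₃ :+ y₄)
                                       := b :* (a :* y₁ :+ y₃) :+ (a :* y₂ :+ y₄)) refl
             (w e) (w e′) (Y es (D ⊝ e ⊝ e′)) (Y es (D ⊝ e)) (Y es (D ⊝ e′)) (Y es D) ⟩
      w e′ * (w e * Y es (D ⊝ e ⊝ e′) + Y es (D ⊝ e′)) + (w e * Y es (D ⊝ e) + Y es D)
        ≈⟨ +-cong (*-congˡ (+-cong (*-congˡ (trans (stateSum-cong es (⊖-comm inc? D e e′))
                                                    (stateSum-↭ p _)))
                                    (stateSum-↭ p _)))
                  (+-cong (*-congˡ (stateSum-↭ p _)) (stateSum-↭ p D)) ⟩
      w e′ * (w e * Y es′ (D ⊝ e′ ⊝ e) + Y es′ (D ⊝ e′)) + (w e * Y es′ (D ⊝ e) + Y es′ D) ∎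
      where Y = stateSum w
    stateSum-↭ (Perm.trans p q) D = trans (stateSum-↭ p D) (stateSum-↭ q D)

    -- Choosing edges only lowers demands, so a negative one is never met.
    stateSum-neg : ∀ es {D x} → x ∈ vs → D x ℤ.< 0ℤ → stateSum w es D ≈ 0#
    stateSum-neg []       {D} x∈vs D<0 with met? D
    ... | yes D≡0 = ⊥-elim (ℤ.<-irrefl (All.lookup D≡0 x∈vs) D<0)
    ... | no _    = refl
    stateSum-neg (e ∷ es) {D} {x} x∈vs D<0 = begin
      w e * stateSum w es (D ⊝ e) + stateSum w es D
        ≈⟨ +-cong (*-congˡ (stateSum-neg es x∈vs (ℤ.≤-<-trans (⊖-≤ inc? D e x) D<0)))
                  (stateSum-neg es x∈vs D<0) ⟩
      w e * 0# + 0#  ≈⟨ +-identityʳ _ ⟩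
      w e * 0#       ≈⟨ zeroʳ _ ⟩
      0#             ∎

    stateSum-skip : ∀ e es {D x} → x ∈ vs → (D ⊝ e) x ℤ.< 0ℤ →
                    stateSum w (e ∷ es) D ≈ stateSum w es D
    stateSum-skip e es x∈vs D<0 =
      trans (+-congʳ (trans (*-congˡ (stateSum-neg es x∈vs D<0)) (zeroʳ _))) (+-identityˡ _)

    -- Once `e` is chosen, the common vertex has demand at most 0, and choosing `e′` too would make
    -- it negative.
    stateSum-skip-meet : ∀ e e′ es {D} → (∀ x → D x ℤ.≤ 1ℤ) → Meet inc? vs e e′ →
                         stateSum w (e′ ∷ es) (D ⊝ e) ≈ stateSum w es (D ⊝ e)
    stateSum-skip-meet e e′ es {D} D≤1 (x , x∈vs , x-e , x-e′) =
      stateSum-skip e′ es x∈vs negative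
      where
      negative : (D ⊝ e ⊝ e′) x ℤ.< 0ℤ
      negative rewrite incidence≡1 inc? x-e | incidence≡1 inc? x-e′ =
        ℤ.≤-<-trans (ℤ.+-monoˡ-≤ (ℤ.- 1ℤ) (ℤ.+-monoˡ-≤ (ℤ.- 1ℤ) (D≤1 x))) ℤ.-<+

    -- This removes the edges at the border, where the complementary demand is 0.
    stateSum-drop : ∀ es₀ es {D} →
                    All (λ e → ∃ λ x → x ∈ vs × Inc x e × D x ≡ 0ℤ) es₀ →
                    stateSum w (es₀ ++ es) D ≈ stateSum w es D
    stateSum-drop []        es         []                         = refl
    stateSum-drop (e ∷ es₀) es {D} ((x , x∈vs , x-e , D≡0) ∷ all) =
      trans (stateSum-skip e (es₀ ++ es) x∈vs negative) (stateSum-drop es₀ es all)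
      where
      negative : (D ⊝ e) x ℤ.< 0ℤ
      negative rewrite incidence≡1 inc? x-e | D≡0 = ℤ.-<+

  sumOver : ∀ {A : Set} → List A → (A → Carrier) → Carrier
  sumOver xs φ = foldr (λ x s → φ x + s) 0# xs

  sumOver-cong : ∀ {A : Set} (xs : List A) {φ ψ : A → Carrier} →
                 (∀ x → φ x ≈ ψ x) → sumOver xs φ ≈ sumOver xs ψ
  sumOver-cong []       eq = refl
  sumOver-cong (x ∷ xs) eq = +-cong (eq x) (sumOver-cong xs eq)

  sumOver-++ : ∀ {A : Set} (xs ys : List A) (φ : A → Carrier) →
               sumOver (xs ++ ys) φ ≈ sumOver xs φ + sumOver ys φ
  sumOver-++ []       ys φ = sym (+-identityˡ _)
  sumOver-++ (x ∷ xs) ys φ = trans (+-congˡ (sumOver-++ xs ys φ)) (sym (+-assoc _ _ _))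

  sumOver-map-* : ∀ {A B : Set} (f : A → B) (xs : List A) (k : Carrier)
                  {φ : B → Carrier} {ψ : A → Carrier} → (∀ x → φ (f x) ≈ k * ψ x) →
                  sumOver (map f xs) φ ≈ k * sumOver xs ψ
  sumOver-map-* f []       k eq = sym (zeroʳ k)
  sumOver-map-* f (x ∷ xs) k eq =
    trans (+-cong (eq x) (sumOver-map-* f xs k eq)) (sym (distribˡ _ _ _))

  sumOver-filter : ∀ {A : Set} {P : A → Set} (P? : ∀ x → Dec (P x)) (φ : A → Carrier) xs →
                   foldr _+_ 0# (map φ (filter P? xs)) ≈ sumOver xs (λ x → indicator (P? x) * φ x)
  sumOver-filter P? φ []       = refl
  sumOver-filter P? φ (x ∷ xs) with does (P? x)
  ... | true  = +-cong (sym (*-identityˡ _)) (sumOver-filter P? φ xs)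
  ... | false = trans (sumOver-filter P? φ xs)
                      (sym (trans (+-congʳ (zeroˡ _)) (+-identityˡ _)))

  Covers : (V → ℤ) → List E → Set
  Covers D S = All (λ x → degree inc? x S ≡ D x) vs

  covers? : ∀ D S → Dec (Covers D S)
  covers? D S = All.all? (λ x → degree inc? x S ℤ.≟ D x) vs

  covers-∷ : ∀ D e S → Covers D (e ∷ S) ⇔ Covers (_⊖_ inc? D e) S
  covers-∷ D e S = mk⇔ (All.map to) (All.map from)
    where
    cancel : ∀ p q → (p ℤ.+ q) ℤ.- p ≡ q
    cancel = solve-∀
    restore : ∀ p q → p ℤ.+ (q ℤ.- p) ≡ q
    restore = solve-∀
    to : ∀ {x} → degree inc? x (e ∷ S) ≡ D x → degree inc? x S ≡ D x ℤ.- incidence inc? x e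
    to {x} eq = ≡.trans (≡.sym (cancel (incidence inc? x e) _))
      (≡.cong (ℤ._- incidence inc? x e) (≡.trans (≡.sym (degree-∷ inc? x e S)) eq))
    from : ∀ {x} → degree inc? x S ≡ D x ℤ.- incidence inc? x e → degree inc? x (e ∷ S) ≡ D x
    from {x} eq = ≡.trans (degree-∷ inc? x e S)
      (≡.trans (≡.cong (ℤ._+_ (incidence inc? x e)) eq) (restore (incidence inc? x e) (D x)))

  open MatchingGeneratingFunction rawRing using (weight)

  -- `subsets` and `stateSum` branch alike on the first edge; a set containing `e` covers `D`
  -- exactly if the rest of it covers `D` lowered by `e`.
  sumOver-subsets : ∀ (w : E → Carrier) es D →
    sumOver (subsets es) (λ S → indicator (covers? D S) * weight w S) ≈ stateSum w es D
  sumOver-subsets w []       D = trans (+-identityʳ _) (trans (*-identityʳ _)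
    (indicator-cong (mk⇔ (All.map ≡.sym) (All.map ≡.sym)) (covers? D []) (met? D)))
  sumOver-subsets w (e ∷ es) D = begin
    sumOver (map (e ∷_) (subsets es) ++ subsets es) φ
      ≈⟨ sumOver-++ (map (e ∷_) (subsets es)) (subsets es) φ ⟩
    sumOver (map (e ∷_) (subsets es)) φ + sumOver (subsets es) φ
      ≈⟨ +-congʳ (sumOver-map-* (e ∷_) (subsets es) (w e) step) ⟩
    w e * sumOver (subsets es) ψ + sumOver (subsets es) φ
      ≈⟨ +-cong (*-congˡ (sumOver-subsets w es (_⊖_ inc? D e))) (sumOver-subsets w es D) ⟩
    stateSum w (e ∷ es) D ∎
    where
    φ ψ : List E → Carrier
    φ S = indicator (covers? D S) * weight w S
    ψ S = indicator (covers? (_⊖_ inc? D e) S) * weight w S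
    step : ∀ S → φ (e ∷ S) ≈ w e * ψ S
    step S = trans
      (*-congʳ (indicator-cong (covers-∷ D e S) (covers? D (e ∷ S)) (covers? (_⊖_ inc? D e) S)))
      (solve 3 (λ i x y → i :* (x :* y) := x :* (i :* y)) refl _ _ _)

module _ (K : CommutativeRing 0ℓ 0ℓ) (G : FiniteGraph) where
  open CommutativeRing K
  open FiniteGraph G
  open StateSum K incident? vertices
  open MatchingGeneratingFunction rawRing

  M≈stateSum : ∀ w → M G w ≈ stateSum w edges (λ _ → 1ℤ)
  M≈stateSum w = trans (sumOver-filter isPerfectMatching? (weight w) (subsets edges))
    (trans (sumOver-cong (subsets edges) (λ S → *-congʳ
             (indicator-cong (perfect⇔covers S) (isPerfectMatching? S) (covers? _ S))))
           (sumOver-subsets w edges _))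
    where
    perfect⇔covers : ∀ S → IsPerfectMatching S ⇔ Covers (λ _ → 1ℤ) S
    perfect⇔covers S = mk⇔
      (λ pm → All.tabulate (λ {x} _ → ≡.cong ℤ.+_ (pm x)))
      (λ all x → ℤ.+-injective (All.lookup all (vertices-complete x)))

-- Summing out the cells, and complementation within them

quadrants : List (Fin 2 × Fin 2)
quadrants = (0F , 0F) ∷ (0F , 1F) ∷ (1F , 0F) ∷ (1F , 1F) ∷ []

-- `corner c` arranges the edges of a 4-cycle in a 2 × 2 array: edges in one row or column of it
-- share a vertex, and its diagonals, the two perfect matchings of the cycle, cover the same
-- vertices.
module CellSum
  (K : CommutativeRing 0ℓ 0ℓ) {V E C : Set} {Inc : V → E → Set}
  (inc? : ∀ x e → Dec (Inc x e)) (vs : List V)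
  (corner : C → Fin 2 → Fin 2 → E)
  (diagonals : ∀ c x → incidence inc? x (corner c 0F 0F) ℤ.+ incidence inc? x (corner c 1F 1F)
                     ≡ incidence inc? x (corner c 0F 1F) ℤ.+ incidence inc? x (corner c 1F 0F))
  (row-meet : ∀ c ρ → Meet inc? vs (corner c ρ 0F) (corner c ρ 1F))
  (col-meet : ∀ c σ → Meet inc? vs (corner c 0F σ) (corner c 1F σ))
  where
  open CommutativeRing K
  open import Relation.Binary.Reasoning.Setoid setoid
  open NaturalSolver commutativeSemiring using (solve; _:=_; _:+_; _:*_; con)
  open StateSum K inc? vs

  private
    infixl 6 _⊝_
    _⊝_ : (V → ℤ) → E → (V → ℤ)
    _⊝_ = _⊖_ inc?

  -- A diagonal covers each vertex of the cell once, so in an Aztec diamond this is the indicator of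
  -- the four vertices of the cell, and `touches` counts the cells at a vertex.
  touch : C → V → ℤ
  touch c x = incidence inc? x (corner c 0F 0F) ℤ.+ incidence inc? x (corner c 1F 1F)

  touches : List C → V → ℤ
  touches cs x = foldr (λ c t → touch c x ℤ.+ t) 0ℤ cs

  cellEdges : List C → List E
  cellEdges cs = map (λ (c , ρ , σ) → corner c ρ σ) (cartesianProduct cs quadrants)

  cellFactor : (E → Carrier) → C → Carrier
  cellFactor w c = w (corner c 0F 0F) * w (corner c 1F 1F) + w (corner c 0F 1F) * w (corner c 1F 0F)

  cellProduct : (E → Carrier) → List C → Carrier
  cellProduct w = foldr (λ c p → cellFactor w c * p) 1#

  -- The state sum with the edges of each cell summed out: a cell covers none of its four
  -- vertices, the two ends of one of its edges, or all four.
  cellSum : (E → Carrier) → List C → (V → ℤ) → Carrier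
  cellSum w []       D = stateSum w [] D
  cellSum w (c ∷ cs) D =
    cellSum w cs D
    + (w (corner c 0F 0F) * cellSum w cs (D ⊝ corner c 0F 0F)
       + w (corner c 0F 1F) * cellSum w cs (D ⊝ corner c 0F 1F)
       + w (corner c 1F 0F) * cellSum w cs (D ⊝ corner c 1F 0F)
       + w (corner c 1F 1F) * cellSum w cs (D ⊝ corner c 1F 1F))
    + cellFactor w c * cellSum w cs (λ x → D x ℤ.- touch c x)

  -- Of the 16 sets of edges of a cell, those with two edges at a common vertex contribute 0,
  -- because its demand is at most 1. There remain the empty set, the four single edges, and the two
  -- diagonals, which leave the same demand and combine into `cellFactor`.
  stateSum≈cellSum : ∀ w cs {D} → (∀ x → D x ℤ.≤ 1ℤ) →
                     stateSum w (cellEdges cs) D ≈ cellSum w cs D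
  stateSum≈cellSum w []       D≤1     = refl
  stateSum≈cellSum w (c ∷ cs) {D} D≤1 = begin
    w₀₀ * Y (e₀₁ ∷ e₁₀ ∷ e₁₁ ∷ es) (D ⊝ e₀₀)
    + (w₀₁ * Y (e₁₀ ∷ e₁₁ ∷ es) (D ⊝ e₀₁)
       + (w₁₀ * Y (e₁₁ ∷ es) (D ⊝ e₁₀) + (w₁₁ * Y es (D ⊝ e₁₁) + Y es D)))
      ≈⟨ +-cong (*-congˡ (trans (skip e₀₀ e₀₁ (e₁₀ ∷ e₁₁ ∷ es) (row-meet c 0F))
                         (trans (skip e₀₀ e₁₀ (e₁₁ ∷ es) (col-meet c 0F))
                                (+-cong (*-congˡ (trans (stateSum-cong w es bothDiagonals) (IH-cell)))
                                        (IH e₀₀)))))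
        (+-cong (*-congˡ (+-cong (*-congˡ (trans (skip-⊝ e₀₁ e₁₀ e₁₁ (col-meet c 1F))
                                          (trans (stateSum-cong w es otherDiagonals) IH-cell)))
                                 (trans (skip e₀₁ e₁₁ es (col-meet c 1F)) (IH e₀₁))))
        (+-cong (*-congˡ (trans (skip e₁₀ e₁₁ es (row-meet c 1F)) (IH e₁₀)))
        (+-cong (*-congˡ (IH e₁₁)) (stateSum≈cellSum w cs D≤1)))) ⟩
    w₀₀ * (w₁₁ * Zc + Z e₀₀) + (w₀₁ * (w₁₀ * Zc + Z e₀₁)
      + (w₁₀ * Z e₁₀ + (w₁₁ * Z e₁₁ + cellSum w cs D)))
      ≈⟨ solve 10 (λ a b c d zc za zb zd ze z →
           a :* (d :* zc :+ za) :+ (b :* (c :* zc :+ zb) :+ (c :* zd :+ (d :* ze :+ z)))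
           := z :+ (a :* za :+ b :* zb :+ c :* zd :+ d :* ze) :+ (a :* d :+ b :* c) :* zc) refl
           w₀₀ w₀₁ w₁₀ w₁₁ Zc (Z e₀₀) (Z e₀₁) (Z e₁₀) (Z e₁₁) (cellSum w cs D) ⟩
    cellSum w (c ∷ cs) D ∎
    where
    e₀₀ = corner c 0F 0F
    e₀₁ = corner c 0F 1F
    e₁₀ = corner c 1F 0F
    e₁₁ = corner c 1F 1F
    w₀₀ = w e₀₀
    w₀₁ = w e₀₁
    w₁₀ = w e₁₀
    w₁₁ = w e₁₁
    es = cellEdges cs
    Y = stateSum w
    Dc : V → ℤ
    Dc x = D x ℤ.- touch c x
    Z : E → Carrier
    Z e = cellSum w cs (D ⊝ e)
    Zc = cellSum w cs Dc
    ⊝≤1 : ∀ {D′} → (∀ x → D′ x ℤ.≤ 1ℤ) → ∀ e x → (D′ ⊝ e) x ℤ.≤ 1ℤ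
    ⊝≤1 {D′} D′≤1 e x = ℤ.≤-trans (⊖-≤ inc? D′ e x) (D′≤1 x)
    IH : ∀ e → Y es (D ⊝ e) ≈ Z e
    IH e = stateSum≈cellSum w cs (⊝≤1 D≤1 e)
    skip : ∀ e e′ es′ → Meet inc? vs e e′ → Y (e′ ∷ es′) (D ⊝ e) ≈ Y es′ (D ⊝ e)
    skip e e′ es′ = stateSum-skip-meet w e e′ es′ D≤1
    -- D ⊝ e ⊝ e′ must be reordered before e and the last edge can be seen to meet.
    skip-⊝ : ∀ e e′ e″ → Meet inc? vs e e″ → Y (e″ ∷ es) (D ⊝ e ⊝ e′) ≈ Y es (D ⊝ e ⊝ e′)
    skip-⊝ e e′ e″ meet =
      trans (stateSum-cong w (e″ ∷ es) (⊖-comm inc? D e e′))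
      (trans (stateSum-skip-meet w e e″ es (⊝≤1 D≤1 e′) meet)
             (stateSum-cong w es (⊖-comm inc? D e′ e)))
    regroup : ∀ d i j → d ℤ.- i ℤ.- j ≡ d ℤ.- (i ℤ.+ j)
    regroup = solve-∀
    bothDiagonals : (D ⊝ e₀₀ ⊝ e₁₁) ≗ Dc
    bothDiagonals x = regroup (D x) _ _
    otherDiagonals : (D ⊝ e₀₁ ⊝ e₁₀) ≗ Dc
    otherDiagonals x = ≡.trans (regroup (D x) _ _) (≡.cong (λ t → D x ℤ.- t) (≡.sym (diagonals c x)))
    IH-cell : Y es Dc ≈ Zc
    IH-cell = stateSum≈cellSum w cs λ x →
      ≡.subst (ℤ._≤ 1ℤ) (bothDiagonals x) (⊝≤1 (⊝≤1 D≤1 e₀₀) e₁₁ x)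

  -- Complementing the vertices covered in a cell turns an edge into the opposite one and a full
  -- cell into an empty one. The division by the cell factor Δ is written as a multiplication. It
  -- makes the dual cell factor Δ / Δ² = 1 / Δ, and Δ Δ′ = 1 is what matches an empty cell with a
  -- full one.
  record Dual (w w′ : E → Carrier) : Set where
    field
      opposites : ∀ c ρ σ → cellFactor w c * w′ (corner c ρ σ) ≈ w (corner c (opposite ρ) (opposite σ))
      factors   : ∀ c → cellFactor w c * cellFactor w′ c ≈ 1#

  -- Complementing, in every cell, the set of vertices it covers.
  cellSum-dual : ∀ {w w′} → Dual w w′ → ∀ cs {D D′} → (∀ x → D x ℤ.+ D′ x ≡ touches cs x) →
                 cellSum w cs D ≈ cellProduct w cs * cellSum w′ cs D′
  cellSum-dual {w} {w′} dual []       {D} {D′} D+D′ = trans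
    (indicator-cong (mk⇔ (All.map (transfer D D′ D+D′)) (All.map (transfer D′ D D′+D))) (met? D) (met? D′))
    (sym (*-identityˡ _))
    where
    D′+D : ∀ x → D′ x ℤ.+ D x ≡ 0ℤ
    D′+D x = ≡.trans (ℤ.+-comm (D′ x) (D x)) (D+D′ x)
    transfer : ∀ F F′ → (∀ x → F x ℤ.+ F′ x ≡ 0ℤ) → ∀ {x} → F x ≡ 0ℤ → F′ x ≡ 0ℤ
    transfer F F′ F+F′ {x} F≡0 =
      ≡.trans (≡.sym (ℤ.+-identityˡ _)) (≡.trans (≡.cong (ℤ._+ F′ x) (≡.sym F≡0)) (F+F′ x))
  cellSum-dual {w} {w′} dual (c ∷ cs) {D} {D′} D+D′ = begin
    Z D + (w₀₀ * Z (D ⊝ e₀₀) + w₀₁ * Z (D ⊝ e₀₁) + w₁₀ * Z (D ⊝ e₁₀) + w₁₁ * Z (D ⊝ e₁₁)) + Δ * Z Dc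
      ≈⟨ +-cong (+-cong (trans (IH empty) (sym (trans (*-congʳ (Dual.factors dual c)) (*-identityˡ _))))
                (+-cong (+-cong (+-cong
                  (*-cong (sym (Dual.opposites dual c 1F 1F)) (IH (single e₀₀ e₁₁ ≡.refl)))
                  (*-cong (sym (Dual.opposites dual c 1F 0F)) (IH (single e₀₁ e₁₀ diagonals′))))
                  (*-cong (sym (Dual.opposites dual c 0F 1F)) (IH (single e₁₀ e₀₁ diagonals″))))
                  (*-cong (sym (Dual.opposites dual c 0F 0F)) (IH (single e₁₁ e₀₀ diagonals‴)))))
                (*-congˡ (IH full)) ⟩
    (Δ * Δ′) * (P * Z′ D′c) + ((Δ * w′₁₁) * (P * Z′ (D′ ⊝ e₁₁)) + (Δ * w′₁₀) * (P * Z′ (D′ ⊝ e₁₀))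
        + (Δ * w′₀₁) * (P * Z′ (D′ ⊝ e₀₁)) + (Δ * w′₀₀) * (P * Z′ (D′ ⊝ e₀₀)))
      + Δ * (P * Z′ D′)
      ≈⟨ solve 13 (λ δ δ′ p w′₁₁ w′₁₀ w′₀₁ w′₀₀ zc z₁₁ z₁₀ z₀₁ z₀₀ z →
           (δ :* δ′) :* (p :* zc) :+ ((δ :* w′₁₁) :* (p :* z₁₁) :+ (δ :* w′₁₀) :* (p :* z₁₀)
             :+ (δ :* w′₀₁) :* (p :* z₀₁) :+ (δ :* w′₀₀) :* (p :* z₀₀)) :+ δ :* (p :* z)
           := (δ :* p) :* (z :+ (w′₀₀ :* z₀₀ :+ w′₀₁ :* z₀₁ :+ w′₁₀ :* z₁₀ :+ w′₁₁ :* z₁₁) :+ δ′ :* zc))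
           refl Δ Δ′ P w′₁₁ w′₁₀ w′₀₁ w′₀₀ (Z′ D′c) (Z′ (D′ ⊝ e₁₁)) (Z′ (D′ ⊝ e₁₀)) (Z′ (D′ ⊝ e₀₁))
             (Z′ (D′ ⊝ e₀₀)) (Z′ D′) ⟩
    cellProduct w (c ∷ cs) * cellSum w′ (c ∷ cs) D′ ∎
    where
    e₀₀ = corner c 0F 0F
    e₀₁ = corner c 0F 1F
    e₁₀ = corner c 1F 0F
    e₁₁ = corner c 1F 1F
    w₀₀ = w e₀₀
    w₀₁ = w e₀₁
    w₁₀ = w e₁₀
    w₁₁ = w e₁₁
    w′₀₀ = w′ e₀₀
    w′₀₁ = w′ e₀₁
    w′₁₀ = w′ e₁₀
    w′₁₁ = w′ e₁₁
    Z = cellSum w cs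
    Z′ = cellSum w′ cs
    P = cellProduct w cs
    Δ = cellFactor w c
    Δ′ = cellFactor w′ c
    Dc D′c : V → ℤ
    Dc x = D x ℤ.- touch c x
    D′c x = D′ x ℤ.- touch c x
    IH : ∀ {F F′} → (∀ x → F x ℤ.+ F′ x ≡ touches cs x) → Z F ≈ P * Z′ F′
    IH = cellSum-dual dual cs
    cancel : ∀ t s → (t ℤ.+ s) ℤ.- t ≡ s
    cancel = solve-∀
    rest : ∀ x → (D x ℤ.+ D′ x) ℤ.- touch c x ≡ touches cs x
    rest x = ≡.trans (≡.cong (ℤ._- touch c x) (D+D′ x)) (cancel (touch c x) _)
    empty : ∀ x → D x ℤ.+ D′c x ≡ touches cs x
    empty x = ≡.trans (lemma (D x) (D′ x) (touch c x)) (rest x)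
      where
      lemma : ∀ p q t → p ℤ.+ (q ℤ.- t) ≡ (p ℤ.+ q) ℤ.- t
      lemma = solve-∀
    full : ∀ x → Dc x ℤ.+ D′ x ≡ touches cs x
    full x = ≡.trans (lemma (D x) (D′ x) (touch c x)) (rest x)
      where
      lemma : ∀ p q t → (p ℤ.- t) ℤ.+ q ≡ (p ℤ.+ q) ℤ.- t
      lemma = solve-∀
    single : ∀ e e′ → (∀ {x} → incidence inc? x e ℤ.+ incidence inc? x e′ ≡ touch c x) →
             ∀ x → (D ⊝ e) x ℤ.+ (D′ ⊝ e′) x ≡ touches cs x
    single e e′ eq x = ≡.trans
      (lemma (D x) (D′ x) (incidence inc? x e) (incidence inc? x e′))
      (≡.trans (≡.cong (λ t → D x ℤ.+ D′ x ℤ.- t) eq) (rest x))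
      where
      lemma : ∀ p q i j → (p ℤ.- i) ℤ.+ (q ℤ.- j) ≡ (p ℤ.+ q) ℤ.- (i ℤ.+ j)
      lemma = solve-∀
    diagonals′ : ∀ {x} → incidence inc? x e₀₁ ℤ.+ incidence inc? x e₁₀ ≡ touch c x
    diagonals′ {x} = ≡.sym (diagonals c x)
    diagonals″ : ∀ {x} → incidence inc? x e₁₀ ℤ.+ incidence inc? x e₀₁ ≡ touch c x
    diagonals″ {x} = ≡.trans (ℤ.+-comm _ (incidence inc? x e₀₁)) diagonals′
    diagonals‴ : ∀ {x} → incidence inc? x e₁₁ ℤ.+ incidence inc? x e₀₀ ≡ touch c x
    diagonals‴ {x} = ℤ.+-comm _ (incidence inc? x e₀₀)

-- Aztec diamonds

complete-unique-↭ : ∀ {A : Set} {xs ys : List A} → Unique xs → Unique ys →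
                    (∀ x → x ∈ xs) → (∀ x → x ∈ ys) → xs ↭ ys
complete-unique-↭ uxs uys cxs cys =
  ∼bag⇒↭ (unique∧set⇒bag uxs uys (mk⇔ (λ _ → cys _) (λ _ → cxs _)))

module Transport
  (K : CommutativeRing 0ℓ 0ℓ) {V E V′ E′ : Set} {Inc : V → E → Set} {Inc′ : V′ → E′ → Set}
  (inc? : ∀ x e → Dec (Inc x e)) (vs : List V)
  (inc′? : ∀ x e → Dec (Inc′ x e)) (vs′ : List V′)
  (κ : V → V′) (ι : E → E′)
  (compatible : ∀ x e → Inc x e ⇔ Inc′ (κ x) (ι e))
  (inside : ∀ {x} → x ∈ vs → κ x ∈ vs′)
  (Outside : V′ → Set)
  (outside : ∀ x′ → (∃ λ x → x ∈ vs × x′ ≡ κ x) ⊎ Outside x′)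
  (untouched : ∀ {x′} → Outside x′ → ∀ e → ¬ Inc′ x′ (ι e))
  where
  open CommutativeRing K
  open StateSum K

  -- No edge `ι e` reaches an outside vertex, so the demand 0 there stays met however the edges are
  -- chosen.
  transport : ∀ (w : E′ → Carrier) es {D D′} → (∀ x → D′ (κ x) ≡ D x) →
              (∀ {x′} → Outside x′ → D′ x′ ≡ 0ℤ) →
              stateSum inc′? vs′ w (map ι es) D′ ≈ stateSum inc? vs (w ∘ ι) es D
  transport w [] {D} {D′} D′κ≡D D′≡0 =
    indicator-cong inc? vs (mk⇔ to from) (met? inc′? vs′ D′) (met? inc? vs D)
    where
    to : All (λ x → D′ x ≡ 0ℤ) vs′ → All (λ x → D x ≡ 0ℤ) vs
    to all = All.tabulate λ {x} x∈vs → ≡.trans (≡.sym (D′κ≡D x)) (All.lookup all (inside x∈vs))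
    from : All (λ x → D x ≡ 0ℤ) vs → All (λ x → D′ x ≡ 0ℤ) vs′
    from all = All.tabulate λ {x′} _ → [ (λ (x , x∈vs , x′≡κx) →
      ≡.trans (≡.cong D′ x′≡κx) (≡.trans (D′κ≡D x) (All.lookup all x∈vs))) , D′≡0 ]′ (outside x′)
  transport w (e ∷ es) {D} {D′} D′κ≡D D′≡0 = +-cong
    (*-congˡ (transport w es
      (λ x → ≡.cong₂ ℤ._-_ (D′κ≡D x)
        (≡.cong (if_then 1ℤ else 0ℤ)
          (≡.sym (does-⇔ (compatible x e) (inc? x e) (inc′? (κ x) (ι e))))))
      (λ out → ≡.cong₂ ℤ._-_ (D′≡0 out) (incidence≡0 inc′? (untouched out e)))))
    (transport w es D′κ≡D D′≡0)

module _ {A V : Set} (_≟_ : DecidableEquality V) where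

  count : (A → V) → List A → V → ℤ
  count φ as x = foldr (λ a s → incidence (λ x a → x ≟ φ a) x a ℤ.+ s) 0ℤ as

  count≡0 : ∀ φ as {x : V} → (∀ a → x ≢ φ a) → count φ as x ≡ 0ℤ
  count≡0 φ []       x≢ = ≡.refl
  count≡0 φ (a ∷ as) x≢ =
    ≡.cong₂ ℤ._+_ (incidence≡0 (λ x a → x ≟ φ a) (x≢ a)) (count≡0 φ as x≢)

  private
    count∉≡0 : ∀ φ as {x} → (∀ {a} → a ∈ as → x ≢ φ a) → count φ as x ≡ 0ℤ
    count∉≡0 φ []       x≢ = ≡.refl
    count∉≡0 φ (a ∷ as) x≢ = ≡.cong₂ ℤ._+_
      (incidence≡0 (λ x a → x ≟ φ a) (x≢ (here ≡.refl))) (count∉≡0 φ as (x≢ ∘ there))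

  count≡1 : ∀ φ → (∀ {a b} → φ a ≡ φ b → a ≡ b) → ∀ {as} → Unique as →
            ∀ {a} → a ∈ as → count φ as (φ a) ≡ 1ℤ
  count≡1 φ inj {a ∷ as} (a∉as ∷ _) (here ≡.refl) = ≡.cong₂ ℤ._+_
    (incidence≡1 (λ x a → x ≟ φ a) ≡.refl)
    (count∉≡0 φ as (λ b∈as φa≡φb → All.lookup a∉as b∈as (inj φa≡φb)))
  count≡1 φ inj {b ∷ as} (b∉as ∷ uas) (there a∈as) = ≡.cong₂ ℤ._+_
    (incidence≡0 (λ x a → x ≟ φ a) (λ φa≡φb → All.lookup b∉as a∈as (≡.sym (inj φa≡φb))))
    (count≡1 φ inj uas a∈as)

-- The cells of an Aztec diamond and the smaller diamond inside it

Cell : ℕ → Set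
Cell n = Fin n × Fin n

cells : ∀ n → List (Cell n)
cells n = cartesianProduct (allFin n) (allFin n)

cells-unique : ∀ n → Unique (cells n)
cells-unique n = cartesianProduct⁺ (allFin⁺ n) (allFin⁺ n)

∈-cells : ∀ {n} (c : Cell n) → c ∈ cells n
∈-cells (i , j) = ∈-cartesianProduct⁺ (∈-allFin i) (∈-allFin j)

corner : ∀ {n} → Cell n → Fin 2 → Fin 2 → AztecEdge n
corner (i , j) ρ σ = combine i ρ , combine j σ

horizontal vertical : ∀ {n} → Fin 2 → Cell n → AztecVertex n
horizontal ρ (i , j) = u (i ⊹ ρ) j
vertical   σ (i , j) = v i (j ⊹ σ)

ends-corner : ∀ {n} (c : Cell n) ρ σ → aztecEnds (corner c ρ σ) ≡ (horizontal ρ c , vertical σ c)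
ends-corner (i , j) ρ σ =
  ≡.cong₂ (λ (i , ρ) (j , σ) → u (i ⊹ ρ) j , v i (j ⊹ σ))
    (Fin.remQuot-combine i ρ) (Fin.remQuot-combine j σ)

⊹-injective : ∀ {n} ρ {i j : Fin n} → i ⊹ ρ ≡ j ⊹ ρ → i ≡ j
⊹-injective 0F = Fin.inject₁-injective
⊹-injective 1F = Fin.suc-injective

horizontal-injective : ∀ {n} ρ {c c′ : Cell n} → horizontal ρ c ≡ horizontal ρ c′ → c ≡ c′
horizontal-injective ρ eq =
  let eq₁ , eq₂ = Product.,-injective (inj₁-injective eq) in ≡.cong₂ _,_ (⊹-injective ρ eq₁) eq₂

vertical-injective : ∀ {n} σ {c c′ : Cell n} → vertical σ c ≡ vertical σ c′ → c ≡ c′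
vertical-injective σ eq =
  let eq₁ , eq₂ = Product.,-injective (inj₂-injective eq) in ≡.cong₂ _,_ eq₁ (⊹-injective σ eq₂)

shift : ∀ m → Fin (m · 2) → Fin (suc m · 2)
shift m r = inject₁ (suc r)

-- Rows are paired into cells from the top, so moving down by one row changes the position within
-- the pair, and the lower row of a pair moves into the next pair.
shift-combine : ∀ {m} (i : Fin m) ρ → shift m (combine i ρ) ≡ combine (i ⊹ ρ) (opposite ρ)
shift-combine zero    0F = ≡.refl
shift-combine zero    1F = ≡.refl
shift-combine (suc i) 0F = ≡.cong (λ k → suc (suc k)) (shift-combine i 0F)
shift-combine (suc i) 1F = ≡.cong (λ k → suc (suc k)) (shift-combine i 1F)

remQuot-shift : ∀ {m} (r : Fin (m · 2)) → let (i , ρ) = remQuot {m} 2 r in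
                remQuot {suc m} 2 (shift m r) ≡ (i ⊹ ρ , opposite ρ)
remQuot-shift {m} r with i , ρ , ≡.refl ← Fin.combine-surjective {m} {2} r =
  ≡.trans (≡.cong (remQuot {suc m} 2) (shift-combine i ρ))
  (≡.trans (Fin.remQuot-combine (i ⊹ ρ) (opposite ρ))
           (≡.cong (λ (i , ρ) → i ⊹ ρ , opposite ρ) (≡.sym (Fin.remQuot-combine i ρ))))

-- AD m sits inside AD (suc m), avoiding the border; the embedding interchanges the two
-- kinds of vertices.
embedVertex : ∀ {m} → AztecVertex m → AztecVertex (suc m)
embedVertex (u i j) = v i (inject₁ (suc j))
embedVertex (v i j) = u (inject₁ (suc i)) j

embedEdge : ∀ m → AztecEdge m → AztecEdge (suc m)
embedEdge m (r , s) = shift m r , shift m s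

⊹-opposite : ∀ {n} (i : Fin n) ρ → (i ⊹ ρ) ⊹ opposite ρ ≡ inject₁ (suc i)
⊹-opposite i 0F = ≡.refl
⊹-opposite i 1F = ≡.refl

ends-embed : ∀ {m} (e : AztecEdge m) → let (x , y) = aztecEnds e in
             aztecEnds (embedEdge m e) ≡ (embedVertex y , embedVertex x)
ends-embed {m} (r , s) =
  let (i , ρ) = remQuot {m} 2 r
      (j , σ) = remQuot {m} 2 s
  in ≡.trans
    (≡.cong₂ (λ (i , ρ) (j , σ) → u (i ⊹ ρ) j , v i (j ⊹ σ)) (remQuot-shift {m} r) (remQuot-shift {m} s))
    (≡.cong₂ (λ i′ j′ → u i′ (j ⊹ σ) , v (i ⊹ ρ) j′) (⊹-opposite i ρ) (⊹-opposite j σ))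

embedVertex-injective : ∀ {m} {x y : AztecVertex m} → embedVertex x ≡ embedVertex y → x ≡ y
embedVertex-injective {x = u i j} {u i′ j′} eq =
  let eq₁ , eq₂ = Product.,-injective (inj₂-injective eq)
  in ≡.cong₂ u eq₁ (Fin.suc-injective (Fin.inject₁-injective eq₂))
embedVertex-injective {x = v i j} {v i′ j′} eq =
  let eq₁ , eq₂ = Product.,-injective (inj₁-injective eq)
  in ≡.cong₂ v (Fin.suc-injective (Fin.inject₁-injective eq₁)) eq₂

embedEdge-injective : ∀ m {e e′ : AztecEdge m} → embedEdge m e ≡ embedEdge m e′ → e ≡ e′
embedEdge-injective m eq =
  let eq₁ , eq₂ = Product.,-injective eq
  in ≡.cong₂ _,_ (Fin.suc-injective (Fin.inject₁-injective eq₁)) (Fin.suc-injective (Fin.inject₁-injective eq₂))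

data Border {m} : AztecVertex (suc m) → Set where
  top    : ∀ j → Border (u zero j)
  bottom : ∀ j → Border (u (fromℕ (suc m)) j)
  left   : ∀ i → Border (v i zero)
  right  : ∀ i → Border (v i (fromℕ (suc m)))

interior⊎border : ∀ {m} (x : AztecVertex (suc m)) → (∃ λ y → x ≡ embedVertex y) ⊎ Border x
interior⊎border (u k j) with view k
... | ‵fromℕ           = inj₂ (bottom j)
... | ‵inject₁ zero    = inj₂ (top j)
... | ‵inject₁ (suc i) = inj₁ (v i j , ≡.refl)
interior⊎border (v i k) with view k
... | ‵fromℕ           = inj₂ (right i)
... | ‵inject₁ zero    = inj₂ (left i)
... | ‵inject₁ (suc j) = inj₁ (u i j , ≡.refl)

combine-fromℕ : ∀ m → combine (fromℕ m) 1F ≡ fromℕ (suc (m · 2))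
combine-fromℕ zero    = ≡.refl
combine-fromℕ (suc m) = ≡.cong (λ k → suc (suc k)) (combine-fromℕ m)

remQuot-fromℕ : ∀ m → remQuot {suc m} 2 (fromℕ (suc (m · 2))) ≡ (fromℕ m , 1F)
remQuot-fromℕ m =
  ≡.trans (≡.cong (remQuot {suc m} 2) (≡.sym (combine-fromℕ m))) (Fin.remQuot-combine (fromℕ m) 1F)

embed≢border : ∀ {m} {x : AztecVertex (suc m)} → Border x → ∀ y → x ≢ embedVertex y
embed≢border (bottom j) (v i j′) eq = Fin.fromℕ≢inject₁ (proj₁ (Product.,-injective (inj₁-injective eq)))
embed≢border (right i)  (u i′ j) eq = Fin.fromℕ≢inject₁ (proj₂ (Product.,-injective (inj₂-injective eq)))

module _ (n : ℕ) where
  open FiniteGraph (AD n) using (vertices; edges; edges-unique; incident?; vertices-complete; edges-complete)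
    renaming (Incident to Inc; _≟_ to _≟ᵛ_)

  -- The ends of an edge are of different kinds, so `x` equals at most one of them and the
  -- disjunction in `Inc` becomes a sum.
  incidence-corner : ∀ x (c : Cell n) ρ σ → incidence incident? x (corner c ρ σ)
    ≡ incidence (λ x c → x ≟ᵛ horizontal ρ c) x c ℤ.+ incidence (λ x c → x ≟ᵛ vertical σ c) x c
  incidence-corner x c ρ σ = ≡.trans (≡.cong (λ (y , z) →
      if does ((x ≟ᵛ y) ⊎-dec (x ≟ᵛ z)) then 1ℤ else 0ℤ) (ends-corner c ρ σ)) (sum x)
    where
    sum : ∀ x → (if does ((x ≟ᵛ horizontal ρ c) ⊎-dec (x ≟ᵛ vertical σ c)) then 1ℤ else 0ℤ)
      ≡ incidence (λ x c → x ≟ᵛ horizontal ρ c) x c ℤ.+ incidence (λ x c → x ≟ᵛ vertical σ c) x c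
    sum x@(u _ _) with does (x ≟ᵛ horizontal ρ c)
    ... | true  = ≡.refl
    ... | false = ≡.refl
    sum x@(v _ _) with does (x ≟ᵛ vertical σ c)
    ... | true  = ≡.refl
    ... | false = ≡.refl

  private
    h₀ h₁ k₀ k₁ : AztecVertex n → Cell n → ℤ
    h₀ = incidence (λ x c → x ≟ᵛ horizontal 0F c)
    h₁ = incidence (λ x c → x ≟ᵛ horizontal 1F c)
    k₀ = incidence (λ x c → x ≟ᵛ vertical 0F c)
    k₁ = incidence (λ x c → x ≟ᵛ vertical 1F c)

  diagonals : ∀ (c : Cell n) x →
    incidence incident? x (corner c 0F 0F) ℤ.+ incidence incident? x (corner c 1F 1F)
    ≡ incidence incident? x (corner c 0F 1F) ℤ.+ incidence incident? x (corner c 1F 0F)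
  diagonals c x rewrite incidence-corner x c 0F 0F | incidence-corner x c 0F 1F
                      | incidence-corner x c 1F 0F | incidence-corner x c 1F 1F =
    lemma (h₀ x c) (k₀ x c) (h₁ x c) (k₁ x c)
    where
    lemma : ∀ p q r s → (p ℤ.+ q) ℤ.+ (r ℤ.+ s) ≡ (p ℤ.+ s) ℤ.+ (r ℤ.+ q)
    lemma = solve-∀

  row-meet : ∀ (c : Cell n) ρ → Meet incident? vertices (corner c ρ 0F) (corner c ρ 1F)
  row-meet c ρ = horizontal ρ c , vertices-complete _ ,
    inj₁ (≡.sym (≡.cong proj₁ (ends-corner c ρ 0F))) , inj₁ (≡.sym (≡.cong proj₁ (ends-corner c ρ 1F)))

  col-meet : ∀ (c : Cell n) σ → Meet incident? vertices (corner c 0F σ) (corner c 1F σ)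
  col-meet c σ = vertical σ c , vertices-complete _ ,
    inj₂ (≡.sym (≡.cong proj₂ (ends-corner c 0F σ))) , inj₂ (≡.sym (≡.cong proj₂ (ends-corner c 1F σ)))

  module Aztec (K : CommutativeRing 0ℓ 0ℓ) =
    CellSum K incident? vertices corner diagonals row-meet col-meet

  module _ (K : CommutativeRing 0ℓ 0ℓ) where
    open Aztec K

    -- The edges of a diagonal have all four vertices of the cell as ends, two `horizontal` and two
    -- `vertical`. Each of these four maps is injective on cells, which makes the separate counts
    -- easy to evaluate.
    touches-count : ∀ cs x → touches cs x ≡
      (count _≟ᵛ_ (horizontal 0F) cs x ℤ.+ count _≟ᵛ_ (horizontal 1F) cs x)
      ℤ.+ (count _≟ᵛ_ (vertical 0F) cs x ℤ.+ count _≟ᵛ_ (vertical 1F) cs x)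
    touches-count []       x = ≡.refl
    touches-count (c ∷ cs) x rewrite incidence-corner x c 0F 0F | incidence-corner x c 1F 1F
                                   | touches-count cs x =
      lemma (h₀ x c) (k₀ x c) (h₁ x c) (k₁ x c) _ _ _ _
      where
      lemma : ∀ p q r s a b c d → ((p ℤ.+ q) ℤ.+ (r ℤ.+ s)) ℤ.+ ((a ℤ.+ b) ℤ.+ (c ℤ.+ d))
        ≡ ((p ℤ.+ a) ℤ.+ (r ℤ.+ b)) ℤ.+ ((q ℤ.+ c) ℤ.+ (s ℤ.+ d))
      lemma = solve-∀

    cellEdges↭edges : cellEdges (cells n) ↭ edges
    cellEdges↭edges = complete-unique-↭
      (map⁺ corner-injective (cartesianProduct⁺ (cells-unique n) quadrants-unique))
      edges-unique complete edges-complete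
      where
      corner-injective : ∀ {p q : Cell n × Fin 2 × Fin 2} →
        (let (c , ρ , σ) = p in corner c ρ σ) ≡ (let (c , ρ , σ) = q in corner c ρ σ) → p ≡ q
      corner-injective {(i , j) , ρ , σ} {(i′ , j′) , ρ′ , σ′} eq
        with eq₁ , eq₂ ← Product.,-injective eq
        with ≡.refl , ≡.refl ← Fin.combine-injective i ρ i′ ρ′ eq₁
           | ≡.refl , ≡.refl ← Fin.combine-injective j σ j′ σ′ eq₂ = ≡.refl
      quadrants-unique : Unique quadrants
      quadrants-unique = cartesianProduct⁺ (allFin⁺ 2) (allFin⁺ 2)
      complete : ∀ e → e ∈ cellEdges (cells n)
      complete (r , s) with i , ρ , ≡.refl ← Fin.combine-surjective {n} {2} r
                          | j , σ , ≡.refl ← Fin.combine-surjective {n} {2} s =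
        ∈-map⁺ _ (∈-cartesianProduct⁺ (∈-cells (i , j))
                   (∈-cartesianProduct⁺ {xs = allFin 2} {allFin 2} (∈-allFin ρ) (∈-allFin σ)))

-- The reduction from order m + 1 to order m

module _ (K : CommutativeRing 0ℓ 0ℓ) (m : ℕ) where
  open CommutativeRing K using (Carrier; _≈_; _*_; setoid; *-congˡ)
  open Aztec (suc m) K
  open StateSum K
  open MatchingGeneratingFunction (CommutativeRing.rawRing K) using (M)
  open import Relation.Binary.Reasoning.Setoid setoid

  private
    module G  = FiniteGraph (AD m)
    module G⁺ = FiniteGraph (AD (suc m))

    touches≡ : ∀ x {p q r s} →
      count G⁺._≟_ (horizontal 0F) (cells (suc m)) x ≡ p →
      count G⁺._≟_ (horizontal 1F) (cells (suc m)) x ≡ q →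
      count G⁺._≟_ (vertical 0F) (cells (suc m)) x ≡ r →
      count G⁺._≟_ (vertical 1F) (cells (suc m)) x ≡ s →
      touches (cells (suc m)) x ≡ (p ℤ.+ q) ℤ.+ (r ℤ.+ s)
    touches≡ x p q r s = ≡.trans (touches-count (suc m) K (cells (suc m)) x)
      (≡.cong₂ ℤ._+_ (≡.cong₂ ℤ._+_ p q) (≡.cong₂ ℤ._+_ r s))

    none : ∀ x φ → (∀ c → x ≢ φ c) → count G⁺._≟_ φ (cells (suc m)) x ≡ 0ℤ
    none x φ = count≡0 G⁺._≟_ φ (cells (suc m))

    oneʰ : ∀ ρ c → count G⁺._≟_ (horizontal ρ) (cells (suc m)) (horizontal ρ c) ≡ 1ℤ
    oneʰ ρ c = count≡1 G⁺._≟_ (horizontal ρ) (horizontal-injective ρ) (cells-unique (suc m)) (∈-cells c)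

    oneᵛ : ∀ σ c → count G⁺._≟_ (vertical σ) (cells (suc m)) (vertical σ c) ≡ 1ℤ
    oneᵛ σ c = count≡1 G⁺._≟_ (vertical σ) (vertical-injective σ) (cells-unique (suc m)) (∈-cells c)

  touches-interior : ∀ x → touches (cells (suc m)) (embedVertex x) ≡ ℤ.+ 2
  touches-interior (v i j) = touches≡ x
    (oneʰ 0F (suc i , j)) (oneʰ 1F (inject₁ i , j))
    (none x (vertical 0F) (λ _ ())) (none x (vertical 1F) (λ _ ()))
    where x = u (suc (inject₁ i)) j
  touches-interior (u i j) = touches≡ x
    (none x (horizontal 0F) (λ _ ())) (none x (horizontal 1F) (λ _ ()))
    (oneᵛ 0F (i , suc j)) (oneᵛ 1F (i , inject₁ j))
    where x = v i (suc (inject₁ j))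

  touches-border : ∀ {x} → Border x → touches (cells (suc m)) x ≡ 1ℤ
  touches-border (top j) = touches≡ x
    (oneʰ 0F (zero , j)) (none x (horizontal 1F) (λ _ ()))
    (none x (vertical 0F) (λ _ ())) (none x (vertical 1F) (λ _ ()))
    where x = u zero j
  touches-border (bottom j) = touches≡ x
    (none x (horizontal 0F) (λ _ → Fin.fromℕ≢inject₁ ∘ proj₁ ∘ Product.,-injective ∘ inj₁-injective))
    (oneʰ 1F (fromℕ m , j))
    (none x (vertical 0F) (λ _ ())) (none x (vertical 1F) (λ _ ()))
    where x = u (fromℕ (suc m)) j
  touches-border (left i) = touches≡ x
    (none x (horizontal 0F) (λ _ ())) (none x (horizontal 1F) (λ _ ()))
    (oneᵛ 0F (i , zero)) (none x (vertical 1F) (λ _ ()))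
    where x = v i zero
  touches-border (right i) = touches≡ x
    (none x (horizontal 0F) (λ _ ())) (none x (horizontal 1F) (λ _ ()))
    (none x (vertical 0F) (λ _ → Fin.fromℕ≢inject₁ ∘ proj₂ ∘ Product.,-injective ∘ inj₂-injective))
    (oneᵛ 1F (i , fromℕ m))
    where x = v i (fromℕ (suc m))

  -- The complement of the constant demand 1 in the sense of `cellSum-dual`. With two cells at an
  -- interior vertex and one at a border vertex, it asks for a perfect matching of the inner
  -- diamond.
  demand : AztecVertex (suc m) → ℤ
  demand x = touches (cells (suc m)) x ℤ.- 1ℤ

  demand-interior : ∀ x → demand (embedVertex x) ≡ 1ℤ
  demand-interior x = ≡.cong (ℤ._- 1ℤ) (touches-interior x)

  demand-border : ∀ {x} → Border x → demand x ≡ 0ℤ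
  demand-border b = ≡.cong (ℤ._- 1ℤ) (touches-border b)

  demand≤1 : ∀ x → demand x ℤ.≤ 1ℤ
  demand≤1 x with interior⊎border x
  ... | inj₁ (y , ≡.refl) = ℤ.≤-reflexive (demand-interior y)
  ... | inj₂ b            = ℤ.≤-trans (ℤ.≤-reflexive (demand-border b)) (ℤ.+≤+ ℕ.z≤n)

  open DecMembership {A = AztecEdge (suc m)} (Product.≡-dec Fin._≟_ Fin._≟_) using (_∈?_)

  innerEdges outerEdges : List (AztecEdge (suc m))
  innerEdges = map (embedEdge m) G.edges

  outer? : ∀ e → Dec (e ∉ innerEdges)
  outer? e = ¬? (e ∈? innerEdges)

  outerEdges = filter outer? G⁺.edges

  edges↭outer++inner : G⁺.edges ↭ outerEdges ++ innerEdges
  edges↭outer++inner = complete-unique-↭ G⁺.edges-unique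
    (++⁺ (filter⁺ outer? G⁺.edges-unique) (map⁺ (embedEdge-injective m) G.edges-unique)
         (λ (e∈outer , e∈inner) → proj₂ (∈-filter⁻ outer? {xs = G⁺.edges} e∈outer) e∈inner))
    G⁺.edges-complete complete
    where
    complete : ∀ e → e ∈ outerEdges ++ innerEdges
    complete e with e ∈? innerEdges
    ... | yes e∈ = ∈-++⁺ʳ outerEdges e∈
    ... | no  e∉ = ∈-++⁺ˡ (∈-filter⁺ outer? (G⁺.edges-complete e) e∉)

  -- An edge outside the inner diamond is in the first or last row or column of the edge array.
  outer-border : ∀ e → e ∉ innerEdges → ∃ λ x → G⁺.Incident x e × Border x
  outer-border (r , s) e∉ with view r | view s
  ... | ‵fromℕ           | _                = _ , inj₁ ≡.refl ,
    ≡.subst (λ (i , ρ) → Border (u (i ⊹ ρ) (proj₁ (remQuot {suc m} 2 s)))) (≡.sym (remQuot-fromℕ m)) (bottom _)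
  ... | ‵inject₁ zero    | _                = _ , inj₁ ≡.refl , top _
  ... | ‵inject₁ (suc _) | ‵fromℕ           = _ , inj₂ ≡.refl ,
    ≡.subst (λ (j , σ) → Border (v (proj₁ (remQuot {suc m} 2 r)) (j ⊹ σ))) (≡.sym (remQuot-fromℕ m)) (right _)
  ... | ‵inject₁ (suc _) | ‵inject₁ zero    = _ , inj₂ ≡.refl , left _
  ... | ‵inject₁ (suc r) | ‵inject₁ (suc s) = ⊥-elim (e∉ (∈-map⁺ (embedEdge m) (G.edges-complete (r , s))))

  embed-incident : ∀ x e → G.Incident x e ⇔ G⁺.Incident (embedVertex x) (embedEdge m e)
  embed-incident x e = mk⇔
    (λ { (inj₁ eq) → inj₂ (≡.trans (≡.cong embedVertex eq) (≡.sym (≡.cong proj₂ (ends-embed {m} e))))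
       ; (inj₂ eq) → inj₁ (≡.trans (≡.cong embedVertex eq) (≡.sym (≡.cong proj₁ (ends-embed {m} e)))) })
    (λ { (inj₁ eq) → inj₂ (embedVertex-injective (≡.trans eq (≡.cong proj₁ (ends-embed {m} e))))
       ; (inj₂ eq) → inj₁ (embedVertex-injective (≡.trans eq (≡.cong proj₂ (ends-embed {m} e)))) })

  border-untouched : ∀ {x} → Border x → ∀ e → ¬ G⁺.Incident x (embedEdge m e)
  border-untouched b e (inj₁ eq) = embed≢border b _ (≡.trans eq (≡.cong proj₁ (ends-embed {m} e)))
  border-untouched b e (inj₂ eq) = embed≢border b _ (≡.trans eq (≡.cong proj₂ (ends-embed {m} e)))

  open Transport K G.incident? G.vertices G⁺.incident? G⁺.vertices embedVertex (embedEdge m)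
    embed-incident (λ _ → G⁺.vertices-complete _) Border
    (λ x → Sum.map₁ (λ (y , eq) → y , G.vertices-complete y , eq) (interior⊎border x))
    border-untouched

  M-reduce : ∀ {w w′} → Dual w w′ →
             M (AD (suc m)) w ≈ cellProduct w (cells (suc m)) * M (AD m) (w′ ∘ (embedEdge m))
  M-reduce {w} {w′} dual = begin
    M (AD (suc m)) w
      ≈⟨ M≈stateSum K (AD (suc m)) w ⟩
    Y w G⁺.edges (λ _ → 1ℤ)
      ≈⟨ stateSum-↭ G⁺.incident? G⁺.vertices w (↭-sym (cellEdges↭edges (suc m) K)) _ ⟩
    Y w (cellEdges cs) (λ _ → 1ℤ)
      ≈⟨ stateSum≈cellSum w cs (λ _ → ℤ.≤-refl) ⟩
    cellSum w cs (λ _ → 1ℤ)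
      ≈⟨ cellSum-dual dual cs (λ x → cancel (touches cs x)) ⟩
    cellProduct w cs * cellSum w′ cs demand
      ≈⟨ *-congˡ (stateSum≈cellSum w′ cs demand≤1) ⟨
    cellProduct w cs * Y w′ (cellEdges cs) demand
      ≈⟨ *-congˡ (stateSum-↭ G⁺.incident? G⁺.vertices w′
           (↭-trans (cellEdges↭edges (suc m) K) edges↭outer++inner) demand) ⟩
    cellProduct w cs * Y w′ (outerEdges ++ innerEdges) demand
      ≈⟨ *-congˡ (stateSum-drop G⁺.incident? G⁺.vertices w′ outerEdges innerEdges
           (All.tabulate λ {e} e∈ →
              let x , x-e , b = outer-border e (proj₂ (∈-filter⁻ outer? {xs = G⁺.edges} e∈))
              in x , G⁺.vertices-complete x , x-e , demand-border b)) ⟩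
    cellProduct w cs * Y w′ innerEdges demand
      ≈⟨ *-congˡ (transport w′ G.edges demand-interior demand-border) ⟩
    cellProduct w cs * stateSum G.incident? G.vertices (w′ ∘ (embedEdge m)) G.edges (λ _ → 1ℤ)
      ≈⟨ *-congˡ (M≈stateSum K (AD m) (w′ ∘ (embedEdge m))) ⟨
    cellProduct w cs * M (AD m) (w′ ∘ (embedEdge m)) ∎
    where
    cs = cells (suc m)
    Y = stateSum G⁺.incident? G⁺.vertices
    cancel : ∀ t → 1ℤ ℤ.+ (t ℤ.- 1ℤ) ≡ t
    cancel = solve-∀

-- Laurent monomials

Exponent : ℕ → Set
Exponent n = Fin n → ℤ

infixl 6 _⊕_ _⊘_
infixr 8 _⊗_

_⊕_ _⊘_ : ∀ {n} → Exponent n → Exponent n → Exponent n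
(E ⊕ F) i = E i ℤ.+ F i
(E ⊘ F) i = E i ℤ.- F i

_⊗_ : ∀ {n} → ℕ → Exponent n → Exponent n
(k ⊗ E) i = + k ℤ.* E i

𝟘 : ∀ {n} → Exponent n
𝟘 i = 0ℤ

generator : ∀ {n} → Fin n → Exponent n
generator i j = if does (i Fin.≟ j) then 1ℤ else 0ℤ

generators : ∀ {n} → List (Fin n) → Exponent n
generators = foldr (λ i E → generator i ⊕ E) 𝟘

module Power (K : CommutativeRing 0ℓ 0ℓ) where
  open CommutativeRing K hiding (zero)
  open import Relation.Binary.Reasoning.Setoid setoid
  open NaturalSolver commutativeSemiring using (solve; _:=_; _:*_)

  power : Carrier → Carrier → ℤ → Carrier
  power x x⁻¹ (+ zero)       = 1#
  power x x⁻¹ (+ suc n)      = x * power x x⁻¹ (+ n)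
  power x x⁻¹ -[1+ zero ]    = x⁻¹
  power x x⁻¹ -[1+ suc n ]   = x⁻¹ * power x x⁻¹ -[1+ n ]

  module _ {x x⁻¹ : Carrier} (inverse : x * x⁻¹ ≈ 1#) where

    cancel : ∀ y → x * (x⁻¹ * y) ≈ y
    cancel y = trans (sym (*-assoc x x⁻¹ y)) (trans (*-congʳ inverse) (*-identityˡ y))

    power-suc : ∀ i → power x x⁻¹ (ℤ.suc i) ≈ x * power x x⁻¹ i
    power-suc (+ n)          = refl
    power-suc -[1+ zero ]    = sym inverse
    power-suc -[1+ suc n ]   = sym (cancel _)

    power-pred : ∀ i → power x x⁻¹ (ℤ.pred i) ≈ x⁻¹ * power x x⁻¹ i
    power-pred i = begin
      power x x⁻¹ (ℤ.pred i)
        ≈⟨ trans (sym (*-assoc x⁻¹ x _)) (trans (*-congʳ (trans (*-comm x⁻¹ x) inverse)) (*-identityˡ _)) ⟨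
      x⁻¹ * (x * power x x⁻¹ (ℤ.pred i))
        ≈⟨ *-congˡ (power-suc (ℤ.pred i)) ⟨
      x⁻¹ * power x x⁻¹ (ℤ.suc (ℤ.pred i))
        ≈⟨ *-congˡ (reflexive (≡.cong (power x x⁻¹) (ℤ.suc-pred i))) ⟩
      x⁻¹ * power x x⁻¹ i ∎

    power-+ : ∀ i j → power x x⁻¹ (i ℤ.+ j) ≈ power x x⁻¹ i * power x x⁻¹ j
    power-+ (+ zero)     j = trans (reflexive (≡.cong (power x x⁻¹) (ℤ.+-identityˡ j))) (sym (*-identityˡ _))
    power-+ (+ suc n)    j = begin
      power x x⁻¹ (ℤ.suc (+ n) ℤ.+ j)              ≡⟨ ≡.cong (power x x⁻¹) (ℤ.suc-+ n j) ⟩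
      power x x⁻¹ (ℤ.suc (+ n ℤ.+ j))              ≈⟨ power-suc (+ n ℤ.+ j) ⟩
      x * power x x⁻¹ (+ n ℤ.+ j)                  ≈⟨ *-congˡ (power-+ (+ n) j) ⟩
      x * (power x x⁻¹ (+ n) * power x x⁻¹ j)      ≈⟨ *-assoc x _ _ ⟨
      power x x⁻¹ (+ suc n) * power x x⁻¹ j        ∎
    power-+ -[1+ zero ]  j = power-pred j
    power-+ -[1+ suc n ] j = begin
      power x x⁻¹ (-[1+ suc n ] ℤ.+ j)             ≡⟨ ≡.cong (power x x⁻¹) (ℤ.+-assoc (ℤ.- 1ℤ) -[1+ n ] j) ⟩
      power x x⁻¹ (ℤ.pred (-[1+ n ] ℤ.+ j))        ≈⟨ power-pred (-[1+ n ] ℤ.+ j) ⟩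
      x⁻¹ * power x x⁻¹ (-[1+ n ] ℤ.+ j)           ≈⟨ *-congˡ (power-+ -[1+ n ] j) ⟩
      x⁻¹ * (power x x⁻¹ -[1+ n ] * power x x⁻¹ j) ≈⟨ *-assoc x⁻¹ _ _ ⟨
      power x x⁻¹ -[1+ suc n ] * power x x⁻¹ j     ∎

  -- y i stands for the inverse of x i.
  monomial : ∀ {n} (x y : Fin n → Carrier) → Exponent n → Carrier
  monomial {zero}  x y E = 1#
  monomial {suc n} x y E = power (x zero) (y zero) (E zero) * monomial (x ∘ suc) (y ∘ suc) (E ∘ suc)

  monomial-cong : ∀ {n} (x y : Fin n → Carrier) {E F} → E ≗ F → monomial x y E ≈ monomial x y F
  monomial-cong {zero}  x y eq = refl
  monomial-cong {suc n} x y eq = *-cong (reflexive (≡.cong (power (x zero) (y zero)) (eq zero)))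
                                        (monomial-cong (x ∘ suc) (y ∘ suc) (eq ∘ suc))

  monomial-𝟘 : ∀ {n} (x y : Fin n → Carrier) → monomial x y 𝟘 ≈ 1#
  monomial-𝟘 {zero}  x y = refl
  monomial-𝟘 {suc n} x y = trans (*-identityˡ _) (monomial-𝟘 (x ∘ suc) (y ∘ suc))

  monomial-⊕ : ∀ {n} (x y : Fin n → Carrier) → (∀ i → x i * y i ≈ 1#) → ∀ E F →
               monomial x y (E ⊕ F) ≈ monomial x y E * monomial x y F
  monomial-⊕ {zero}  x y inv E F = sym (*-identityˡ _)
  monomial-⊕ {suc n} x y inv E F = trans
    (*-cong (power-+ (inv zero) (E zero) (F zero)) (monomial-⊕ (x ∘ suc) (y ∘ suc) (inv ∘ suc) (E ∘ suc) (F ∘ suc)))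
    (solve 4 (λ p q r s → (p :* q) :* (r :* s) := (p :* r) :* (q :* s)) refl _ _ _ _)

  monomial-generator : ∀ {n} (x y : Fin n → Carrier) i → monomial x y (generator i) ≈ x i
  monomial-generator {suc n} x y zero    =
    trans (*-cong (*-identityʳ _) (monomial-𝟘 (x ∘ suc) (y ∘ suc))) (*-identityʳ _)
  monomial-generator {suc n} x y (suc i) =
    trans (*-identityˡ _) (monomial-generator (x ∘ suc) (y ∘ suc) i)

-- The iterated reductions of the weight matrix

decided : ∀ {P : Set} (P? : Dec P) {_ : True P?} → P
decided P? {t} = toWitness t

#2 #a #b #c #d #e #f #g #h #R #S #T #U #W : Fin 14
#2 = # 0
#a = # 1
#b = # 2
#c = # 3
#d = # 4
#e = # 5
#f = # 6
#g = # 7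
#h = # 8
#R = # 9
-- S = ag + de, T = bh + cf, U = ag + 2de and W = bh + 2cf.
#S = # 10
#T = # 11
#U = # 12
#W = # 13

𝟐 𝐚 𝐛 𝐜 𝐝 𝐞 𝐟 𝐠 𝐡 𝐑 𝐒 𝐓 𝐔 𝐖 : Exponent 14
𝟐 = generator #2
𝐚 = generator #a
𝐛 = generator #b
𝐜 = generator #c
𝐝 = generator #d
𝐞 = generator #e
𝐟 = generator #f
𝐠 = generator #g
𝐡 = generator #h
𝐑 = generator #R
𝐒 = generator #S
𝐓 = generator #T
𝐔 = generator #U
𝐖 = generator #W

-- A triple (x , y , z) stands for the identity ∏ x + ∏ y = ∏ z.
relations : List (List (Fin 14) × List (Fin 14) × List (Fin 14))
relations =
  (#a ∷ #g ∷ [] , #d ∷ #e ∷ []                   , #S ∷ []) ∷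
  (#b ∷ #h ∷ [] , #c ∷ #f ∷ []                   , #T ∷ []) ∷
  (#a ∷ #g ∷ [] , #2 ∷ #d ∷ #e ∷ []              , #U ∷ []) ∷
  (#b ∷ #h ∷ [] , #2 ∷ #c ∷ #f ∷ []              , #W ∷ []) ∷
  (#S ∷ #T ∷ [] , #c ∷ #d ∷ #e ∷ #f ∷ []         , #R ∷ []) ∷
  (#R ∷ []      , #a ∷ #c ∷ #f ∷ #g ∷ []         , #S ∷ #W ∷ []) ∷
  (#R ∷ []      , #b ∷ #d ∷ #e ∷ #h ∷ []         , #T ∷ #U ∷ []) ∷
  (#U ∷ #W ∷ [] , #a ∷ #b ∷ #g ∷ #h ∷ []         , #2 ∷ #R ∷ []) ∷
  ([]           , []                             , #2 ∷ []) ∷ []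

_≗?_ : ∀ {n} (E F : Exponent n) → Dec (E ≗ F)
E ≗? F = Fin.all? (λ i → E i ℤ.≟ F i)

-- The exponent vector of a monomial, or nothing for the weight 0.
Entry : Set
Entry = Maybe (Exponent 14)

_⊕?_ : Entry → Entry → Entry
just E ⊕? just F = just (E ⊕ F)
_      ⊕? _      = nothing

-- The sum of the monomials is the monomial with exponent vector G, as a multiple of a relation.
SumsTo : Entry → Entry → Exponent 14 → Set
SumsTo nothing  nothing  G = ⊥
SumsTo nothing  (just F) G = F ≗ G
SumsTo (just E) nothing  G = E ≗ G
SumsTo (just E) (just F) G = Any (λ (x , y , z) → Scaled x y z ⊎ Scaled y x z) relations
  where
  Scaled : List (Fin 14) → List (Fin 14) → List (Fin 14) → Set
  Scaled x y z = (E ⊕ generators z) ≗ (G ⊕ generators x) × (F ⊕ generators z) ≗ (G ⊕ generators y)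

sumsTo? : ∀ E F G → Dec (SumsTo E F G)
sumsTo? nothing  nothing  G = no (λ ())
sumsTo? nothing  (just F) G = F ≗? G
sumsTo? (just E) nothing  G = E ≗? G
sumsTo? (just E) (just F) G = Any.any? (λ _ → (_ ≗? _ ×-dec _ ≗? _) ⊎-dec (_ ≗? _ ×-dec _ ≗? _)) relations

-- A 2-periodic family of cell factors, indexed by the parities of the cell coordinates.
Factors : Set
Factors = Fin 2 → Fin 2 → Exponent 14

-- A 4 × 4 matrix, row 2π + ρ and column 2π′ + σ being given as π ρ and π′ σ.
Matrix : Set
Matrix = Fin 2 → Fin 2 → Fin 2 → Fin 2 → Entry

table₂ : Exponent 14 → Exponent 14 → Exponent 14 → Exponent 14 → Factors
table₂ E₀₀ E₀₁ E₁₀ E₁₁ 0F 0F = E₀₀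
table₂ E₀₀ E₀₁ E₁₀ E₁₁ 0F 1F = E₀₁
table₂ E₀₀ E₀₁ E₁₀ E₁₁ 1F 0F = E₁₀
table₂ E₀₀ E₀₁ E₁₀ E₁₁ 1F 1F = E₁₁

initial : Vec (Vec Entry 4) 4
initial = (just 𝐚 ∷ just 𝐝 ∷ just 𝐝 ∷ just 𝐚 ∷ [])
        ∷ (just 𝐞 ∷ nothing ∷ just 𝐠 ∷ just 𝐞 ∷ [])
        ∷ (just 𝐟 ∷ just 𝐡 ∷ nothing ∷ just 𝐟 ∷ [])
        ∷ (just 𝐛 ∷ just 𝐜 ∷ just 𝐜 ∷ just 𝐛 ∷ [])
        ∷ []

-- The cell factors of the weights M, d M, …, d¹¹ M for the reduction d, computed symbolically.
factors : Vec Factors 12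
factors =
  (table₂ (𝐝 ⊕ 𝐞)
          (𝐒)
          (𝐓)
          (𝐜 ⊕ 𝐟)) ∷
  (table₂ (𝐚 ⊕ 𝐛 ⊕ 𝐑 ⊘ (𝐜 ⊕ 𝐝 ⊕ 𝐞 ⊕ 𝐟 ⊕ 𝐒 ⊕ 𝐓))
          (𝐑 ⊘ (𝐞 ⊕ 𝐟 ⊕ 𝐒 ⊕ 𝐓))
          (𝐑 ⊘ (𝐜 ⊕ 𝐝 ⊕ 𝐒 ⊕ 𝐓))
          (𝐠 ⊕ 𝐡 ⊘ (𝐒 ⊕ 𝐓))) ∷
  (table₂ (𝐜 ⊕ 𝐟 ⊕ 2 ⊗ 𝐒 ⊕ 2 ⊗ 𝐓 ⊘ 2 ⊗ 𝐑)
          (𝐜 ⊕ 𝐝 ⊕ 𝐞 ⊕ 𝐟 ⊕ 3 ⊗ 𝐓 ⊕ 𝐔 ⊘ (𝐛 ⊕ 𝐡 ⊕ 2 ⊗ 𝐑))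
          (𝐜 ⊕ 𝐝 ⊕ 𝐞 ⊕ 𝐟 ⊕ 3 ⊗ 𝐒 ⊕ 𝐖 ⊘ (𝐚 ⊕ 𝐠 ⊕ 2 ⊗ 𝐑))
          (𝐝 ⊕ 𝐞 ⊕ 2 ⊗ 𝐒 ⊕ 2 ⊗ 𝐓 ⊘ 2 ⊗ 𝐑)) ∷
  (table₂ (𝟐 ⊕ 3 ⊗ 𝐑 ⊘ (𝐚 ⊕ 𝐛 ⊕ 2 ⊗ 𝐒 ⊕ 2 ⊗ 𝐓 ⊕ 𝐔 ⊕ 𝐖))
          (𝟐 ⊕ 3 ⊗ 𝐑 ⊘ (𝐜 ⊕ 𝐝 ⊕ 2 ⊗ 𝐒 ⊕ 2 ⊗ 𝐓 ⊕ 𝐔 ⊕ 𝐖))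
          (𝟐 ⊕ 3 ⊗ 𝐑 ⊘ (𝐞 ⊕ 𝐟 ⊕ 2 ⊗ 𝐒 ⊕ 2 ⊗ 𝐓 ⊕ 𝐔 ⊕ 𝐖))
          (𝐚 ⊕ 𝐛 ⊕ 4 ⊗ 𝐑 ⊘ (2 ⊗ 𝐜 ⊕ 2 ⊗ 𝐝 ⊕ 2 ⊗ 𝐞 ⊕ 2 ⊗ 𝐟 ⊕ 2 ⊗ 𝐒 ⊕ 2 ⊗ 𝐓 ⊕ 𝐔 ⊕ 𝐖))) ∷
  (table₂ (𝐝 ⊕ 𝐞 ⊕ 2 ⊗ 𝐒 ⊕ 2 ⊗ 𝐓 ⊕ 2 ⊗ 𝐔 ⊕ 2 ⊗ 𝐖 ⊘ (2 ⊗ 𝟐 ⊕ 4 ⊗ 𝐑))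
          (𝐛 ⊕ 𝐝 ⊕ 𝐞 ⊕ 𝐡 ⊕ 4 ⊗ 𝐒 ⊕ 3 ⊗ 𝐖 ⊘ (2 ⊗ 𝟐 ⊕ 4 ⊗ 𝐑))
          (𝐚 ⊕ 𝐜 ⊕ 𝐟 ⊕ 𝐠 ⊕ 4 ⊗ 𝐓 ⊕ 3 ⊗ 𝐔 ⊘ (2 ⊗ 𝟐 ⊕ 4 ⊗ 𝐑))
          (𝐜 ⊕ 𝐟 ⊕ 2 ⊗ 𝐒 ⊕ 2 ⊗ 𝐓 ⊕ 2 ⊗ 𝐔 ⊕ 2 ⊗ 𝐖 ⊘ (2 ⊗ 𝟐 ⊕ 4 ⊗ 𝐑))) ∷
  (table₂ (3 ⊗ 𝟐 ⊕ 𝐚 ⊕ 𝐛 ⊕ 4 ⊗ 𝐑 ⊘ (𝐜 ⊕ 𝐝 ⊕ 𝐞 ⊕ 𝐟 ⊕ 2 ⊗ 𝐒 ⊕ 2 ⊗ 𝐓 ⊕ 2 ⊗ 𝐔 ⊕ 2 ⊗ 𝐖))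
          (3 ⊗ 𝟐 ⊕ 4 ⊗ 𝐑 ⊘ (𝐞 ⊕ 𝐟 ⊕ 2 ⊗ 𝐒 ⊕ 2 ⊗ 𝐓 ⊕ 2 ⊗ 𝐔 ⊕ 2 ⊗ 𝐖))
          (3 ⊗ 𝟐 ⊕ 4 ⊗ 𝐑 ⊘ (𝐜 ⊕ 𝐝 ⊕ 2 ⊗ 𝐒 ⊕ 2 ⊗ 𝐓 ⊕ 2 ⊗ 𝐔 ⊕ 2 ⊗ 𝐖))
          (4 ⊗ 𝟐 ⊕ 𝐜 ⊕ 𝐝 ⊕ 𝐞 ⊕ 𝐟 ⊕ 4 ⊗ 𝐑 ⊘ (2 ⊗ 𝐚 ⊕ 2 ⊗ 𝐛 ⊕ 𝐠 ⊕ 𝐡 ⊕ 2 ⊗ 𝐒 ⊕ 2 ⊗ 𝐓 ⊕ 2 ⊗ 𝐔 ⊕ 2 ⊗ 𝐖))) ∷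
  (table₂ (𝐜 ⊕ 𝐟 ⊕ 2 ⊗ 𝐒 ⊕ 2 ⊗ 𝐓 ⊕ 2 ⊗ 𝐔 ⊕ 2 ⊗ 𝐖 ⊘ (4 ⊗ 𝟐 ⊕ 4 ⊗ 𝐑))
          (𝐜 ⊕ 𝐟 ⊕ 𝐒 ⊕ 4 ⊗ 𝐓 ⊕ 4 ⊗ 𝐔 ⊘ (4 ⊗ 𝟐 ⊕ 𝐝 ⊕ 𝐞 ⊕ 4 ⊗ 𝐑))
          (𝐝 ⊕ 𝐞 ⊕ 4 ⊗ 𝐒 ⊕ 𝐓 ⊕ 4 ⊗ 𝐖 ⊘ (4 ⊗ 𝟐 ⊕ 𝐜 ⊕ 𝐟 ⊕ 4 ⊗ 𝐑))
          (𝐝 ⊕ 𝐞 ⊕ 2 ⊗ 𝐒 ⊕ 2 ⊗ 𝐓 ⊕ 2 ⊗ 𝐔 ⊕ 2 ⊗ 𝐖 ⊘ (4 ⊗ 𝟐 ⊕ 4 ⊗ 𝐑))) ∷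
  (table₂ (4 ⊗ 𝟐 ⊕ 5 ⊗ 𝐑 ⊘ (𝐚 ⊕ 𝐛 ⊕ 3 ⊗ 𝐒 ⊕ 3 ⊗ 𝐓 ⊕ 2 ⊗ 𝐔 ⊕ 2 ⊗ 𝐖))
          (4 ⊗ 𝟐 ⊕ 5 ⊗ 𝐑 ⊘ (𝐜 ⊕ 𝐝 ⊕ 3 ⊗ 𝐒 ⊕ 3 ⊗ 𝐓 ⊕ 2 ⊗ 𝐔 ⊕ 2 ⊗ 𝐖))
          (4 ⊗ 𝟐 ⊕ 5 ⊗ 𝐑 ⊘ (𝐞 ⊕ 𝐟 ⊕ 3 ⊗ 𝐒 ⊕ 3 ⊗ 𝐓 ⊕ 2 ⊗ 𝐔 ⊕ 2 ⊗ 𝐖))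
          (4 ⊗ 𝟐 ⊕ 2 ⊗ 𝐚 ⊕ 2 ⊗ 𝐛 ⊕ 𝐠 ⊕ 𝐡 ⊕ 4 ⊗ 𝐑 ⊘ (𝐜 ⊕ 𝐝 ⊕ 𝐞 ⊕ 𝐟 ⊕ 3 ⊗ 𝐒 ⊕ 3 ⊗ 𝐓 ⊕ 2 ⊗ 𝐔 ⊕ 2 ⊗ 𝐖))) ∷
  (table₂ (𝐝 ⊕ 𝐞 ⊕ 4 ⊗ 𝐒 ⊕ 4 ⊗ 𝐓 ⊕ 2 ⊗ 𝐔 ⊕ 2 ⊗ 𝐖 ⊘ (4 ⊗ 𝟐 ⊕ 6 ⊗ 𝐑))
          (2 ⊗ 𝐝 ⊕ 2 ⊗ 𝐞 ⊕ 4 ⊗ 𝐒 ⊕ 3 ⊗ 𝐓 ⊕ 𝐔 ⊕ 4 ⊗ 𝐖 ⊘ (4 ⊗ 𝟐 ⊕ 𝐛 ⊕ 𝐡 ⊕ 6 ⊗ 𝐑))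
          (2 ⊗ 𝐜 ⊕ 2 ⊗ 𝐟 ⊕ 3 ⊗ 𝐒 ⊕ 4 ⊗ 𝐓 ⊕ 4 ⊗ 𝐔 ⊕ 𝐖 ⊘ (4 ⊗ 𝟐 ⊕ 𝐚 ⊕ 𝐠 ⊕ 6 ⊗ 𝐑))
          (𝐜 ⊕ 𝐟 ⊕ 4 ⊗ 𝐒 ⊕ 4 ⊗ 𝐓 ⊕ 2 ⊗ 𝐔 ⊕ 2 ⊗ 𝐖 ⊘ (4 ⊗ 𝟐 ⊕ 6 ⊗ 𝐑))) ∷
  (table₂ (5 ⊗ 𝟐 ⊕ 𝐚 ⊕ 𝐛 ⊕ 7 ⊗ 𝐑 ⊘ (𝐜 ⊕ 𝐝 ⊕ 𝐞 ⊕ 𝐟 ⊕ 4 ⊗ 𝐒 ⊕ 4 ⊗ 𝐓 ⊕ 3 ⊗ 𝐔 ⊕ 3 ⊗ 𝐖))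
          (5 ⊗ 𝟐 ⊕ 7 ⊗ 𝐑 ⊘ (𝐞 ⊕ 𝐟 ⊕ 4 ⊗ 𝐒 ⊕ 4 ⊗ 𝐓 ⊕ 3 ⊗ 𝐔 ⊕ 3 ⊗ 𝐖))
          (5 ⊗ 𝟐 ⊕ 7 ⊗ 𝐑 ⊘ (𝐜 ⊕ 𝐝 ⊕ 4 ⊗ 𝐒 ⊕ 4 ⊗ 𝐓 ⊕ 3 ⊗ 𝐔 ⊕ 3 ⊗ 𝐖))
          (4 ⊗ 𝟐 ⊕ 8 ⊗ 𝐑 ⊘ (𝐚 ⊕ 𝐛 ⊕ 𝐜 ⊕ 𝐝 ⊕ 𝐞 ⊕ 𝐟 ⊕ 4 ⊗ 𝐒 ⊕ 4 ⊗ 𝐓 ⊕ 3 ⊗ 𝐔 ⊕ 3 ⊗ 𝐖))) ∷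
  (table₂ (𝐜 ⊕ 𝐟 ⊕ 4 ⊗ 𝐒 ⊕ 4 ⊗ 𝐓 ⊕ 4 ⊗ 𝐔 ⊕ 4 ⊗ 𝐖 ⊘ (6 ⊗ 𝟐 ⊕ 8 ⊗ 𝐑))
          (𝐛 ⊕ 𝐜 ⊕ 𝐟 ⊕ 𝐡 ⊕ 4 ⊗ 𝐒 ⊕ 4 ⊗ 𝐓 ⊕ 4 ⊗ 𝐔 ⊕ 3 ⊗ 𝐖 ⊘ (6 ⊗ 𝟐 ⊕ 8 ⊗ 𝐑))
          (𝐚 ⊕ 𝐝 ⊕ 𝐞 ⊕ 𝐠 ⊕ 4 ⊗ 𝐒 ⊕ 4 ⊗ 𝐓 ⊕ 3 ⊗ 𝐔 ⊕ 4 ⊗ 𝐖 ⊘ (6 ⊗ 𝟐 ⊕ 8 ⊗ 𝐑))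
          (𝐝 ⊕ 𝐞 ⊕ 4 ⊗ 𝐒 ⊕ 4 ⊗ 𝐓 ⊕ 4 ⊗ 𝐔 ⊕ 4 ⊗ 𝐖 ⊘ (6 ⊗ 𝟐 ⊕ 8 ⊗ 𝐑))) ∷
  (table₂ (7 ⊗ 𝟐 ⊕ 8 ⊗ 𝐑 ⊘ (𝐚 ⊕ 𝐛 ⊕ 4 ⊗ 𝐒 ⊕ 4 ⊗ 𝐓 ⊕ 4 ⊗ 𝐔 ⊕ 4 ⊗ 𝐖))
          (7 ⊗ 𝟐 ⊕ 8 ⊗ 𝐑 ⊘ (𝐜 ⊕ 𝐝 ⊕ 4 ⊗ 𝐒 ⊕ 4 ⊗ 𝐓 ⊕ 4 ⊗ 𝐔 ⊕ 4 ⊗ 𝐖))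
          (7 ⊗ 𝟐 ⊕ 8 ⊗ 𝐑 ⊘ (𝐞 ⊕ 𝐟 ⊕ 4 ⊗ 𝐒 ⊕ 4 ⊗ 𝐓 ⊕ 4 ⊗ 𝐔 ⊕ 4 ⊗ 𝐖))
          (8 ⊗ 𝟐 ⊕ 8 ⊗ 𝐑 ⊘ (𝐠 ⊕ 𝐡 ⊕ 4 ⊗ 𝐒 ⊕ 4 ⊗ 𝐓 ⊕ 4 ⊗ 𝐔 ⊕ 4 ⊗ 𝐖))) ∷ []

parity+ : Fin 2 → Fin 2 → Fin 2
parity+ π 0F = π
parity+ π 1F = opposite π

dual : Matrix → Factors → Matrix
dual A Δ π ρ π′ σ = Maybe.map (_⊘ Δ π π′) (A π (opposite ρ) π′ (opposite σ))

-- The inner diamond omits the first row and column of the edge array, so row 2π + ρ of the new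
-- matrix is row 2π + ρ + 1 of the old one modulo 4, and likewise for columns.
inner : Matrix → Matrix
inner A π ρ π′ σ = A (parity+ π ρ) (opposite ρ) (parity+ π′ σ) (opposite σ)

factor : Fin 12 → Factors
factor = lookup factors

iterate : ℕ → Matrix
iterate zero    π ρ π′ σ = lookup (lookup initial (combine π ρ)) (combine π′ σ)
iterate (suc k) = inner (dual (iterate k) (factor (k mod 12)))

matrix : Fin 12 → Matrix
matrix k = iterate (toℕ k)

next : Fin 12 → Fin 12
next k = suc (toℕ k) mod 12

-- The twelfth reduction of M is the multiple of M by this monomial.
drift : Fin 12 → Exponent 14
drift k with does (k Fin.≟ # 11)
... | true  = 2 ⊗ 𝐒 ⊕ 2 ⊗ 𝐓 ⊕ 2 ⊗ 𝐔 ⊕ 2 ⊗ 𝐖 ⊘ (4 ⊗ 𝟐 ⊕ 4 ⊗ 𝐑)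
... | false = 𝟘

matrix-sums? : Dec (∀ k π π′ →
  SumsTo (matrix k π 0F π′ 0F ⊕? matrix k π 1F π′ 1F) (matrix k π 0F π′ 1F ⊕? matrix k π 1F π′ 0F) (factor k π π′))
matrix-sums? = Fin.all? λ k → Fin.all? λ π → Fin.all? λ π′ → sumsTo? _ _ _

-- For `k` below 11 the two sides agree by the definition of `iterate`, up to adding `𝟘`. The
-- content is `k` = 11, where the period closes.
matrix-next? : Dec (∀ k π ρ π′ σ →
  Pointwise _≗_ (inner (dual (matrix k) (factor k)) π ρ π′ σ) (Maybe.map (_⊕ drift k) (matrix (next k) π ρ π′ σ)))
matrix-next? = Fin.all? λ k → Fin.all? λ π → Fin.all? λ ρ → Fin.all? λ π′ → Fin.all? λ σ → Pointwise.dec _≗?_ _ _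

abstract
  matrix-sums : ∀ k π π′ →
    SumsTo (matrix k π 0F π′ 0F ⊕? matrix k π 1F π′ 1F) (matrix k π 0F π′ 1F ⊕? matrix k π 1F π′ 0F) (factor k π π′)
  matrix-sums = decided matrix-sums?

  matrix-next : ∀ k π ρ π′ σ →
    Pointwise _≗_ (inner (dual (matrix k) (factor k)) π ρ π′ σ) (Maybe.map (_⊕ drift k) (matrix (next k) π ρ π′ σ))
  matrix-next = decided matrix-next?

-- Sums of exponents over the cells, by parity

sumℤ : ∀ {A : Set} → List A → (A → ℤ) → ℤ
sumℤ as f = foldr (λ a s → f a ℤ.+ s) 0ℤ as

sumℤ-product : ∀ {A B : Set} (as : List A) (bs : List B) (f : A × B → ℤ) →
               sumℤ (cartesianProduct as bs) f ≡ sumℤ as (λ a → sumℤ bs (λ b → f (a , b)))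
sumℤ-product []       bs f = ≡.refl
sumℤ-product (a ∷ as) bs f = ≡.trans (row bs) (≡.cong (λ z → sumℤ bs (λ b → f (a , b)) ℤ.+ z) (sumℤ-product as bs f))
  where
  row : ∀ bs′ → sumℤ (map (a ,_) bs′ ++ cartesianProduct as bs) f
                ≡ sumℤ bs′ (λ b → f (a , b)) ℤ.+ sumℤ (cartesianProduct as bs) f
  row []        = ≡.sym (ℤ.+-identityˡ _)
  row (b ∷ bs′) = ≡.trans (≡.cong (λ z → f (a , b) ℤ.+ z) (row bs′)) (≡.sym (ℤ.+-assoc (f (a , b)) _ _))

parity : ∀ {n} → Fin n → Fin 2
parity zero    = 0F
parity (suc i) = opposite (parity i)

parity-inject₁ : ∀ {n} (i : Fin n) → parity (inject₁ i) ≡ parity i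
parity-inject₁ zero    = ≡.refl
parity-inject₁ (suc i) = ≡.cong opposite (parity-inject₁ i)

parity-⊹ : ∀ {n} (i : Fin n) ρ → parity (i ⊹ ρ) ≡ parity+ (parity i) ρ
parity-⊹ i 0F = parity-inject₁ i
parity-⊹ i 1F = ≡.refl

evens odds : ℕ → ℤ
evens n = + ⌈ n /2⌉
odds  n = + ⌊ n /2⌋

evens+odds : ∀ n → evens n ℤ.+ odds n ≡ + n
evens+odds n = ≡.cong +_ (≡.trans (ℕ.+-comm ⌈ n /2⌉ ⌊ n /2⌋) (ℕ.⌊n/2⌋+⌈n/2⌉≡n n))

-- Removing index 0 exchanges the parities, hence `ψ ∘ opposite` in the induction; accordingly
-- `evens (suc n)` is `odds n` plus 1, and `odds (suc n)` is `evens n`.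
sumℤ-parity : ∀ {A : Set} n (φ : Fin n → A) (f : A → ℤ) (ψ : Fin 2 → ℤ) → (∀ i → f (φ i) ≡ ψ (parity i)) →
              sumℤ (tabulate φ) f ≡ evens n ℤ.* ψ 0F ℤ.+ odds n ℤ.* ψ 1F
sumℤ-parity zero    φ f ψ eq = ≡.refl
sumℤ-parity (suc n) φ f ψ eq = ≡.trans
  (≡.cong₂ ℤ._+_ (eq zero) (sumℤ-parity n (φ ∘ suc) f (ψ ∘ opposite) (eq ∘ suc)))
  (lemma (odds n) (evens n) (ψ 0F) (ψ 1F))
  where
  lemma : ∀ o e p q → p ℤ.+ (e ℤ.* q ℤ.+ o ℤ.* p) ≡ (1ℤ ℤ.+ o) ℤ.* p ℤ.+ e ℤ.* q
  lemma = solve-∀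

cellTotal : ℕ → Factors → Exponent 14
cellTotal n Δ i = evens n ℤ.* (evens n ℤ.* Δ 0F 0F i ℤ.+ odds n ℤ.* Δ 0F 1F i)
             ℤ.+ odds n ℤ.* (evens n ℤ.* Δ 1F 0F i ℤ.+ odds n ℤ.* Δ 1F 1F i)

sumℤ-cells : ∀ n Δ i → sumℤ (cells n) (λ (r , s) → Δ (parity r) (parity s) i) ≡ cellTotal n Δ i
sumℤ-cells n Δ i = ≡.trans (sumℤ-product (allFin n) (allFin n) (λ (r , s) → Δ (parity r) (parity s) i))
  (sumℤ-parity n (λ r → r) (λ r → sumℤ (allFin n) (λ s → Δ (parity r) (parity s) i))
    (λ π → evens n ℤ.* Δ π 0F i ℤ.+ odds n ℤ.* Δ π 1F i)
    (λ r → sumℤ-parity n (λ s → s) (λ s → Δ (parity r) (parity s) i) (λ π′ → Δ (parity r) π′ i) (λ s → ≡.refl)))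

scale : Exponent 14 → Matrix → Matrix
scale t A π ρ π′ σ = Maybe.map (_⊕ t) (A π ρ π′ σ)

scaleFactors : Exponent 14 → Factors → Factors
scaleFactors t Δ π π′ = Δ π π′ ⊕ (t ⊕ t)

cellTotal-scale : ∀ n t Δ i → cellTotal n (scaleFactors t Δ) i
                              ≡ cellTotal n Δ i ℤ.+ + n ℤ.* + n ℤ.* (t i ℤ.+ t i)
cellTotal-scale n t Δ i = ≡.trans
  (lemma (evens n) (odds n) (Δ 0F 0F i) (Δ 0F 1F i) (Δ 1F 0F i) (Δ 1F 1F i) (t i ℤ.+ t i))
  (≡.cong (λ s → cellTotal n Δ i ℤ.+ s ℤ.* s ℤ.* (t i ℤ.+ t i)) (evens+odds n))
  where
  lemma : ∀ e o p q r s t →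
    e ℤ.* (e ℤ.* (p ℤ.+ t) ℤ.+ o ℤ.* (q ℤ.+ t)) ℤ.+ o ℤ.* (e ℤ.* (r ℤ.+ t) ℤ.+ o ℤ.* (s ℤ.+ t))
    ≡ e ℤ.* (e ℤ.* p ℤ.+ o ℤ.* q) ℤ.+ o ℤ.* (e ℤ.* r ℤ.+ o ℤ.* s) ℤ.+ (e ℤ.+ o) ℤ.* (e ℤ.+ o) ℤ.* t
  lemma = solve-∀

module Total {I : Set} (factor : I → Factors) (next : I → I) (drift : I → Exponent 14) where

  -- `N · suc N` is the number of edges of a perfect matching of `AD N`, hence the power to which
  -- the scalar `drift k` enters.
  total : ℕ → I → Exponent 14
  total zero    k = 𝟘
  total (suc N) k = cellTotal (suc N) (factor k) ⊕ (total N (next k) ⊕ (N · suc N) ⊗ drift k)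

-- Matching generating functions in a ring where the relations hold

module _ (K : CommutativeRing 0ℓ 0ℓ) where
  open CommutativeRing K

  Inverses : ∀ {n} → (x x⁻¹ : Fin n → Carrier) → Set
  Inverses x x⁻¹ = ∀ i → x i * x⁻¹ i ≈ 1#

  RelationsHold : (Fin 14 → Carrier) → Set
  RelationsHold x = All (λ (p , q , r) → ∏ p + ∏ q ≈ ∏ r) relations
    where
    ∏ : List (Fin 14) → Carrier
    ∏ = foldr (λ i s → x i * s) 1#

module ClosedForm
  (K : CommutativeRing 0ℓ 0ℓ) (x x⁻¹ : Fin 14 → CommutativeRing.Carrier K)
  (inverse : Inverses K x x⁻¹) (relations-hold : RelationsHold K x)
  where
  open CommutativeRing K hiding (zero)
  open import Relation.Binary.Reasoning.Setoid setoid
  open NaturalSolver commutativeSemiring using (solve; _:=_; _:+_; _:*_)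
  open Power K
  open MatchingGeneratingFunction rawRing using (M; weight)

  abstract
    -- Abstract, so that below only these laws are visible and no power is unfolded.
    ⟦_⟧ : Exponent 14 → Carrier
    ⟦_⟧ = monomial x x⁻¹

    ⟦⟧-⊕ : ∀ E F → ⟦ E ⊕ F ⟧ ≈ ⟦ E ⟧ * ⟦ F ⟧
    ⟦⟧-⊕ = monomial-⊕ x x⁻¹ inverse

    ⟦⟧-cong : ∀ {E F} → E ≗ F → ⟦ E ⟧ ≈ ⟦ F ⟧
    ⟦⟧-cong = monomial-cong x x⁻¹

    ⟦⟧-𝟘 : ⟦ 𝟘 ⟧ ≈ 1#
    ⟦⟧-𝟘 = monomial-𝟘 x x⁻¹

    ⟦⟧-generator : ∀ i → ⟦ generator i ⟧ ≈ x i
    ⟦⟧-generator = monomial-generator x x⁻¹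

  ⟦⟧-generators : ∀ is → ⟦ generators is ⟧ ≈ foldr (λ i p → x i * p) 1# is
  ⟦⟧-generators []       = ⟦⟧-𝟘
  ⟦⟧-generators (i ∷ is) = trans (⟦⟧-⊕ (generator i) (generators is))
    (*-cong (⟦⟧-generator i) (⟦⟧-generators is))

  ⟦⟧-inverse : ∀ E → ⟦ E ⟧ * ⟦ 𝟘 ⊘ E ⟧ ≈ 1#
  ⟦⟧-inverse E = trans (sym (⟦⟧-⊕ E (𝟘 ⊘ E)))
    (trans (⟦⟧-cong (λ i → lemma (E i))) ⟦⟧-𝟘)
    where
    lemma : ∀ e → e ℤ.+ (0ℤ ℤ.- e) ≡ 0ℤ
    lemma = solve-∀

  ⟦⟧-cancel : ∀ E {p q} → p * ⟦ E ⟧ ≈ q * ⟦ E ⟧ → p ≈ q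
  ⟦⟧-cancel E {p} {q} eq = trans (sym (strip p)) (trans (*-congʳ eq) (strip q))
    where
    strip : ∀ p → (p * ⟦ E ⟧) * ⟦ 𝟘 ⊘ E ⟧ ≈ p
    strip p = trans (*-assoc p _ _) (trans (*-congˡ (⟦⟧-inverse E)) (*-identityʳ p))

  value : Entry → Carrier
  value nothing  = 0#
  value (just E) = ⟦ E ⟧

  value-cong : ∀ {E F} → Pointwise _≗_ E F → value E ≈ value F
  value-cong (just eq) = ⟦⟧-cong eq
  value-cong nothing   = refl

  value-⊕? : ∀ E F → value (E ⊕? F) ≈ value E * value F
  value-⊕? nothing  F        = sym (zeroˡ _)
  value-⊕? (just E) nothing  = sym (zeroʳ _)
  value-⊕? (just E) (just F) = ⟦⟧-⊕ E F

  value-scale : ∀ t E → value (Maybe.map (_⊕ t) E) ≈ ⟦ t ⟧ * value E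
  value-scale t nothing  = sym (zeroʳ _)
  value-scale t (just E) = trans (⟦⟧-⊕ E t) (*-comm _ _)

  value-⊘ : ∀ F E → ⟦ F ⟧ * value (Maybe.map (_⊘ F) E) ≈ value E
  value-⊘ F nothing  = zeroʳ _
  value-⊘ F (just E) = trans (sym (⟦⟧-⊕ F (E ⊘ F))) (⟦⟧-cong (λ i → lemma (F i) (E i)))
    where
    lemma : ∀ f e → f ℤ.+ (e ℤ.- f) ≡ e
    lemma = solve-∀

  -- The hypotheses say E = G p / r and F = G q / r with denominators cleared, so the sum is G (p +
  -- q) / r = G; the invertible monomial r is cancelled at the end.
  scaled-relation : ∀ {E F G p q r} →
    ⟦ generators p ⟧ + ⟦ generators q ⟧ ≈ ⟦ generators r ⟧ →
    (E ⊕ generators r) ≗ (G ⊕ generators p) → (F ⊕ generators r) ≗ (G ⊕ generators q) →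
    ⟦ E ⟧ + ⟦ F ⟧ ≈ ⟦ G ⟧
  scaled-relation {E} {F} {G} {p} {q} {r} rel eqE eqF = ⟦⟧-cancel (generators r) (begin
    (⟦ E ⟧ + ⟦ F ⟧) * ⟦ generators r ⟧
      ≈⟨ distribʳ _ _ _ ⟩
    ⟦ E ⟧ * ⟦ generators r ⟧ + ⟦ F ⟧ * ⟦ generators r ⟧
      ≈⟨ +-cong (shifted eqE) (shifted eqF) ⟩
    ⟦ G ⟧ * ⟦ generators p ⟧ + ⟦ G ⟧ * ⟦ generators q ⟧
      ≈⟨ distribˡ _ _ _ ⟨
    ⟦ G ⟧ * (⟦ generators p ⟧ + ⟦ generators q ⟧)
      ≈⟨ *-congˡ rel ⟩
    ⟦ G ⟧ * ⟦ generators r ⟧ ∎)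
    where
    shifted : ∀ {E F H H′} → (E ⊕ H) ≗ (F ⊕ H′) → ⟦ E ⟧ * ⟦ H ⟧ ≈ ⟦ F ⟧ * ⟦ H′ ⟧
    shifted {E} {F} {H} {H′} eq = trans (sym (⟦⟧-⊕ E H)) (trans (⟦⟧-cong eq) (⟦⟧-⊕ F H′))

  sumsTo-sound : ∀ E F G → SumsTo E F G → value E + value F ≈ ⟦ G ⟧
  sumsTo-sound nothing  (just F) G eq = trans (+-identityˡ _) (⟦⟧-cong eq)
  sumsTo-sound (just E) nothing  G eq = trans (+-identityʳ _) (⟦⟧-cong eq)
  sumsTo-sound (just E) (just F) G any with (p , q , r) , rel∈ , eq ← find any = go eq
    where
    expand : ∀ is → ⟦ generators is ⟧ ≈ foldr (λ i s → x i * s) 1# is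
    expand = ⟦⟧-generators
    rel : ⟦ generators p ⟧ + ⟦ generators q ⟧ ≈ ⟦ generators r ⟧
    rel = trans (+-cong (expand p) (expand q)) (trans (All.lookup relations-hold rel∈) (sym (expand r)))
    go : _ → ⟦ E ⟧ + ⟦ F ⟧ ≈ ⟦ G ⟧
    go (inj₁ (eqE , eqF)) = scaled-relation {E} {F} {G} {p} {q} {r} rel eqE eqF
    go (inj₂ (eqE , eqF)) = scaled-relation {E} {F} {G} {q} {p} {r} (trans (+-comm _ _) rel) eqE eqF

  M-cong : ∀ G {w w′ : FiniteGraph.Edge G → Carrier} → (∀ e → w e ≈ w′ e) → M G w ≈ M G w′
  M-cong G {w} {w′} eq = sum-cong (perfectMatchings G)
    where
    weight-cong : ∀ S → weight w S ≈ weight w′ S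
    weight-cong []      = refl
    weight-cong (e ∷ S) = *-cong (eq e) (weight-cong S)
    sum-cong : ∀ Ss → foldr _+_ 0# (map (weight w) Ss) ≈ foldr _+_ 0# (map (weight w′) Ss)
    sum-cong []       = refl
    sum-cong (S ∷ Ss) = +-cong (weight-cong S) (sum-cong Ss)

  periodic : ∀ (A : Matrix) n → AztecEdge n → Carrier
  periodic A n (r , s) =
    let (i , ρ) = remQuot {n} 2 r
        (j , σ) = remQuot {n} 2 s
    in  value (A (parity i) ρ (parity j) σ)

  periodic-cong : ∀ n A A′ → (∀ π ρ π′ σ → value (A π ρ π′ σ) ≈ value (A′ π ρ π′ σ)) →
                  ∀ e → periodic A n e ≈ periodic A′ n e
  periodic-cong n A A′ eq (r , s) = eq _ _ _ _

  periodic-corner : ∀ A {n} (c : Cell n) ρ σ → let (i , j) = c in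
                    periodic A n (corner c ρ σ) ≡ value (A (parity i) ρ (parity j) σ)
  periodic-corner A (i , j) ρ σ = ≡.cong₂ (λ (i , ρ) (j , σ) → value (A (parity i) ρ (parity j) σ))
    (Fin.remQuot-combine i ρ) (Fin.remQuot-combine j σ)

  periodic-embed : ∀ A m e → periodic A (suc m) (embedEdge m e) ≡ periodic (inner A) m e
  periodic-embed A m (r , s) =
    let (i , ρ) = remQuot {m} 2 r
        (j , σ) = remQuot {m} 2 s
    in ≡.trans
      (≡.cong₂ (λ (i , ρ) (j , σ) → value (A (parity i) ρ (parity j) σ))
        (remQuot-shift {m} r) (remQuot-shift {m} s))
      (≡.cong₂ (λ π π′ → value (A π (opposite ρ) π′ (opposite σ))) (parity-⊹ i ρ) (parity-⊹ j σ))

  Factorises : Matrix → Factors → Set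
  Factorises A Δ = ∀ π π′ → value (A π 0F π′ 0F) * value (A π 1F π′ 1F)
                          + value (A π 0F π′ 1F) * value (A π 1F π′ 0F) ≈ ⟦ Δ π π′ ⟧

  module _ (m : ℕ) (A : Matrix) (Δ : Factors) (factorises : Factorises A Δ) where
    private
      n = suc m
    open Aztec n K

    cellFactor≈ : ∀ (c : Cell n) → let (i , j) = c in cellFactor (periodic A n) c ≈ ⟦ Δ (parity i) (parity j) ⟧
    cellFactor≈ c@(i , j) = trans (reflexive (≡.cong₂ _+_
      (≡.cong₂ _*_ (periodic-corner A c 0F 0F) (periodic-corner A c 1F 1F))
      (≡.cong₂ _*_ (periodic-corner A c 0F 1F) (periodic-corner A c 1F 0F))))
      (factorises (parity i) (parity j))

    cellProduct≈ : ∀ cs → cellProduct (periodic A n) cs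
                          ≈ ⟦ (λ i → sumℤ cs (λ (r , s) → Δ (parity r) (parity s) i)) ⟧
    cellProduct≈ []       = sym ⟦⟧-𝟘
    cellProduct≈ (c@(i , j) ∷ cs) = trans (*-cong (cellFactor≈ c) (cellProduct≈ cs))
      (sym (⟦⟧-⊕ (Δ (parity i) (parity j)) (λ i → sumℤ cs (λ (r , s) → Δ (parity r) (parity s) i))))

    private
      w w′ : AztecEdge n → Carrier
      w  = periodic A n
      w′ = periodic (dual A Δ) n

    opposites : ∀ c ρ σ → cellFactor w c * w′ (corner c ρ σ) ≈ w (corner c (opposite ρ) (opposite σ))
    opposites c@(i , j) ρ σ = begin
      cellFactor w c * w′ (corner c ρ σ)
        ≈⟨ *-cong (cellFactor≈ c) (reflexive (periodic-corner (dual A Δ) c ρ σ)) ⟩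
      ⟦ Δ (parity i) (parity j) ⟧ * value (dual A Δ (parity i) ρ (parity j) σ)
        ≈⟨ value-⊘ (Δ (parity i) (parity j)) (A (parity i) (opposite ρ) (parity j) (opposite σ)) ⟩
      value (A (parity i) (opposite ρ) (parity j) (opposite σ))
        ≡⟨ periodic-corner A c (opposite ρ) (opposite σ) ⟨
      w (corner c (opposite ρ) (opposite σ)) ∎

    -- Each dual weight times δ is the opposite weight, so δ² times the dual cell factor is δ again.
    -- One δ is cancelled in `factors-inverse`, where it is known to be an invertible monomial.
    factor-inverse : ∀ δ w₀₀ w₀₁ w₁₀ w₁₁ w′₀₀ w′₀₁ w′₁₀ w′₁₁ →
      δ * w′₀₀ ≈ w₁₁ → δ * w′₀₁ ≈ w₁₀ → δ * w′₁₀ ≈ w₀₁ → δ * w′₁₁ ≈ w₀₀ →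
      δ ≈ w₀₀ * w₁₁ + w₀₁ * w₁₀ →
      (δ * (w′₀₀ * w′₁₁ + w′₀₁ * w′₁₀)) * δ ≈ δ
    factor-inverse δ w₀₀ w₀₁ w₁₀ w₁₁ w′₀₀ w′₀₁ w′₁₀ w′₁₁ eq₀₀ eq₀₁ eq₁₀ eq₁₁ δ≈ = begin
      (δ * (w′₀₀ * w′₁₁ + w′₀₁ * w′₁₀)) * δ
        ≈⟨ solve 5 (λ δ a b c d → (δ :* (a :* b :+ c :* d)) :* δ
                                := (δ :* b) :* (δ :* a) :+ (δ :* d) :* (δ :* c)) refl δ w′₀₀ w′₁₁ w′₀₁ w′₁₀ ⟩
      (δ * w′₁₁) * (δ * w′₀₀) + (δ * w′₁₀) * (δ * w′₀₁)
        ≈⟨ +-cong (*-cong eq₁₁ eq₀₀) (*-cong eq₁₀ eq₀₁) ⟩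
      w₀₀ * w₁₁ + w₀₁ * w₁₀
        ≈⟨ δ≈ ⟨
      δ ∎

    factors-inverse : ∀ c → cellFactor w c * cellFactor w′ c ≈ 1#
    factors-inverse c@(i , j) = ⟦⟧-cancel (Δ (parity i) (parity j)) (begin
      (cellFactor w c * cellFactor w′ c) * ⟦ Δ (parity i) (parity j) ⟧
        ≈⟨ *-congˡ (cellFactor≈ c) ⟨
      (cellFactor w c * cellFactor w′ c) * cellFactor w c
        ≈⟨ factor-inverse (cellFactor w c)
             (w (corner c 0F 0F)) (w (corner c 0F 1F)) (w (corner c 1F 0F)) (w (corner c 1F 1F))
             (w′ (corner c 0F 0F)) (w′ (corner c 0F 1F)) (w′ (corner c 1F 0F)) (w′ (corner c 1F 1F))
             (opposites c 0F 0F) (opposites c 0F 1F) (opposites c 1F 0F) (opposites c 1F 1F) refl ⟩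
      cellFactor w c
        ≈⟨ cellFactor≈ c ⟩
      ⟦ Δ (parity i) (parity j) ⟧
        ≈⟨ *-identityˡ _ ⟨
      1# * ⟦ Δ (parity i) (parity j) ⟧ ∎)

    periodic-dual : Dual w w′
    periodic-dual = record { opposites = opposites ; factors = factors-inverse }

    M-periodic : M (AD n) (periodic A n) ≈ ⟦ cellTotal n Δ ⟧ * M (AD m) (periodic (inner (dual A Δ)) m)
    M-periodic = trans (M-reduce K m periodic-dual)
      (*-cong (trans (cellProduct≈ (cells n)) (⟦⟧-cong (sumℤ-cells n Δ)))
              (M-cong (AD m) (λ e → reflexive (periodic-embed (dual A Δ) m e))))

  scale-factorises : ∀ t A Δ → Factorises A Δ → Factorises (scale t A) (scaleFactors t Δ)
  scale-factorises t A Δ fact π π′ = begin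
    value (scale t A π 0F π′ 0F) * value (scale t A π 1F π′ 1F)
    + value (scale t A π 0F π′ 1F) * value (scale t A π 1F π′ 0F)
      ≈⟨ +-cong (*-cong (value-scale t (A π 0F π′ 0F)) (value-scale t (A π 1F π′ 1F)))
                (*-cong (value-scale t (A π 0F π′ 1F)) (value-scale t (A π 1F π′ 0F))) ⟩
    (⟦ t ⟧ * value (A π 0F π′ 0F)) * (⟦ t ⟧ * value (A π 1F π′ 1F))
    + (⟦ t ⟧ * value (A π 0F π′ 1F)) * (⟦ t ⟧ * value (A π 1F π′ 0F))
      ≈⟨ solve 5 (λ t a b c d → (t :* a) :* (t :* b) :+ (t :* c) :* (t :* d)
                              := (a :* b :+ c :* d) :* (t :* t)) refl ⟦ t ⟧ _ _ _ _ ⟩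
    (value (A π 0F π′ 0F) * value (A π 1F π′ 1F) + value (A π 0F π′ 1F) * value (A π 1F π′ 0F)) * (⟦ t ⟧ * ⟦ t ⟧)
      ≈⟨ *-cong (fact π π′) (sym (⟦⟧-⊕ t t)) ⟩
    ⟦ Δ π π′ ⟧ * ⟦ t ⊕ t ⟧
      ≈⟨ ⟦⟧-⊕ _ _ ⟨
    ⟦ scaleFactors t Δ π π′ ⟧ ∎

  -- Weights scaled by t have cell factors scaled by t², hence reduced weights scaled by t / t² = 1
  -- / t.
  scale-next : ∀ (Δ s t : Exponent 14) E F → Pointwise _≗_ (Maybe.map (_⊘ Δ) E) (Maybe.map (_⊕ s) F) →
               Pointwise _≗_ (Maybe.map (_⊘ (Δ ⊕ (t ⊕ t))) (Maybe.map (_⊕ t) E)) (Maybe.map (_⊕ (s ⊘ t)) F)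
  scale-next Δ s t nothing  nothing  nothing   = nothing
  scale-next Δ s t (just E) (just F) (just eq) = just λ i → ≡.trans (lemma (E i) (Δ i) (t i))
    (≡.trans (≡.cong (ℤ._- t i) (eq i)) (ℤ.+-assoc (F i) (s i) (ℤ.- t i)))
    where
    lemma : ∀ e δ t → (e ℤ.+ t) ℤ.- (δ ℤ.+ (t ℤ.+ t)) ≡ (e ℤ.- δ) ℤ.- t
    lemma = solve-∀

  -- Reducing the weights matrix k gives those of matrix (next k), up to the scalar drift k;
  -- M (AD N) with the weights matrix k is then the monomial with exponent total N k.
  module _
    {I : Set} (matrix : I → Matrix) (factor : I → Factors) (next : I → I) (drift : I → Exponent 14)
    (matrix-sums : ∀ k π π′ → SumsTo (matrix k π 0F π′ 0F ⊕? matrix k π 1F π′ 1F)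
                                     (matrix k π 0F π′ 1F ⊕? matrix k π 1F π′ 0F) (factor k π π′))
    (matrix-next : ∀ k π ρ π′ σ →
      Pointwise _≗_ (inner (dual (matrix k) (factor k)) π ρ π′ σ) (Maybe.map (_⊕ drift k) (matrix (next k) π ρ π′ σ)))
    where
    open Total factor next drift

    matrix-factorises : ∀ k → Factorises (matrix k) (factor k)
    matrix-factorises k π π′ = trans (sym (+-cong
        (value-⊕? (matrix k π 0F π′ 0F) (matrix k π 1F π′ 1F)) (value-⊕? (matrix k π 0F π′ 1F) (matrix k π 1F π′ 0F))))
      (sumsTo-sound (matrix k π 0F π′ 0F ⊕? matrix k π 1F π′ 1F) (matrix k π 0F π′ 1F ⊕? matrix k π 1F π′ 0F)
        (factor k π π′) (matrix-sums k π π′))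

    -- The scalar `t` is there for the induction: reducing `matrix k` scaled by `t` gives
    -- `matrix (next k)` scaled by `drift k ⊘ t`.
    M-matrix : ∀ N k t → M (AD N) (periodic (scale t (matrix k)) N) ≈ ⟦ total N k ⊕ (N · suc N) ⊗ t ⟧
    M-matrix zero    k t = trans (+-identityʳ _) (sym ⟦⟧-𝟘)
    M-matrix (suc N) k t = begin
      M (AD (suc N)) (periodic (scale t (matrix k)) (suc N))
        ≈⟨ M-periodic N (scale t (matrix k)) (scaleFactors t (factor k))
             (scale-factorises t (matrix k) (factor k) (matrix-factorises k)) ⟩
      ⟦ cellTotal (suc N) (scaleFactors t (factor k)) ⟧
      * M (AD N) (periodic (inner (dual (scale t (matrix k)) (scaleFactors t (factor k)))) N)
        ≈⟨ *-congˡ (M-cong (AD N) (periodic-cong N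
             (inner (dual (scale t (matrix k)) (scaleFactors t (factor k)))) (scale (drift k ⊘ t) (matrix (next k)))
             λ π ρ π′ σ → value-cong (scale-next (factor k (parity+ π ρ) (parity+ π′ σ)) (drift k) t
               (matrix k (parity+ π ρ) (opposite (opposite ρ)) (parity+ π′ σ) (opposite (opposite σ)))
               (matrix (next k) π ρ π′ σ) (matrix-next k π ρ π′ σ)))) ⟩
      ⟦ cellTotal (suc N) (scaleFactors t (factor k)) ⟧ * M (AD N) (periodic (scale (drift k ⊘ t) (matrix (next k))) N)
        ≈⟨ *-congˡ (M-matrix N (next k) (drift k ⊘ t)) ⟩
      ⟦ cellTotal (suc N) (scaleFactors t (factor k)) ⟧ * ⟦ total N (next k) ⊕ (N · suc N) ⊗ (drift k ⊘ t) ⟧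
        ≈⟨ ⟦⟧-⊕ _ _ ⟨
      ⟦ cellTotal (suc N) (scaleFactors t (factor k)) ⊕ (total N (next k) ⊕ (N · suc N) ⊗ (drift k ⊘ t)) ⟧
        ≈⟨ ⟦⟧-cong exponents ⟩
      ⟦ total (suc N) k ⊕ (suc N · suc (suc N)) ⊗ t ⟧ ∎
      where
      -- The coefficient of t is 2(N + 1)² from the (N + 1)² cell factors and -N(N + 1) from the
      -- smaller diamond, together (N + 1)(N + 2).
      exponents : (cellTotal (suc N) (scaleFactors t (factor k)) ⊕ (total N (next k) ⊕ (N · suc N) ⊗ (drift k ⊘ t)))
                ≗ (total (suc N) k ⊕ (suc N · suc (suc N)) ⊗ t)
      exponents i = ≡.trans
        (≡.cong₂ ℤ._+_ (cellTotal-scale (suc N) t (factor k) i)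
          (≡.cong (λ p → total N (next k) i ℤ.+ p ℤ.* (drift k i ℤ.- t i)) (ℤ.pos-* N (suc N))))
        (≡.trans (lemma (+ N) (cellTotal (suc N) (factor k) i) (total N (next k) i) (drift k i) (t i))
          (≡.cong₂ (λ p q → cellTotal (suc N) (factor k) i ℤ.+ (total N (next k) i ℤ.+ p ℤ.* drift k i) ℤ.+ q ℤ.* t i)
            (≡.sym (ℤ.pos-* N (suc N))) (≡.sym (ℤ.pos-* (suc N) (suc (suc N))))))
        where
        lemma : ∀ ν c s d t →
          (c ℤ.+ (1ℤ ℤ.+ ν) ℤ.* (1ℤ ℤ.+ ν) ℤ.* (t ℤ.+ t)) ℤ.+ (s ℤ.+ ν ℤ.* (1ℤ ℤ.+ ν) ℤ.* (d ℤ.- t))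
          ≡ c ℤ.+ (s ℤ.+ ν ℤ.* (1ℤ ℤ.+ ν) ℤ.* d) ℤ.+ (1ℤ ℤ.+ ν) ℤ.* (+ 2 ℤ.+ ν) ℤ.* t
        lemma = solve-∀

-- Polynomials as functions on the positive integers

open ≡.≡-Reasoning

private
  module Poly (m : ℕ) = RawRing ℤ[ m ]

ev : ∀ m → Vec ℤ m → Poly.Carrier m → ℤ
ev zero    []      z       = z
ev (suc m) (x ∷ ρ) []      = 0ℤ
ev (suc m) (x ∷ ρ) (c ∷ p) = ev m ρ c ℤ.+ x ℤ.* ev (suc m) (x ∷ ρ) p

ev-0 : ∀ m ρ → ev m ρ (Poly.0# m) ≡ 0ℤ
ev-0 zero    []      = ≡.refl
ev-0 (suc m) (x ∷ ρ) = ≡.refl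

ev-1 : ∀ m ρ → ev m ρ (Poly.1# m) ≡ 1ℤ
ev-1 zero    []      = ≡.refl
ev-1 (suc m) (x ∷ ρ) = ≡.cong₂ ℤ._+_ (ev-1 m ρ) (ℤ.*-zeroʳ x)

ev-+ : ∀ m ρ p q → ev m ρ (Poly._+_ m p q) ≡ ev m ρ p ℤ.+ ev m ρ q
ev-+ zero    []      p       q       = ≡.refl
ev-+ (suc m) (x ∷ ρ) []      q       = ≡.sym (ℤ.+-identityˡ _)
ev-+ (suc m) (x ∷ ρ) (c ∷ p) []      = ≡.sym (ℤ.+-identityʳ _)
ev-+ (suc m) (x ∷ ρ) (c ∷ p) (d ∷ q) = ≡.trans
  (≡.cong₂ (λ y z → y ℤ.+ x ℤ.* z) (ev-+ m ρ c d) (ev-+ (suc m) (x ∷ ρ) p q))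
  (lemma x (ev m ρ c) (ev m ρ d) (ev (suc m) (x ∷ ρ) p) (ev (suc m) (x ∷ ρ) q))
  where
  lemma : ∀ x c d p q → (c ℤ.+ d) ℤ.+ x ℤ.* (p ℤ.+ q) ≡ (c ℤ.+ x ℤ.* p) ℤ.+ (d ℤ.+ x ℤ.* q)
  lemma = solve-∀

ev-* : ∀ m ρ p q → ev m ρ (Poly._*_ m p q) ≡ ev m ρ p ℤ.* ev m ρ q

ev-scale : ∀ m x ρ c q → ev (suc m) (x ∷ ρ) (map (Poly._*_ m c) q) ≡ ev m ρ c ℤ.* ev (suc m) (x ∷ ρ) q
ev-scale m x ρ c []      = ≡.sym (ℤ.*-zeroʳ (ev m ρ c))
ev-scale m x ρ c (d ∷ q) = ≡.trans
  (≡.cong₂ (λ y z → y ℤ.+ x ℤ.* z) (ev-* m ρ c d) (ev-scale m x ρ c q))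
  (lemma x (ev m ρ c) (ev m ρ d) (ev (suc m) (x ∷ ρ) q))
  where
  lemma : ∀ x c d q → c ℤ.* d ℤ.+ x ℤ.* (c ℤ.* q) ≡ c ℤ.* (d ℤ.+ x ℤ.* q)
  lemma = solve-∀

ev-* zero    []      p       q = ≡.refl
ev-* (suc m) (x ∷ ρ) []      q = ≡.refl
ev-* (suc m) (x ∷ ρ) (c ∷ p) q = begin
  ev (suc m) (x ∷ ρ) (addPoly ℤ[ m ] (map (Poly._*_ m c) q) (Poly.0# m ∷ mulPoly ℤ[ m ] p q))
    ≡⟨ ev-+ (suc m) (x ∷ ρ) (map (Poly._*_ m c) q) _ ⟩
  ev (suc m) (x ∷ ρ) (map (Poly._*_ m c) q)
    ℤ.+ (ev m ρ (Poly.0# m) ℤ.+ x ℤ.* ev (suc m) (x ∷ ρ) (mulPoly ℤ[ m ] p q))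
    ≡⟨ ≡.cong₂ ℤ._+_ (ev-scale m x ρ c q)
         (≡.cong₂ (λ y z → y ℤ.+ x ℤ.* z) (ev-0 m ρ) (ev-* (suc m) (x ∷ ρ) p q)) ⟩
  ev m ρ c ℤ.* Q ℤ.+ (0ℤ ℤ.+ x ℤ.* (ev (suc m) (x ∷ ρ) p ℤ.* Q))
    ≡⟨ lemma x (ev m ρ c) (ev (suc m) (x ∷ ρ) p) Q ⟩
  (ev m ρ c ℤ.+ x ℤ.* ev (suc m) (x ∷ ρ) p) ℤ.* Q ∎
  where
  Q = ev (suc m) (x ∷ ρ) q
  lemma : ∀ x c p q → c ℤ.* q ℤ.+ (0ℤ ℤ.+ x ℤ.* (p ℤ.* q)) ≡ (c ℤ.+ x ℤ.* p) ℤ.* q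
  lemma = solve-∀

ev-X : ∀ m ρ i → ev m ρ (X m i) ≡ lookup ρ i
ev-X (suc m) (x ∷ ρ) zero    = begin
  ev m ρ (Poly.0# m) ℤ.+ x ℤ.* (ev m ρ (Poly.1# m) ℤ.+ x ℤ.* 0ℤ)
    ≡⟨ ≡.cong₂ (λ y z → y ℤ.+ x ℤ.* (z ℤ.+ x ℤ.* 0ℤ)) (ev-0 m ρ) (ev-1 m ρ) ⟩
  0ℤ ℤ.+ x ℤ.* (1ℤ ℤ.+ x ℤ.* 0ℤ)
    ≡⟨ lemma x ⟩
  x ∎
  where
  lemma : ∀ x → 0ℤ ℤ.+ x ℤ.* (1ℤ ℤ.+ x ℤ.* 0ℤ) ≡ x
  lemma = solve-∀
ev-X (suc m) (x ∷ ρ) (suc i) =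
  ≡.trans (≡.cong₂ ℤ._+_ (ev-X m ρ i) (ℤ.*-zeroʳ x)) (ℤ.+-identityʳ _)

ev-cong : ∀ m ρ {p q} → Poly._≈_ m p q → ev m ρ p ≡ ev m ρ q
ev-cong zero    []      eq = eq
ev-cong (suc m) (x ∷ ρ) {[]}    {[]}    eq = ≡.refl
ev-cong (suc m) (x ∷ ρ) {[]}    {d ∷ q} eq = ≡.trans (≡.sym (≡.cong₂ ℤ._+_ (ev-0 m ρ) (ℤ.*-zeroʳ x)))
  (≡.cong₂ (λ y z → y ℤ.+ x ℤ.* z) (ev-cong m ρ (eq 0))
    (ev-cong (suc m) (x ∷ ρ) {[]} {q} (λ i → eq (suc i))))
ev-cong (suc m) (x ∷ ρ) {c ∷ p} {[]}    eq = ≡.trans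
  (≡.cong₂ (λ y z → y ℤ.+ x ℤ.* z) (ev-cong m ρ (eq 0))
    (ev-cong (suc m) (x ∷ ρ) {p} {[]} (λ i → eq (suc i))))
  (≡.cong₂ ℤ._+_ (ev-0 m ρ) (ℤ.*-zeroʳ x))
ev-cong (suc m) (x ∷ ρ) {c ∷ p} {d ∷ q} eq = ≡.cong₂ (λ y z → y ℤ.+ x ℤ.* z) (ev-cong m ρ (eq 0))
  (ev-cong (suc m) (x ∷ ρ) {p} {q} (λ i → eq (suc i)))

point : ∀ {m} → Vec ℕ m → Vec ℤ m
point = Vec.map (λ n → + suc n)

divisible-by-all⇒0 : ∀ k (q : ℕ → ℤ) → (∀ n → k ≡ + suc n ℤ.* q n) → k ≡ 0ℤ
divisible-by-all⇒0 k q eq with ℤ.∣ k ∣ in ∣k∣≡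
... | zero  = ℤ.∣i∣≡0⇒i≡0 ∣k∣≡
-- The hypothesis at `suc n` makes |k| divisible by |k| + 1.
... | suc n = ⊥-elim (ℕ∣.>⇒∤ (ℕ.n<1+n (suc n)) (ℕ∣.divides ℤ.∣ q (suc n) ∣ (begin
  suc n                                     ≡⟨ ∣k∣≡ ⟨
  ℤ.∣ k ∣                                   ≡⟨ ≡.cong ℤ.∣_∣ (eq (suc n)) ⟩
  ℤ.∣ + suc (suc n) ℤ.* q (suc n) ∣         ≡⟨ ℤ.abs-* (+ suc (suc n)) (q (suc n)) ⟩
  suc (suc n) ℕ.* ℤ.∣ q (suc n) ∣           ≡⟨ ℕ.*-comm (suc (suc n)) ℤ.∣ q (suc n) ∣ ⟩
  ℤ.∣ q (suc n) ∣ ℕ.* suc (suc n)           ∎)))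

module _ (m : ℕ) where
  ev-uncons : ∀ x ρ p → ev (suc m) (x ∷ ρ) p
                        ≡ ev m ρ (coeff ℤ[ m ] p 0) ℤ.+ x ℤ.* ev (suc m) (x ∷ ρ) (drop 1 p)
  ev-uncons x ρ []      = ≡.sym (≡.cong₂ ℤ._+_ (ev-0 m ρ) (ℤ.*-zeroʳ x))
  ev-uncons x ρ (c ∷ p) = ≡.refl

  coeff-drop : ∀ p i → coeff ℤ[ m ] (drop 1 p) i ≡ coeff ℤ[ m ] p (suc i)
  coeff-drop []      i = ≡.refl
  coeff-drop (c ∷ p) i = ≡.refl

  -- The difference of the constant terms is divisible by every positive integer.
  ev-coeff : ∀ ρ p q →
    (∀ n → ev (suc m) (+ suc n ∷ ρ) p ≡ ev (suc m) (+ suc n ∷ ρ) q) →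
    ∀ i → ev m ρ (coeff ℤ[ m ] p i) ≡ ev m ρ (coeff ℤ[ m ] q i)
  ev-coeff ρ p q eq zero    = ℤ.i-j≡0⇒i≡j _ _ (divisible-by-all⇒0 _
    (λ n → ev (suc m) (+ suc n ∷ ρ) (drop 1 q) ℤ.- ev (suc m) (+ suc n ∷ ρ) (drop 1 p))
    (λ n → lemma (+ suc n) (ev m ρ (coeff ℤ[ m ] p 0)) (ev m ρ (coeff ℤ[ m ] q 0))
        (ev (suc m) (+ suc n ∷ ρ) (drop 1 p)) (ev (suc m) (+ suc n ∷ ρ) (drop 1 q))
      (≡.trans (≡.sym (ev-uncons (+ suc n) ρ p)) (≡.trans (eq n) (ev-uncons (+ suc n) ρ q)))))
    where
    lemma : ∀ x c d P Q → c ℤ.+ x ℤ.* P ≡ d ℤ.+ x ℤ.* Q → c ℤ.- d ≡ x ℤ.* (Q ℤ.- P)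
    lemma x c d P Q e = begin
      c ℤ.- d                                  ≡⟨ rearrange x c d P ⟩
      (c ℤ.+ x ℤ.* P) ℤ.- d ℤ.- x ℤ.* P        ≡⟨ ≡.cong (λ t → t ℤ.- d ℤ.- x ℤ.* P) e ⟩
      (d ℤ.+ x ℤ.* Q) ℤ.- d ℤ.- x ℤ.* P        ≡⟨ rearrange′ x d P Q ⟩
      x ℤ.* (Q ℤ.- P)                          ∎
      where
      rearrange : ∀ x c d P → c ℤ.- d ≡ (c ℤ.+ x ℤ.* P) ℤ.- d ℤ.- x ℤ.* P
      rearrange = solve-∀
      rearrange′ : ∀ x d P Q → (d ℤ.+ x ℤ.* Q) ℤ.- d ℤ.- x ℤ.* P ≡ x ℤ.* (Q ℤ.- P)
      rearrange′ = solve-∀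
  ev-coeff ρ p q eq (suc i) = ≡.trans (≡.sym (≡.cong (ev m ρ) (coeff-drop p i)))
    (≡.trans (ev-coeff ρ (drop 1 p) (drop 1 q) tails i) (≡.cong (ev m ρ) (coeff-drop q i)))
    where
    tails : ∀ n → ev (suc m) (+ suc n ∷ ρ) (drop 1 p) ≡ ev (suc m) (+ suc n ∷ ρ) (drop 1 q)
    tails n = ℤ.*-cancelˡ-≡ (+ suc n) _ _ (ℤ-group.∙-cancelˡ (ev m ρ (coeff ℤ[ m ] q 0)) _ _
      (≡.trans (≡.sym (≡.trans (ev-uncons (+ suc n) ρ p)
                         (≡.cong (ℤ._+ (+ suc n ℤ.* ev (suc m) (+ suc n ∷ ρ) (drop 1 p)))
                               (ev-coeff ρ p q eq zero))))
             (≡.trans (eq n) (ev-uncons (+ suc n) ρ q))))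

ev-faithful : ∀ m {p q} → (∀ (ρ : Vec ℕ m) → ev m (point ρ) p ≡ ev m (point ρ) q) → Poly._≈_ m p q
ev-faithful zero    eq = eq []
ev-faithful (suc m) {p} {q} eq i =
  ev-faithful m (λ ρ → ev-coeff m (point ρ) p q (λ n → eq (n ∷ ρ)) i)

-- Irreducibility of R

module Ops (m : ℕ) where
  open RawRing ℤ[ m ] public

  -- The source of all laws of ℤ[m] below: each is a law of ℤ, applied at every point.
  ≈-by-ev : ∀ {p q} → (∀ ρ → ev m ρ p ≡ ev m ρ q) → p ≈ q
  ≈-by-ev eq = ev-faithful m (λ ρ → eq (point ρ))

  ≈-refl : ∀ {p} → p ≈ p
  ≈-refl = ≈-by-ev (λ ρ → ≡.refl)

  ≈-sym : ∀ {p q} → p ≈ q → q ≈ p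
  ≈-sym eq = ≈-by-ev (λ ρ → ≡.sym (ev-cong m ρ eq))

  ≈-trans : ∀ {p q r} → p ≈ q → q ≈ r → p ≈ r
  ≈-trans eq eq′ = ≈-by-ev (λ ρ → ≡.trans (ev-cong m ρ eq) (ev-cong m ρ eq′))

  *-cong : ∀ {p p′ q q′} → p ≈ p′ → q ≈ q′ → p * q ≈ p′ * q′
  *-cong {p} {p′} {q} {q′} eq eq′ = ≈-by-ev (λ ρ → ≡.trans (ev-* m ρ p q)
    (≡.trans (≡.cong₂ ℤ._*_ (ev-cong m ρ eq) (ev-cong m ρ eq′)) (≡.sym (ev-* m ρ p′ q′))))

  *-comm : ∀ p q → p * q ≈ q * p
  *-comm p q = ≈-by-ev (λ ρ → ≡.trans (ev-* m ρ p q) (≡.trans (ℤ.*-comm (ev m ρ p) _) (≡.sym (ev-* m ρ q p))))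

  *-zeroˡ : ∀ q → 0# * q ≈ 0#
  *-zeroˡ q = ≈-by-ev (λ ρ → ≡.trans (ev-* m ρ 0# q)
    (≡.trans (≡.cong (ℤ._* ev m ρ q) (ev-0 m ρ)) (≡.sym (ev-0 m ρ))))

  *-zeroʳ : ∀ q → q * 0# ≈ 0#
  *-zeroʳ q = ≈-trans (*-comm q 0#) (*-zeroˡ q)

  +-cong : ∀ {p p′ q q′} → p ≈ p′ → q ≈ q′ → p + q ≈ p′ + q′
  +-cong {p} {p′} {q} {q′} eq eq′ = ≈-by-ev (λ ρ → ≡.trans (ev-+ m ρ p q)
    (≡.trans (≡.cong₂ ℤ._+_ (ev-cong m ρ eq) (ev-cong m ρ eq′)) (≡.sym (ev-+ m ρ p′ q′))))

  +-identityˡ : ∀ q → 0# + q ≈ q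
  +-identityˡ q = ≈-by-ev (λ ρ → ≡.trans (ev-+ m ρ 0# q)
    (≡.trans (≡.cong (ℤ._+ ev m ρ q) (ev-0 m ρ)) (ℤ.+-identityˡ _)))

  +-identityʳ : ∀ q → q + 0# ≈ q
  +-identityʳ q = ≈-by-ev (λ ρ → ≡.trans (ev-+ m ρ q 0#)
    (≡.trans (≡.cong (λ z → ev m ρ q ℤ.+ z) (ev-0 m ρ)) (ℤ.+-identityʳ _)))

  Unit : Carrier → Set
  Unit p = ∃ λ q → q * p ≈ 1#

≈0? : ∀ m p → Dec (Ops._≈_ m p (Ops.0# m))
≈0? zero    z       = z ℤ.≟ 0ℤ
≈0? (suc m) []      = yes (λ i → Ops.≈-refl m)
≈0? (suc m) (c ∷ p) = map′
  (λ { (c≈0 , p≈0) zero → c≈0 ; (c≈0 , p≈0) (suc i) → p≈0 i })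
  (λ eq → eq 0 , λ i → eq (suc i))
  (≈0? m c ×-dec ≈0? (suc m) p)

-- Degrees in the variable adjoined last

module _ (m : ℕ) where
  open Ops m

  ZeroFrom : ℕ → List Carrier → Set
  ZeroFrom n p = ∀ i → coeff ℤ[ m ] p (n ℕ.+ i) ≈ 0#

  -- Lists may end in zeros, so the degree cannot be read off from the length.
  record Degree (p : List Carrier) (n : ℕ) : Set where
    constructor hasDegree
    field
      leading≉0 : ¬ coeff ℤ[ m ] p n ≈ 0#
      zeroFrom  : ZeroFrom (suc n) p

  coeff-drop-+ : ∀ n p i → coeff ℤ[ m ] (drop n p) i ≡ coeff ℤ[ m ] p (n ℕ.+ i)
  coeff-drop-+ zero    p       i = ≡.refl
  coeff-drop-+ (suc n) []      i = ≡.refl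
  coeff-drop-+ (suc n) (c ∷ p) i = coeff-drop-+ n p i

  degree? : ∀ p n → Dec (Degree p n)
  degree? p n = map′ (λ (l , z) → hasDegree l (λ i → ≡.subst (_≈ 0#) (coeff-drop-+ (suc n) p i) (z i)))
                     (λ (hasDegree l z) → l , λ i → ≡.subst (_≈ 0#) (≡.sym (coeff-drop-+ (suc n) p i)) (z i))
                     (¬? (≈0? m (coeff ℤ[ m ] p n)) ×-dec ≈0? (suc m) (drop (suc n) p))

  degree-exists : ∀ p → ¬ Ops._≈_ (suc m) p [] → ∃ (Degree p)
  degree-exists []      p≉0 = ⊥-elim (p≉0 (λ i → ≈-refl))
  degree-exists (c ∷ p) p≉0 with ≈0? (suc m) p
  ... | yes p≈0 = 0 , hasDegree (λ c≈0 → p≉0 λ { zero → c≈0 ; (suc i) → p≈0 i }) p≈0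
  ... | no  p≉0 = let n , hasDegree l z = degree-exists p p≉0 in suc n , hasDegree l z

  coeff-add : ∀ p q i → coeff ℤ[ m ] (addPoly ℤ[ m ] p q) i ≈ coeff ℤ[ m ] p i + coeff ℤ[ m ] q i
  coeff-add []      q       i       = ≈-sym (+-identityˡ _)
  coeff-add (c ∷ p) []      i       = ≈-sym (+-identityʳ _)
  coeff-add (c ∷ p) (d ∷ q) zero    = ≈-refl
  coeff-add (c ∷ p) (d ∷ q) (suc i) = coeff-add p q i

  coeff-scale : ∀ c q i → coeff ℤ[ m ] (map (c *_) q) i ≈ c * coeff ℤ[ m ] q i
  coeff-scale c []      i       = ≈-sym (*-zeroʳ c)
  coeff-scale c (d ∷ q) zero    = ≈-refl
  coeff-scale c (d ∷ q) (suc i) = coeff-scale c q i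

  coeff-mul : ∀ c p q i → coeff ℤ[ m ] (mulPoly ℤ[ m ] (c ∷ p) q) i
                          ≈ c * coeff ℤ[ m ] q i + coeff ℤ[ m ] (0# ∷ mulPoly ℤ[ m ] p q) i
  coeff-mul c p q i = ≈-trans (coeff-add (map (c *_) q) _ i) (+-cong (coeff-scale c q i) ≈-refl)

  coeff-mul-constant : ∀ p q → ZeroFrom 1 q →
                       ∀ i → coeff ℤ[ m ] (mulPoly ℤ[ m ] p q) i ≈ coeff ℤ[ m ] p i * coeff ℤ[ m ] q 0
  coeff-mul-constant []      q z i       = ≈-sym (*-zeroˡ _)
  coeff-mul-constant (c ∷ p) q z zero    = ≈-trans (coeff-mul c p q 0) (+-identityʳ _)
  coeff-mul-constant (c ∷ p) q z (suc i) = ≈-trans (coeff-mul c p q (suc i))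
    (≈-trans (+-cong (≈-trans (*-cong ≈-refl (z i)) (*-zeroʳ c)) (coeff-mul-constant p q z i)) (+-identityˡ _))

  coeff-mul-leading : ∀ p q n k → ZeroFrom (suc n) p → ZeroFrom (suc k) q →
                      coeff ℤ[ m ] (mulPoly ℤ[ m ] p q) (n ℕ.+ k) ≈ coeff ℤ[ m ] p n * coeff ℤ[ m ] q k
  coeff-mul-leading []      q n       k zp zq = ≈-sym (*-zeroˡ _)
  coeff-mul-leading (c ∷ p) q zero    k zp zq = ≈-trans (coeff-mul c p q k)
    (≈-trans (+-cong ≈-refl (rest k)) (+-identityʳ _))
    where
    p*q≈0 : Ops._≈_ (suc m) (mulPoly ℤ[ m ] p q) []
    p*q≈0 = Ops.≈-trans (suc m) {mulPoly ℤ[ m ] p q} {mulPoly ℤ[ m ] [] q} {[]}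
      (Ops.*-cong (suc m) {p} {[]} {q} {q} zp (λ _ → ≈-refl)) (λ _ → ≈-refl)
    rest : ∀ k → coeff ℤ[ m ] (0# ∷ mulPoly ℤ[ m ] p q) k ≈ 0#
    rest zero    = ≈-refl
    rest (suc k) = p*q≈0 k
  coeff-mul-leading (c ∷ p) q (suc n) k zp zq = ≈-trans (coeff-mul c p q (suc n ℕ.+ k))
    (≈-trans (+-cong (≈-trans (*-cong ≈-refl q≈0) (*-zeroʳ c)) (coeff-mul-leading p q n k zp zq))
             (+-identityˡ _))
    where
    q≈0 : coeff ℤ[ m ] q (suc n ℕ.+ k) ≈ 0#
    q≈0 = ≡.subst (λ j → coeff ℤ[ m ] q j ≈ 0#) (≡.cong suc (ℕ.+-comm k n)) (zq n)

  *≉0⇒≉0 : ∀ {p q} → ¬ p * q ≈ 0# → ¬ p ≈ 0# × ¬ q ≈ 0#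
  *≉0⇒≉0 {p} {q} pq≉0 = (λ p≈0 → pq≉0 (≈-trans (*-cong p≈0 ≈-refl) (*-zeroˡ q)))
                      , (λ q≈0 → pq≉0 (≈-trans (*-cong ≈-refl q≈0) (*-zeroʳ p)))

-- The product of the leading coefficients is a coefficient of `p * q`, and is nonzero by induction
-- on the number of variables.
integral : ∀ m {p q} → ¬ Ops._≈_ m p (Ops.0# m) → ¬ Ops._≈_ m q (Ops.0# m) →
           ¬ Ops._≈_ m (Ops._*_ m p q) (Ops.0# m)
integral zero    {p} {q} p≉0 q≉0 pq≈0 with ℤ.i*j≡0⇒i≡0∨j≡0 p pq≈0
... | inj₁ p≈0 = p≉0 p≈0
... | inj₂ q≈0 = q≉0 q≈0
integral (suc m) {p} {q} p≉0 q≉0 pq≈0 =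
  let n , hasDegree lp zp = degree-exists m p p≉0
      k , hasDegree lq zq = degree-exists m q q≉0
  in integral m lp lq (Ops.≈-trans m (Ops.≈-sym m (coeff-mul-leading m p q n k zp zq)) (pq≈0 (n ℕ.+ k)))

module _ (m : ℕ) where
  open Ops (suc m)

  -- The product of the leading coefficients of p and q is a coefficient of r.
  degree-* : ∀ {p q r n} → p * q ≈ r → Degree m r n →
             ∃ λ i → ∃ λ j → Degree m p i × Degree m q j × i ℕ.+ j ℕ.≤ n
  degree-* {p} {q} {r} {n} eq dr@(hasDegree _ z) = i , j , dp , dq , ℕ.≮⇒≥ too-large
    where
    module K = Ops m
    pq≉0 : ¬ p * q ≈ 0#
    pq≉0 pq≈0 = Degree.leading≉0 dr (K.≈-trans (K.≈-sym (eq n)) (pq≈0 n))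
    p-degree = degree-exists m p (proj₁ (*≉0⇒≉0 (suc m) {p} {q} pq≉0))
    q-degree = degree-exists m q (proj₂ (*≉0⇒≉0 (suc m) {p} {q} pq≉0))
    i = proj₁ p-degree
    j = proj₁ q-degree
    dp = proj₂ p-degree
    dq = proj₂ q-degree
    too-large : ¬ n ℕ.< i ℕ.+ j
    too-large n<i+j = integral m (Degree.leading≉0 dp) (Degree.leading≉0 dq)
      (K.≈-trans (K.≈-sym (coeff-mul-leading m p q i j (Degree.zeroFrom dp) (Degree.zeroFrom dq)))
      (K.≈-trans (eq (i ℕ.+ j))
      (≡.subst (λ k → coeff ℤ[ m ] r k K.≈ K.0#) (ℕ.m+[n∸m]≡n n<i+j) (z (i ℕ.+ j ℕ.∸ suc n)))))

  Divides : Carrier → Carrier → Set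
  Divides y r = ∃ λ s → s * y ≈ r

  constant-divisor : ∀ y r → Divides y r → Degree m r 0 → ZeroFrom m 1 y
  constant-divisor y r (s , eq) dr = go (degree-* {s} {y} {r} eq dr)
    where
    go : (∃ λ i → ∃ λ j → Degree m s i × Degree m y j × i ℕ.+ j ℕ.≤ 0) → ZeroFrom m 1 y
    go (0     , 0     , _ , dy , _)  = Degree.zeroFrom dy
    go (0     , suc _ , _ , _  , ())
    go (suc _ , _     , _ , _  , ())

  linear-factors : ∀ {p q r} → p * q ≈ r → Degree m r 1 → ZeroFrom m 1 p ⊎ ZeroFrom m 1 q
  linear-factors {p} {q} {r} eq dr = go (degree-* {p} {q} {r} eq dr)
    where
    go : (∃ λ i → ∃ λ j → Degree m p i × Degree m q j × i ℕ.+ j ℕ.≤ 1) → ZeroFrom m 1 p ⊎ ZeroFrom m 1 q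
    go (0     , _     , dp , _  , _) = inj₁ (Degree.zeroFrom dp)
    go (suc _ , 0     , _  , dq , _) = inj₂ (Degree.zeroFrom dq)
    go (suc i , suc j , _  , _  , ℕ.s≤s i+1+j≤0) = ⊥-elim (ℕ.<⇒≱ (ℕ.m≤n+m (suc j) i) (ℕ.≤-trans i+1+j≤0 ℕ.z≤n))

  unit-constant : ∀ y → ZeroFrom m 1 y → Ops.Unit m (coeff ℤ[ m ] y 0) → Unit y
  unit-constant y z (s , eq) = s ∷ [] , λ where
    zero    → Ops.≈-trans m (coeff-mul-constant m (s ∷ []) y z 0) eq
    (suc i) → Ops.≈-trans m (coeff-mul-constant m (s ∷ []) y z (suc i)) (Ops.*-zeroˡ m _)

divides-coeff : ∀ m y r → ZeroFrom (suc m) 1 y → Divides (suc m) y r →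
                ∀ i → Divides m (coeff ℤ[ suc m ] y 0) (coeff ℤ[ suc m ] r i)
divides-coeff m y r z (s , eq) i = coeff ℤ[ suc m ] s i ,
  Ops.≈-trans (suc m) {s′ * y′} {coeff ℤ[ suc m ] (mulPoly ℤ[ suc m ] s y) i} {coeff ℤ[ suc m ] r i}
    (Ops.≈-sym (suc m) {coeff ℤ[ suc m ] (mulPoly ℤ[ suc m ] s y) i} {s′ * y′}
      (coeff-mul-constant (suc m) s y z i)) (eq i)
  where
  open Ops (suc m) using (_*_)
  s′ = coeff ℤ[ suc m ] s i
  y′ = coeff ℤ[ suc m ] y 0

-- Factorisations of a polynomial linear in a and in b

ones : ∀ {m} → Vec ℤ m
ones = Vec.replicate _ 1ℤ

-- A matrix of products has determinant 0, whereas the values 1, 1, 2, 1 of cfg, gh, 2cdef, deh at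
-- the all-ones point would give 1 · 1 = 1 · 2.
not-proportional : ∀ y₀ y₁ s t → y₀ ℤ.* s ≡ + 1 → y₁ ℤ.* s ≡ + 1 →
                   y₀ ℤ.* t ≡ + 2 → y₁ ℤ.* t ≡ + 1 → ⊥
not-proportional y₀ y₁ s t y₀s y₁s y₀t y₁t
  = absurd (≡.trans (≡.sym (≡.cong₂ ℤ._*_ y₀s y₁t)) (≡.trans (exchange y₀ s y₁ t) (≡.cong₂ ℤ._*_ y₁s y₀t)))
  where
  absurd : + 1 ≡ + 2 → ⊥
  absurd ()
  exchange : ∀ y₀ s y₁ t → (y₀ ℤ.* s) ℤ.* (y₁ ℤ.* t) ≡ (y₁ ℤ.* s) ℤ.* (y₀ ℤ.* t)
  exchange = solve-∀

-- Applied to the coefficients gh, cfg and deh of R; the variables are adjoined in the order h, g, …, c.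
module _ (gh cfg deh : RawRing.Carrier ℤ[ 6 ]) where
  private
    gh₅ = coeff ℤ[ 5 ] gh 0
    fg₅ = coeff ℤ[ 5 ] cfg 1
    deh₅ = coeff ℤ[ 5 ] deh 0
    gh₄ = coeff ℤ[ 4 ] gh₅ 0
    fg₄ = coeff ℤ[ 4 ] fg₅ 0
    eh₄ = coeff ℤ[ 4 ] deh₅ 1
    gh₃ = coeff ℤ[ 3 ] gh₄ 0
    fg₃ = coeff ℤ[ 3 ] fg₄ 0
    h₃ = coeff ℤ[ 3 ] eh₄ 1
    g₂ = coeff ℤ[ 2 ] fg₃ 1
    h₂ = coeff ℤ[ 2 ] h₃ 0

  record Coprime : Set where
    field
      gh₆-degree : Degree 5 gh 0
      gh₅-degree : Degree 4 gh₅ 0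
      gh₄-degree : Degree 3 gh₄ 0
      gh₃-degree : Degree 2 gh₃ 0
      h₂-degree  : Degree 1 h₂ 0
      g-monic    : Ops._≈_ 1 (coeff ℤ[ 1 ] g₂ 1) (Ops.1# 1)

  -- As a divisor of gh, `y` is free of c, d, e and f, so it also divides the coefficient g of cf in
  -- cfg and the coefficient h of de in deh. Dividing h, it is free of g; then it divides the
  -- coefficient 1 of g in g.
  common-divisor-unit : Coprime → ∀ y → Divides 5 y gh → Divides 5 y cfg → Divides 5 y deh → Ops.Unit 6 y
  common-divisor-unit coprime y y∣gh y∣cfg y∣deh =
    unit-constant 5 y z₆ (unit-constant 4 y₅ z₅ (unit-constant 3 y₄ z₄ (unit-constant 2 y₃ z₃
      (unit-constant 1 y₂ z₂ (s₁ , y₁∣1)))))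
    where
    open Coprime coprime
    y₅ = coeff ℤ[ 5 ] y 0
    y₄ = coeff ℤ[ 4 ] y₅ 0
    y₃ = coeff ℤ[ 3 ] y₄ 0
    y₂ = coeff ℤ[ 2 ] y₃ 0
    z₆ = constant-divisor 5 y gh y∣gh gh₆-degree
    y₅∣gh = divides-coeff 4 y gh z₆ y∣gh 0
    y₅∣fg = divides-coeff 4 y cfg z₆ y∣cfg 1
    y₅∣deh = divides-coeff 4 y deh z₆ y∣deh 0
    z₅ = constant-divisor 4 y₅ gh₅ y₅∣gh gh₅-degree
    y₄∣gh = divides-coeff 3 y₅ gh₅ z₅ y₅∣gh 0
    y₄∣fg = divides-coeff 3 y₅ fg₅ z₅ y₅∣fg 0
    y₄∣eh = divides-coeff 3 y₅ deh₅ z₅ y₅∣deh 1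
    z₄ = constant-divisor 3 y₄ gh₄ y₄∣gh gh₄-degree
    y₃∣gh = divides-coeff 2 y₄ gh₄ z₄ y₄∣gh 0
    y₃∣fg = divides-coeff 2 y₄ fg₄ z₄ y₄∣fg 0
    y₃∣h = divides-coeff 2 y₄ eh₄ z₄ y₄∣eh 1
    z₃ = constant-divisor 2 y₃ gh₃ y₃∣gh gh₃-degree
    y₂∣g = divides-coeff 1 y₃ fg₃ z₃ y₃∣fg 1
    y₂∣h = divides-coeff 1 y₃ h₃ z₃ y₃∣h 0
    z₂ = constant-divisor 1 y₂ h₂ y₂∣h h₂-degree
    y₁∣g₁ = divides-coeff 0 y₂ g₂ z₂ y₂∣g 1
    s₁ = proj₁ y₁∣g₁
    y₁∣1 = Ops.≈-trans 1 {Ops._*_ 1 s₁ (coeff ℤ[ 1 ] y₂ 0)} {coeff ℤ[ 1 ] g₂ 1} {Ops.1# 1} (proj₂ y₁∣g₁) g-monic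

module _ (r : RawRing.Carrier ℤ[ 8 ]) where
  private
    a¹ = coeff ℤ[ 7 ] r 1
    a⁰ = coeff ℤ[ 7 ] r 0
    gh = coeff ℤ[ 6 ] a¹ 1
    cfg = coeff ℤ[ 6 ] a¹ 0
    deh = coeff ℤ[ 6 ] a⁰ 1
    cdef = coeff ℤ[ 6 ] a⁰ 0

  -- The computations that the argument relies on, gathered so that the argument itself runs for a
  -- variable `r`. The private names are the coefficients of ab, a, b and 1; `cdef` stands for
  -- 2cdef.
  record Shape : Set where
    field
      a-degree     : Degree 7 r 1
      a¹-degree    : Degree 6 a¹ 1
      a⁰-degree    : Degree 6 a⁰ 1
      cfg-at-ones  : ev 6 ones cfg ≡ + 1
      gh-at-ones   : ev 6 ones gh ≡ + 1
      cdef-at-ones : ev 6 ones cdef ≡ + 2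
      deh-at-ones  : ev 6 ones deh ≡ + 1
      coprime      : Coprime gh cfg deh

  module _ (shape : Shape) where
    open Shape shape

    -- If y were not free of b then s and t would be, and (cfg, gh) would be proportional to
    -- (2cdef, deh).
    b-free : ∀ s t y → Ops._≈_ 7 (Ops._*_ 7 s y) a¹ → Ops._≈_ 7 (Ops._*_ 7 t y) a⁰ → ZeroFrom 6 1 y
    b-free s t y s*y t*y =
      go (linear-factors 6 {s} {y} {a¹} s*y a¹-degree) (linear-factors 6 {t} {y} {a⁰} t*y a⁰-degree)
      where
      open Ops 6
      s₀ = coeff ℤ[ 6 ] s 0
      t₀ = coeff ℤ[ 6 ] t 0
      coeffs : ∀ p {r} → ZeroFrom 6 1 p → Ops._≈_ 7 (Ops._*_ 7 p y) r →
               ∀ i → coeff ℤ[ 6 ] y i * coeff ℤ[ 6 ] p 0 ≈ coeff ℤ[ 6 ] r i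
      coeffs p {r} zp eq i = ≈-trans {y′ * p′} {coeff ℤ[ 6 ] (mulPoly ℤ[ 6 ] y p) i} {coeff ℤ[ 6 ] r i}
        (≈-sym {coeff ℤ[ 6 ] (mulPoly ℤ[ 6 ] y p) i} {y′ * p′} (coeff-mul-constant 6 y p zp i))
        (Ops.≈-trans 7 {Ops._*_ 7 y p} {Ops._*_ 7 p y} {r} (Ops.*-comm 7 y p) eq i)
        where
        y′ = coeff ℤ[ 6 ] y i
        p′ = coeff ℤ[ 6 ] p 0
      at-ones : ∀ p i r → coeff ℤ[ 6 ] y i * p ≈ r →
                ev 6 ones (coeff ℤ[ 6 ] y i) ℤ.* ev 6 ones p ≡ ev 6 ones r
      at-ones p i r eq = ≡.trans (≡.sym (ev-* 6 ones (coeff ℤ[ 6 ] y i) p))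
        (ev-cong 6 ones {coeff ℤ[ 6 ] y i * p} {r} eq)
      go : ZeroFrom 6 1 s ⊎ ZeroFrom 6 1 y → ZeroFrom 6 1 t ⊎ ZeroFrom 6 1 y → ZeroFrom 6 1 y
      go (inj₂ z)  _         = z
      go (inj₁ _)  (inj₂ z)  = z
      go (inj₁ zs) (inj₁ zt) = ⊥-elim (not-proportional
          (ev 6 ones (coeff ℤ[ 6 ] y 0)) (ev 6 ones (coeff ℤ[ 6 ] y 1)) (ev 6 ones s₀) (ev 6 ones t₀)
          (≡.trans (at-ones s₀ 0 cfg (coeffs s {a¹} zs s*y 0)) cfg-at-ones)
          (≡.trans (at-ones s₀ 1 gh (coeffs s {a¹} zs s*y 1)) gh-at-ones)
          (≡.trans (at-ones t₀ 0 cdef (coeffs t {a⁰} zt t*y 0)) cdef-at-ones)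
          (≡.trans (at-ones t₀ 1 deh (coeffs t {a⁰} zt t*y 1)) deh-at-ones))

    -- Being free of a, `y` divides both coefficients of `r` with respect to a, the cofactors being
    -- coefficients of `x`. These cofactors are what `b-free` works with.
    factor-unit : ∀ x y → Ops._≈_ 8 (Ops._*_ 8 x y) r → ZeroFrom 7 1 y → Ops.Unit 8 y
    factor-unit x y eq z₈ = unit-constant 7 y z₈ (unit-constant 6 y₇ z₇ (common-divisor-unit gh cfg deh coprime y₆
      (divides-coeff 5 y₇ a¹ z₇ (s , s*y) 1) (divides-coeff 5 y₇ a¹ z₇ (s , s*y) 0)
      (divides-coeff 5 y₇ a⁰ z₇ (t , t*y) 1)))
      where
      y₇ = coeff ℤ[ 7 ] y 0
      y₆ = coeff ℤ[ 6 ] y₇ 0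
      s = coeff ℤ[ 7 ] x 1
      t = coeff ℤ[ 7 ] x 0
      s*y = proj₂ (divides-coeff 6 y r z₈ (x , eq) 1)
      t*y = proj₂ (divides-coeff 6 y r z₈ (x , eq) 0)
      z₇ = b-free s t y₇ s*y t*y

open Defs using (a; b; c; d; e; f; g; h; R; M)

R-shape : Shape R
R-shape = record
  { a-degree     = decided (degree? 7 R 1)
  ; a¹-degree    = decided (degree? 6 _ 1)
  ; a⁰-degree    = decided (degree? 6 _ 1)
  ; cfg-at-ones  = ≡.refl
  ; gh-at-ones   = ≡.refl
  ; cdef-at-ones = ≡.refl
  ; deh-at-ones  = ≡.refl
  ; coprime      = record
    { gh₆-degree = decided (degree? 5 _ 0)
    ; gh₅-degree = decided (degree? 4 _ 0)
    ; gh₄-degree = decided (degree? 3 _ 0)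
    ; gh₃-degree = decided (degree? 2 _ 0)
    ; h₂-degree  = decided (degree? 1 _ 0)
    ; g-monic    = λ { zero → ≡.refl ; (suc i) → ≡.refl }
    }
  }

R-irreducible : Irreducible R
R-irreducible = mkIrred R∤1 split
  where
  open import Algebra.Definitions.RawMagma (RawRing.*-rawMagma ℤ[a⋯h]) using (_,_)
  open Ops 8
  R∤1 : R ∤ 1#
  -- At the all-ones point `R` is 1 + 1 + 1 + 2 = 5.
  R∤1 (q , eq) = ℕ∣.>⇒∤ {1} {5} (ℕ.s≤s (ℕ.s≤s ℕ.z≤n)) (ℕ∣.divides ℤ.∣ ev 8 ones q ∣
    (≡.trans (≡.cong ℤ.∣_∣ (≡.trans (≡.sym (ev-1 8 ones))
      (≡.trans (≡.sym (ev-cong 8 ones {q * R} {1#} eq)) (ev-* 8 ones q R))))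
           (ℤ.abs-* (ev 8 ones q) (+ 5))))
  split : ∀ {x y} → R ≈ x * y → x ∣ 1# ⊎ y ∣ 1#
  split {x} {y} eq = go (linear-factors 7 {x} {y} {R} x*y (Shape.a-degree R-shape))
    where
    x*y : x * y ≈ R
    x*y = ≈-sym {R} {x * y} eq
    y*x : y * x ≈ R
    y*x = ≈-trans {y * x} {x * y} {R} (*-comm y x) x*y
    go : ZeroFrom 7 1 x ⊎ ZeroFrom 7 1 y → x ∣ 1# ⊎ y ∣ 1#
    go (inj₂ z) = let q , unit = factor-unit R R-shape x y x*y z in inj₂ (q , unit)
    go (inj₁ z) = let q , unit = factor-unit R R-shape y x y*x z in inj₁ (q , unit)

-- The matching generating functions as monomials

open RawRing ℤ[a⋯h] using (Carrier; _≈_; _+_; _*_; 0#; 1#)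

private
  K = ℚ.+-*-commutativeRing
  module K = CommutativeRing K

  module MK = MatchingGeneratingFunction K.rawRing

ι : ℤ → ℚᵘ
ι z = mkℚᵘ z 0

ι-+ : ∀ y z → ι (y ℤ.+ z) K.≈ ι y K.+ ι z
ι-+ y z = *≡* (lemma y z)
  where
  lemma : ∀ y z → (y ℤ.+ z) ℤ.* 1ℤ ≡ (y ℤ.* 1ℤ ℤ.+ z ℤ.* 1ℤ) ℤ.* 1ℤ
  lemma = solve-∀

ι-* : ∀ y z → ι (y ℤ.* z) K.≈ ι y K.* ι z
ι-* y z = K.refl

ι-cong : ∀ {y z} → y ≡ z → ι y K.≈ ι z
ι-cong eq = K.reflexive (≡.cong ι eq)

ι-injective : ∀ {y z} → ι y K.≈ ι z → y ≡ z
ι-injective (*≡* eq) = ℤ.*-cancelʳ-≡ _ _ 1ℤ eq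

generatorValues : Vec ℕ 8 → Vec ℤ 14
generatorValues ρ =
  + 2 ∷ A ∷ B ∷ C ∷ D ∷ E ∷ F ∷ G ∷ H
  ∷ A ℤ.* B ℤ.* G ℤ.* H ℤ.+ A ℤ.* C ℤ.* F ℤ.* G ℤ.+ B ℤ.* D ℤ.* E ℤ.* H ℤ.+ + 2 ℤ.* C ℤ.* D ℤ.* E ℤ.* F
  ∷ A ℤ.* G ℤ.+ D ℤ.* E
  ∷ B ℤ.* H ℤ.+ C ℤ.* F
  ∷ A ℤ.* G ℤ.+ + 2 ℤ.* D ℤ.* E
  ∷ B ℤ.* H ℤ.+ + 2 ℤ.* C ℤ.* F
  ∷ []
  where
  A = lookup (point ρ) 0F
  B = lookup (point ρ) 1F
  C = lookup (point ρ) 2F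
  D = lookup (point ρ) 3F
  E = lookup (point ρ) 4F
  F = lookup (point ρ) 5F
  G = lookup (point ρ) 6F
  H = lookup (point ρ) 7F

generatorValue : Vec ℕ 8 → Fin 14 → ℤ
generatorValue ρ = lookup (generatorValues ρ)

-- Once `ρ` is split into its entries, each value is a sum of products of terms `+ suc n` and
-- reduces to a positive integer, so all cases hold by computation.
generatorValue-nonZero : ∀ ρ i → ℤ.NonZero (generatorValue ρ i)
generatorValue-nonZero ρ@(_ ∷ _ ∷ _ ∷ _ ∷ _ ∷ _ ∷ _ ∷ _ ∷ []) = go
  where
  go : ∀ i → ℤ.NonZero (generatorValue ρ i)
  go 0F = _
  go 1F = _
  go 2F = _
  go 3F = _
  go 4F = _
  go 5F = _
  go 6F = _
  go 7F = _
  go 8F = _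
  go 9F = _
  go (suc 9F) = _
  go (suc (suc 9F)) = _
  go (suc (suc (suc 9F))) = _
  go (suc (suc (suc (suc 9F)))) = _

module _ (ρ : Vec ℕ 8) where
  private
    z : Fin 14 → ℤ
    z = generatorValue ρ

  generatorℚ generatorℚ⁻¹ : Fin 14 → ℚᵘ
  generatorℚ i   = ι (z i)
  generatorℚ⁻¹ i = (1/ ι (z i)) {{generatorValue-nonZero ρ i}}

  generatorℚ-inverse : ∀ i → generatorℚ i K.* generatorℚ⁻¹ i K.≈ K.1#
  generatorℚ-inverse i = ℚ.*-inverseʳ (ι (z i)) {{generatorValue-nonZero ρ i}}

  private
    ∏ : List (Fin 14) → ℤ
    ∏ = foldr (λ i s → z i ℤ.* s) 1ℤ

    ι-∏ : ∀ is → foldr (λ i s → generatorℚ i K.* s) K.1# is K.≈ ι (∏ is)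
    ι-∏ []       = K.refl
    ι-∏ (i ∷ is) = K.trans (K.*-congˡ {generatorℚ i} (ι-∏ is)) (K.sym (ι-* (z i) (∏ is)))

    relation : ∀ p q r → ∏ p ℤ.+ ∏ q ≡ ∏ r →
               foldr (λ i s → generatorℚ i K.* s) K.1# p K.+ foldr (λ i s → generatorℚ i K.* s) K.1# q
               K.≈ foldr (λ i s → generatorℚ i K.* s) K.1# r
    relation p q r eq = K.trans (K.+-cong (ι-∏ p) (ι-∏ q))
      (K.trans (K.sym (ι-+ (∏ p) (∏ q))) (K.trans (ι-cong eq) (K.sym (ι-∏ r))))

    A = lookup (point ρ) 0F
    B = lookup (point ρ) 1F
    C = lookup (point ρ) 2F
    D = lookup (point ρ) 3F
    E = lookup (point ρ) 4F
    F = lookup (point ρ) 5F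
    G = lookup (point ρ) 6F
    H = lookup (point ρ) 7F

  relationsℚ : RelationsHold K generatorℚ
  relationsℚ = All.map (λ {(p , q , r)} → relation p q r) relationsℤ
    where
    relationsℤ : All (λ (p , q , r) → ∏ p ℤ.+ ∏ q ≡ ∏ r) relations
    -- Exchanging (a, d, e, g) with (b, c, f, h) fixes R and swaps S with T and U with W, so `r₁`
    -- and `r₂` serve twice.
    r₁ : ∀ a d e g → a ℤ.* (g ℤ.* 1ℤ) ℤ.+ d ℤ.* (e ℤ.* 1ℤ) ≡ (a ℤ.* g ℤ.+ d ℤ.* e) ℤ.* 1ℤ
    r₁ = solve-∀
    r₂ : ∀ a d e g → a ℤ.* (g ℤ.* 1ℤ) ℤ.+ + 2 ℤ.* (d ℤ.* (e ℤ.* 1ℤ)) ≡ (a ℤ.* g ℤ.+ + 2 ℤ.* d ℤ.* e) ℤ.* 1ℤ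
    r₂ = solve-∀
    r₃ : ∀ a b c d e f g h →
      (a ℤ.* g ℤ.+ d ℤ.* e) ℤ.* ((b ℤ.* h ℤ.+ c ℤ.* f) ℤ.* 1ℤ) ℤ.+ c ℤ.* (d ℤ.* (e ℤ.* (f ℤ.* 1ℤ)))
      ≡ (a ℤ.* b ℤ.* g ℤ.* h ℤ.+ a ℤ.* c ℤ.* f ℤ.* g ℤ.+ b ℤ.* d ℤ.* e ℤ.* h ℤ.+ + 2 ℤ.* c ℤ.* d ℤ.* e ℤ.* f) ℤ.* 1ℤ
    r₃ = solve-∀
    r₄ : ∀ a b c d e f g h →
      (a ℤ.* b ℤ.* g ℤ.* h ℤ.+ a ℤ.* c ℤ.* f ℤ.* g ℤ.+ b ℤ.* d ℤ.* e ℤ.* h ℤ.+ + 2 ℤ.* c ℤ.* d ℤ.* e ℤ.* f) ℤ.* 1ℤ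
      ℤ.+ a ℤ.* (c ℤ.* (f ℤ.* (g ℤ.* 1ℤ)))
      ≡ (a ℤ.* g ℤ.+ d ℤ.* e) ℤ.* ((b ℤ.* h ℤ.+ + 2 ℤ.* c ℤ.* f) ℤ.* 1ℤ)
    r₄ = solve-∀
    r₅ : ∀ a b c d e f g h →
      (a ℤ.* b ℤ.* g ℤ.* h ℤ.+ a ℤ.* c ℤ.* f ℤ.* g ℤ.+ b ℤ.* d ℤ.* e ℤ.* h ℤ.+ + 2 ℤ.* c ℤ.* d ℤ.* e ℤ.* f) ℤ.* 1ℤ
      ℤ.+ b ℤ.* (d ℤ.* (e ℤ.* (h ℤ.* 1ℤ)))
      ≡ (b ℤ.* h ℤ.+ c ℤ.* f) ℤ.* ((a ℤ.* g ℤ.+ + 2 ℤ.* d ℤ.* e) ℤ.* 1ℤ)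
    r₅ = solve-∀
    r₆ : ∀ a b c d e f g h →
      (a ℤ.* g ℤ.+ + 2 ℤ.* d ℤ.* e) ℤ.* ((b ℤ.* h ℤ.+ + 2 ℤ.* c ℤ.* f) ℤ.* 1ℤ)
      ℤ.+ a ℤ.* (b ℤ.* (g ℤ.* (h ℤ.* 1ℤ)))
      ≡ + 2 ℤ.* ((a ℤ.* b ℤ.* g ℤ.* h ℤ.+ a ℤ.* c ℤ.* f ℤ.* g
                  ℤ.+ b ℤ.* d ℤ.* e ℤ.* h ℤ.+ + 2 ℤ.* c ℤ.* d ℤ.* e ℤ.* f) ℤ.* 1ℤ)
    r₆ = solve-∀
    relationsℤ = r₁ A D E G ∷ r₁ B C F H ∷ r₂ A D E G ∷ r₂ B C F H
               ∷ r₃ A B C D E F G H ∷ r₄ A B C D E F G H ∷ r₅ A B C D E F G H ∷ r₆ A B C D E F G H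
               ∷ ≡.refl ∷ []

  module At = ClosedForm K generatorℚ generatorℚ⁻¹ generatorℚ-inverse relationsℚ

  at : Carrier → ℚᵘ
  at p = ι (ev 8 (point ρ) p)

  at-* : ∀ p q → at (p * q) K.≈ at p K.* at q
  at-* p q = K.trans (ι-cong (ev-* 8 (point ρ) p q)) (ι-* (ev 8 (point ρ) p) (ev 8 (point ρ) q))

  at-+ : ∀ p q → at (p + q) K.≈ at p K.+ at q
  at-+ p q = K.trans (ι-cong (ev-+ 8 (point ρ) p q)) (ι-+ (ev 8 (point ρ) p) (ev 8 (point ρ) q))

  at-M : ∀ G (w : FiniteGraph.Edge G → Carrier) → at (M G w) K.≈ MK.M G (at ∘ w)
  at-M G w = at-sum (perfectMatchings G)
    where
    at-weight : ∀ S → at (MatchingGeneratingFunction.weight ℤ[a⋯h] w S) K.≈ MK.weight (at ∘ w) S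
    at-weight []      = ι-cong (ev-1 8 (point ρ))
    at-weight (e ∷ S) = K.trans (at-* (w e) _) (K.*-congˡ {at (w e)} (at-weight S))
    at-sum : ∀ Ss → at (foldr _+_ 0# (map (MatchingGeneratingFunction.weight ℤ[a⋯h] w) Ss))
                    K.≈ foldr K._+_ K.0# (map (MK.weight (at ∘ w)) Ss)
    at-sum []       = ι-cong (ev-0 8 (point ρ))
    at-sum (S ∷ Ss) = K.trans (at-+ (MatchingGeneratingFunction.weight ℤ[a⋯h] w S) _)
      (K.+-cong (at-weight S) (at-sum Ss))

infix 4 _≐_

abstract
  -- A Laurent monomial need not be a polynomial, so the two are compared through their values in ℚ.
  -- Abstract, so that what follows manipulates exponent vectors only.
  _≐_ : Carrier → Exponent 14 → Set
  p ≐ E = ∀ ρ → at ρ p K.≈ At.⟦_⟧ ρ E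

  by-points : ∀ {p E} → (∀ ρ → at ρ p K.≈ At.⟦_⟧ ρ E) → p ≐ E
  by-points eq = eq

  at-point : ∀ {p E} → p ≐ E → ∀ ρ → at ρ p K.≈ At.⟦_⟧ ρ E
  at-point eq = eq

≐⇒≈ : ∀ {p q E F} → p ≐ E → q ≐ F → E ≗ F → p ≈ q
≐⇒≈ p≐ q≐ E≗F = ev-faithful 8 λ ρ → ι-injective
  (K.trans (at-point p≐ ρ) (K.trans (At.⟦⟧-cong ρ E≗F) (K.sym (at-point q≐ ρ))))

infixl 7 _*≐_
infixr 8 _^≐_

_*≐_ : ∀ {p q E F} → p ≐ E → q ≐ F → p * q ≐ E ⊕ F
_*≐_ {p} {q} {E} {F} p≐ q≐ = by-points λ ρ → K.trans (at-* ρ p q)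
  (K.trans (K.*-cong (at-point p≐ ρ) (at-point q≐ ρ)) (K.sym (At.⟦⟧-⊕ ρ E F)))

1≐ : 1# ≐ 𝟘
1≐ = by-points λ ρ → K.trans (ι-cong (ev-1 8 (point ρ))) (K.sym (At.⟦⟧-𝟘 ρ))

≐-resp-≗ : ∀ {p E F} → E ≗ F → p ≐ E → p ≐ F
≐-resp-≗ E≗F p≐ = by-points λ ρ → K.trans (at-point p≐ ρ) (At.⟦⟧-cong ρ E≗F)

_^≐_ : ∀ {p E} → p ≐ E → ∀ n → p ^ n ≐ n ⊗ E
_^≐_         p≐ zero    = ≐-resp-≗ (λ i → ≡.refl) 1≐
_^≐_ {E = E} p≐ (suc n) = ≐-resp-≗ (λ i → lemma (+ n) (E i)) (p≐ *≐ p≐ ^≐ n)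
  where
  lemma : ∀ n e → e ℤ.+ n ℤ.* e ≡ (1ℤ ℤ.+ n) ℤ.* e
  lemma = solve-∀

variable≐ : ∀ {p} i → (∀ ρ → ev 8 (point ρ) p ≡ generatorValue ρ i) → p ≐ generator i
variable≐ i eq = by-points λ ρ → K.trans (ι-cong (eq ρ)) (K.sym (At.⟦⟧-generator ρ i))

2≐ : 2# ≐ 𝟐
2≐ = variable≐ #2 λ ρ → ≡.trans (ev-+ 8 (point ρ) 1# 1#) (≡.cong₂ ℤ._+_ (ev-1 8 (point ρ)) (ev-1 8 (point ρ)))
a≐ : a ≐ 𝐚
a≐ = variable≐ #a λ ρ → ev-X 8 (point ρ) 0F
b≐ : b ≐ 𝐛
b≐ = variable≐ #b λ ρ → ev-X 8 (point ρ) 1F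
c≐ : c ≐ 𝐜
c≐ = variable≐ #c λ ρ → ev-X 8 (point ρ) 2F
d≐ : d ≐ 𝐝
d≐ = variable≐ #d λ ρ → ev-X 8 (point ρ) 3F
e≐ : e ≐ 𝐞
e≐ = variable≐ #e λ ρ → ev-X 8 (point ρ) 4F
f≐ : f ≐ 𝐟
f≐ = variable≐ #f λ ρ → ev-X 8 (point ρ) 5F
g≐ : g ≐ 𝐠
g≐ = variable≐ #g λ ρ → ev-X 8 (point ρ) 6F
h≐ : h ≐ 𝐡
h≐ = variable≐ #h λ ρ → ev-X 8 (point ρ) 7F

R≐ : R ≐ 𝐑
R≐ = variable≐ #R value
  where
  value : ∀ ρ → ev 8 (point ρ) R ≡ generatorValue ρ #R
  value ρ = ≡.trans (ev-+ 8 σ (a * b * g * h + a * c * f * g + b * d * e * h) (2# * c * d * e * f)) (≡.cong₂ ℤ._+_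
      (≡.trans (ev-+ 8 σ (a * b * g * h + a * c * f * g) (b * d * e * h)) (≡.cong₂ ℤ._+_
        (≡.trans (ev-+ 8 σ (a * b * g * h) (a * c * f * g)) (≡.cong₂ ℤ._+_
          (product a b g h (X≡ 0F) (X≡ 1F) (X≡ 6F) (X≡ 7F)) (product a c f g (X≡ 0F) (X≡ 2F) (X≡ 5F) (X≡ 6F))))
        (product b d e h (X≡ 1F) (X≡ 3F) (X≡ 4F) (X≡ 7F))))
      (≡.trans (ev-* 8 σ (2# * c * d * e) f) (≡.cong₂ ℤ._*_
        (product 2# c d e (≡.trans (ev-+ 8 σ 1# 1#) (≡.cong₂ ℤ._+_ (ev-1 8 σ) (ev-1 8 σ))) (X≡ 2F) (X≡ 3F) (X≡ 4F))
        (X≡ 5F))))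
    where
    σ = point ρ
    X≡ : ∀ i → ev 8 σ (X 8 i) ≡ lookup σ i
    X≡ = ev-X 8 σ
    product : ∀ p q r s {p′ q′ r′ s′} → ev 8 σ p ≡ p′ → ev 8 σ q ≡ q′ → ev 8 σ r ≡ r′ → ev 8 σ s ≡ s′ →
              ev 8 σ (p * q * r * s) ≡ p′ ℤ.* q′ ℤ.* r′ ℤ.* s′
    product p q r s p≡ q≡ r≡ s≡ = ≡.trans (ev-* 8 σ (p * q * r) s) (≡.cong₂ ℤ._*_
      (≡.trans (ev-* 8 σ (p * q) r) (≡.cong₂ ℤ._*_
        (≡.trans (ev-* 8 σ p q) (≡.cong₂ ℤ._*_ p≡ q≡)) r≡)) s≡)

-- The weights of the matrix M as a periodic array of monomials

mod4-combine : ∀ {n} (i : Fin n) (ρ : Fin 2) → toℕ (combine i ρ) mod 4 ≡ combine (parity i) ρ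
mod4-combine zero          0F = ≡.refl
mod4-combine zero          1F = ≡.refl
mod4-combine (suc zero)    0F = ≡.refl
mod4-combine (suc zero)    1F = ≡.refl
mod4-combine (suc (suc i)) ρ  = ≡.trans (mod4-combine i ρ)
  (≡.cong (λ π → combine π ρ) (≡.sym (Fin.opposite-involutive (parity i))))

mod4 : ∀ n (r : Fin (n · 2)) → let (i , ρ) = remQuot {n} 2 r in toℕ r mod 4 ≡ combine (parity i) ρ
mod4 n r = let (i , ρ) = remQuot {n} 2 r in
  ≡.trans (≡.cong (λ r → toℕ r mod 4) (≡.sym (Fin.combine-remQuot {n} 2 r))) (mod4-combine i ρ)

module _ (ρ : Vec ℕ 8) where
  open At ρ using (⟦_⟧; value; periodic; M-matrix; M-cong; ⟦⟧-cong; periodic-cong; value-scale; ⟦⟧-𝟘)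

  initial≈ : ∀ r s → at ρ (lookup (lookup matrixM r) s) K.≈ value (lookup (lookup initial r) s)
  initial≈ 0F 0F = at-point a≐ ρ
  initial≈ 0F 1F = at-point d≐ ρ
  initial≈ 0F 2F = at-point d≐ ρ
  initial≈ 0F 3F = at-point a≐ ρ
  initial≈ 1F 0F = at-point e≐ ρ
  initial≈ 1F 1F = ι-cong (ev-0 8 (point ρ))
  initial≈ 1F 2F = at-point g≐ ρ
  initial≈ 1F 3F = at-point e≐ ρ
  initial≈ 2F 0F = at-point f≐ ρ
  initial≈ 2F 1F = at-point h≐ ρ
  initial≈ 2F 2F = ι-cong (ev-0 8 (point ρ))
  initial≈ 2F 3F = at-point f≐ ρ
  initial≈ 3F 0F = at-point b≐ ρ
  initial≈ 3F 1F = at-point c≐ ρ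
  initial≈ 3F 2F = at-point c≐ ρ
  initial≈ 3F 3F = at-point b≐ ρ

  wt≈periodic : ∀ n e → at ρ (wt matrixM e) K.≈ periodic (scale 𝟘 (matrix 0F)) n e
  wt≈periodic n (r , s) =
    let (i , ρ′) = remQuot {n} 2 r
        (j , σ) = remQuot {n} 2 s
    in K.trans (K.reflexive (≡.cong₂ (λ r s → at ρ (lookup (lookup matrixM r) s)) (mod4 n r) (mod4 n s)))
      (K.trans (initial≈ (combine (parity i) ρ′) (combine (parity j) σ))
               (K.sym (K.trans (value-scale 𝟘 (matrix 0F (parity i) ρ′ (parity j) σ))
                        (K.trans (K.*-congʳ {value (matrix 0F (parity i) ρ′ (parity j) σ)} ⟦⟧-𝟘) (K.*-identityˡ _)))))

open Total factor next drift

M≐ : ∀ n → M (AD n) (wt matrixM) ≐ total n 0F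
M≐ n = by-points λ ρ → let open At ρ in K.trans (at-M ρ (AD n) (wt matrixM)) (K.trans (M-cong (AD n) (wt≈periodic ρ n))
  (K.trans (M-matrix matrix factor next drift matrix-sums matrix-next n 0F 𝟘)
           (⟦⟧-cong (λ i → ≡.trans (≡.cong (λ t → total n 0F i ℤ.+ t) (ℤ.*-zeroʳ (+ (n · suc n)))) (ℤ.+-identityʳ _)))))

-- The exponents as quadratic polynomials along residue classes

record Quadratic : Set where
  constructor quadratic
  field quad lin const : ℤ

⟪_⟫ : Quadratic → ℤ → ℤ
⟪ quadratic α β γ ⟫ q = α ℤ.* q ℤ.* q ℤ.+ β ℤ.* q ℤ.+ γ

_+Q_ : Quadratic → Quadratic → Quadratic
quadratic α β γ +Q quadratic α′ β′ γ′ = quadratic (α ℤ.+ α′) (β ℤ.+ β′) (γ ℤ.+ γ′)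

⟪⟫-+ : ∀ x y q → ⟪ x +Q y ⟫ q ≡ ⟪ x ⟫ q ℤ.+ ⟪ y ⟫ q
⟪⟫-+ (quadratic α β γ) (quadratic α′ β′ γ′) q = lemma α β γ α′ β′ γ′ q
  where
  lemma : ∀ α β γ α′ β′ γ′ q →
    (α ℤ.+ α′) ℤ.* q ℤ.* q ℤ.+ (β ℤ.+ β′) ℤ.* q ℤ.+ (γ ℤ.+ γ′)
    ≡ (α ℤ.* q ℤ.* q ℤ.+ β ℤ.* q ℤ.+ γ) ℤ.+ (α′ ℤ.* q ℤ.* q ℤ.+ β′ ℤ.* q ℤ.+ γ′)
  lemma = solve-∀

-- The coefficients of cellTotal (n + 2q) as a polynomial in q.
cellQuadratic : ℕ → Factors → Fin 14 → Quadratic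
cellQuadratic n Δ i = quadratic
  (Δ 0F 0F i ℤ.+ Δ 0F 1F i ℤ.+ Δ 1F 0F i ℤ.+ Δ 1F 1F i)
  (+ 2 ℤ.* evens n ℤ.* Δ 0F 0F i ℤ.+ + n ℤ.* (Δ 0F 1F i ℤ.+ Δ 1F 0F i) ℤ.+ + 2 ℤ.* odds n ℤ.* Δ 1F 1F i)
  (cellTotal n Δ i)

-- The expansion of (n + 2q)(n + 2q + 1) t in powers of q.
driftQuadratic : ℕ → Exponent 14 → Fin 14 → Quadratic
driftQuadratic n t i = quadratic (+ 4 ℤ.* t i) ((+ 4 ℤ.* + n ℤ.+ + 2) ℤ.* t i) (+ n ℤ.* (1ℤ ℤ.+ + n) ℤ.* t i)

-- The contribution of the first s reductions of the diamond of order s + n + 2q, as a polynomial in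
-- q. Adding 2q to an order adds q to both `evens` and `odds`, so a single computation covers all q.
stepsQuadratic : ℕ → ℕ → Fin 12 → Fin 14 → Quadratic
stepsQuadratic zero    n k i = quadratic 0ℤ 0ℤ 0ℤ
stepsQuadratic (suc s) n k i =
  cellQuadratic (suc s ℕ.+ n) (factor k) i +Q (stepsQuadratic s n (next k) i +Q driftQuadratic (s ℕ.+ n) (drift k) i)

nexts : ℕ → Fin 12 → Fin 12
nexts zero    k = k
nexts (suc s) k = nexts s (next k)

half-shift : ∀ q n → ⌊ q · 2 ℕ.+ n /2⌋ ≡ q ℕ.+ ⌊ n /2⌋
half-shift zero    n = ≡.refl
half-shift (suc q) n = ≡.cong suc (half-shift q n)

module _ (s q n : ℕ) where
  private
    size : s ℕ.+ (q · 2 ℕ.+ n) ≡ q · 2 ℕ.+ (s ℕ.+ n)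
    size = lemma s q n
      where
      lemma : ∀ s q n → s ℕ.+ (q · 2 ℕ.+ n) ≡ q · 2 ℕ.+ (s ℕ.+ n)
      lemma = ℕ-Solver.solve-∀

  odds-shift : odds (s ℕ.+ (q · 2 ℕ.+ n)) ≡ + q ℤ.+ odds (s ℕ.+ n)
  odds-shift = ≡.cong +_ (≡.trans (≡.cong ⌊_/2⌋ size) (half-shift q (s ℕ.+ n)))

  evens-shift : evens (s ℕ.+ (q · 2 ℕ.+ n)) ≡ + q ℤ.+ evens (s ℕ.+ n)
  evens-shift = ≡.cong +_ (≡.trans (≡.cong ⌈_/2⌉ size)
    (≡.trans (≡.cong ⌊_/2⌋ (≡.sym (ℕ.+-suc (q · 2) (s ℕ.+ n)))) (half-shift q (suc (s ℕ.+ n)))))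

  cellTotal-shift : ∀ Δ i → cellTotal (s ℕ.+ (q · 2 ℕ.+ n)) Δ i ≡ ⟪ cellQuadratic (s ℕ.+ n) Δ i ⟫ (+ q)
  cellTotal-shift Δ i = ≡.trans
    (≡.cong₂ (λ e o → e ℤ.* (e ℤ.* Δ 0F 0F i ℤ.+ o ℤ.* Δ 0F 1F i) ℤ.+ o ℤ.* (e ℤ.* Δ 1F 0F i ℤ.+ o ℤ.* Δ 1F 1F i))
      evens-shift odds-shift)
    (≡.trans (lemma (+ q) (evens (s ℕ.+ n)) (odds (s ℕ.+ n)) (Δ 0F 0F i) (Δ 0F 1F i) (Δ 1F 0F i) (Δ 1F 1F i))
      (≡.cong (λ m → (Δ 0F 0F i ℤ.+ Δ 0F 1F i ℤ.+ Δ 1F 0F i ℤ.+ Δ 1F 1F i) ℤ.* + q ℤ.* + q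
          ℤ.+ (+ 2 ℤ.* evens (s ℕ.+ n) ℤ.* Δ 0F 0F i ℤ.+ m ℤ.* (Δ 0F 1F i ℤ.+ Δ 1F 0F i)
               ℤ.+ + 2 ℤ.* odds (s ℕ.+ n) ℤ.* Δ 1F 1F i) ℤ.* + q
          ℤ.+ cellTotal (s ℕ.+ n) Δ i)
        (evens+odds (s ℕ.+ n))))
    where
    lemma : ∀ q e o x y z w →
      (q ℤ.+ e) ℤ.* ((q ℤ.+ e) ℤ.* x ℤ.+ (q ℤ.+ o) ℤ.* y) ℤ.+ (q ℤ.+ o) ℤ.* ((q ℤ.+ e) ℤ.* z ℤ.+ (q ℤ.+ o) ℤ.* w)
      ≡ (x ℤ.+ y ℤ.+ z ℤ.+ w) ℤ.* q ℤ.* q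
        ℤ.+ (+ 2 ℤ.* e ℤ.* x ℤ.+ (e ℤ.+ o) ℤ.* (y ℤ.+ z) ℤ.+ + 2 ℤ.* o ℤ.* w) ℤ.* q
        ℤ.+ (e ℤ.* (e ℤ.* x ℤ.+ o ℤ.* y) ℤ.+ o ℤ.* (e ℤ.* z ℤ.+ o ℤ.* w))
    lemma = solve-∀

  drift-shift : ∀ t i → (((s ℕ.+ (q · 2 ℕ.+ n)) · suc (s ℕ.+ (q · 2 ℕ.+ n))) ⊗ t) i
                        ≡ ⟪ driftQuadratic (s ℕ.+ n) t i ⟫ (+ q)
  drift-shift t i = ≡.trans
    (≡.cong (ℤ._* t i) (≡.trans (ℤ.pos-* N (suc N)) (≡.cong (λ m → m ℤ.* (1ℤ ℤ.+ m)) N≡)))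
    (lemma (+ q) (+ (s ℕ.+ n)) (t i))
    where
    N = s ℕ.+ (q · 2 ℕ.+ n)
    N≡ : + N ≡ + q ℤ.* + 2 ℤ.+ + (s ℕ.+ n)
    N≡ = ≡.trans (≡.cong +_ size) (≡.cong (λ m → m ℤ.+ + (s ℕ.+ n)) (ℤ.pos-* q 2))
    lemma : ∀ q m t → (q ℤ.* + 2 ℤ.+ m) ℤ.* (1ℤ ℤ.+ (q ℤ.* + 2 ℤ.+ m)) ℤ.* t
      ≡ + 4 ℤ.* t ℤ.* q ℤ.* q ℤ.+ (+ 4 ℤ.* m ℤ.+ + 2) ℤ.* t ℤ.* q ℤ.+ m ℤ.* (1ℤ ℤ.+ m) ℤ.* t
    lemma = solve-∀

total-steps : ∀ s q n k i → total (s ℕ.+ (q · 2 ℕ.+ n)) k i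
                            ≡ ⟪ stepsQuadratic s n k i ⟫ (+ q) ℤ.+ total (q · 2 ℕ.+ n) (nexts s k) i
total-steps zero    q n k i = ≡.sym (ℤ.+-identityˡ _)
total-steps (suc s) q n k i = ≡.trans
  (≡.cong₂ ℤ._+_ (cellTotal-shift (suc s) q n (factor k) i)
    (≡.cong₂ ℤ._+_ (total-steps s q n (next k) i) (drift-shift s q n (drift k) i)))
  (≡.trans (lemma (⟪ cellQuadratic (suc s ℕ.+ n) (factor k) i ⟫ (+ q)) (⟪ stepsQuadratic s n (next k) i ⟫ (+ q))
             (total (q · 2 ℕ.+ n) (nexts s (next k)) i) (⟪ driftQuadratic (s ℕ.+ n) (drift k) i ⟫ (+ q)))
    (≡.cong (ℤ._+ total (q · 2 ℕ.+ n) (nexts s (next k)) i) (≡.sym (≡.trans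
      (⟪⟫-+ (cellQuadratic (suc s ℕ.+ n) (factor k) i) _ (+ q))
      (≡.cong (λ t → ⟪ cellQuadratic (suc s ℕ.+ n) (factor k) i ⟫ (+ q) ℤ.+ t)
        (⟪⟫-+ (stepsQuadratic s n (next k) i) (driftQuadratic (s ℕ.+ n) (drift k) i) (+ q)))))))
  where
  lemma : ∀ c x m d → c ℤ.+ ((x ℤ.+ m) ℤ.+ d) ≡ (c ℤ.+ (x ℤ.+ d)) ℤ.+ m
  lemma = solve-∀

-- All n reductions are carried out, down to the empty diamond with exponent `𝟘`.
total-value : ∀ n → total n 0F ≗ (λ i → ⟪ stepsQuadratic n 0 0F i ⟫ 0ℤ)
total-value n i = ≡.trans (≡.cong (λ n → total n 0F i) (≡.sym (ℕ.+-identityʳ n)))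
  (≡.trans (total-steps n 0 0 0F i) (ℤ.+-identityʳ _))

M-value : ∀ n {p E} → p ≐ E → {_ : True ((λ i → ⟪ stepsQuadratic n 0 0F i ⟫ 0ℤ) ≗? E)} → M (AD n) (wt matrixM) ≈ p
M-value n p≐ {eq} = ≐⇒≈ (M≐ n) p≐
  (λ i → ≡.trans (total-value n i) (decided ((λ i → ⟪ stepsQuadratic n 0 0F i ⟫ 0ℤ) ≗? _) {eq} i))

-- The recurrences over a full period of twelve orders

combination : (U V W X Y : Exponent 14) (n₁ n₂ n₃ n₄ n₅ : ℕ) → Exponent 14
combination U V W X Y n₁ n₂ n₃ n₄ n₅ = n₁ ⊗ U ⊕ n₂ ⊗ V ⊕ n₃ ⊗ W ⊕ n₄ ⊗ X ⊕ n₅ ⊗ Y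

powers≐ : ∀ p₁ p₂ p₃ p₄ p₅ {E₁ E₂ E₃ E₄ E₅} → p₁ ≐ E₁ → p₂ ≐ E₂ → p₃ ≐ E₃ → p₄ ≐ E₄ → p₅ ≐ E₅ →
          ∀ n₁ n₂ n₃ n₄ n₅ →
          p₁ ^ n₁ * p₂ ^ n₂ * p₃ ^ n₃ * p₄ ^ n₄ * p₅ ^ n₅ ≐ combination E₁ E₂ E₃ E₄ E₅ n₁ n₂ n₃ n₄ n₅
powers≐ p₁ p₂ p₃ p₄ p₅ p₁≐ p₂≐ p₃≐ p₄≐ p₅≐ n₁ n₂ n₃ n₄ n₅ =
  p₁≐ ^≐ n₁ *≐ p₂≐ ^≐ n₂ *≐ p₃≐ ^≐ n₃ *≐ p₄≐ ^≐ n₄ *≐ p₅≐ ^≐ n₅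

_≟Q_ : ∀ (x y : Quadratic) → Dec (x ≡ y)
quadratic α β γ ≟Q quadratic α′ β′ γ′ = map′
  (λ { (≡.refl , ≡.refl , ≡.refl) → ≡.refl }) (λ { ≡.refl → ≡.refl , ≡.refl , ≡.refl })
  (α ℤ.≟ α′ ×-dec β ℤ.≟ β′ ×-dec γ ℤ.≟ γ′)

-- Twelve steps lead from index `0F` back to `0F`. The hypothesis says that the exponents gained on
-- the way have no q² term, each of the five being 4q plus a constant. Orders and exponents enter
-- through equations, so that truncated differences can be supplied for them.
recurrence : ∀ q r U V W X Y c₁ c₂ c₃ c₄ c₅ →
  (∀ i → stepsQuadratic 12 r 0F i ≡ quadratic 0ℤ (combination U V W X Y 4 4 4 4 4 i)
                                                (combination U V W X Y c₁ c₂ c₃ c₄ c₅ i)) →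
  ∀ {N P n₁ n₂ n₃ n₄ n₅} → N ≡ 12 ℕ.+ (q · 2 ℕ.+ r) → P ≡ q · 2 ℕ.+ r →
  n₁ ≡ 4 · q ℕ.+ c₁ → n₂ ≡ 4 · q ℕ.+ c₂ → n₃ ≡ 4 · q ℕ.+ c₃ → n₄ ≡ 4 · q ℕ.+ c₄ → n₅ ≡ 4 · q ℕ.+ c₅ →
  total N 0F ≗ (combination U V W X Y n₁ n₂ n₃ n₄ n₅ ⊕ total P 0F)
recurrence q r U V W X Y c₁ c₂ c₃ c₄ c₅ eq ≡.refl ≡.refl ≡.refl ≡.refl ≡.refl ≡.refl ≡.refl i = ≡.trans
  (total-steps 12 q r 0F i)
  (≡.cong (ℤ._+ total (q · 2 ℕ.+ r) 0F i) (≡.trans (≡.cong (λ x → ⟪ x ⟫ (+ q)) (eq i))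
    (≡.trans (lemma (+ q) (U i) (V i) (W i) (X i) (Y i) (+ c₁) (+ c₂) (+ c₃) (+ c₄) (+ c₅))
      (≡.sym (≡.cong₂ ℤ._+_ (≡.cong₂ ℤ._+_ (≡.cong₂ ℤ._+_ (≡.cong₂ ℤ._+_
        (coefficient c₁ (U i)) (coefficient c₂ (V i))) (coefficient c₃ (W i))) (coefficient c₄ (X i)))
        (coefficient c₅ (Y i)))))))
  where
  coefficient : ∀ c x → + (4 · q ℕ.+ c) ℤ.* x ≡ (+ 4 ℤ.* + q ℤ.+ + c) ℤ.* x
  coefficient c x = ≡.cong (λ m → (m ℤ.+ + c) ℤ.* x) (ℤ.pos-* 4 q)
  lemma : ∀ q x₁ x₂ x₃ x₄ x₅ c₁ c₂ c₃ c₄ c₅ →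
    0ℤ ℤ.* q ℤ.* q ℤ.+ (+ 4 ℤ.* x₁ ℤ.+ + 4 ℤ.* x₂ ℤ.+ + 4 ℤ.* x₃ ℤ.+ + 4 ℤ.* x₄ ℤ.+ + 4 ℤ.* x₅) ℤ.* q
    ℤ.+ (c₁ ℤ.* x₁ ℤ.+ c₂ ℤ.* x₂ ℤ.+ c₃ ℤ.* x₃ ℤ.+ c₄ ℤ.* x₄ ℤ.+ c₅ ℤ.* x₅)
    ≡ (+ 4 ℤ.* q ℤ.+ c₁) ℤ.* x₁ ℤ.+ (+ 4 ℤ.* q ℤ.+ c₂) ℤ.* x₂ ℤ.+ (+ 4 ℤ.* q ℤ.+ c₃) ℤ.* x₃
      ℤ.+ (+ 4 ℤ.* q ℤ.+ c₄) ℤ.* x₄ ℤ.+ (+ 4 ℤ.* q ℤ.+ c₅) ℤ.* x₅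
  lemma = solve-∀

-- With n = 6 + q, the exponents 4n - 12, 4n - 10, 4n - 12, 4n - 16, 4n - 8 are 4q plus 12, 14, 12,
-- 8, 16. As `i` runs through all 14 generators, this includes the cancellation of S, T, U and W.
even-steps : ∀ i → stepsQuadratic 12 0 0F i
  ≡ quadratic 0ℤ (combination 𝟐 (𝐚 ⊕ 𝐛) (𝐜 ⊕ 𝐝 ⊕ 𝐞 ⊕ 𝐟) (𝐠 ⊕ 𝐡) 𝐑 4 4 4 4 4 i)
                 (combination 𝟐 (𝐚 ⊕ 𝐛) (𝐜 ⊕ 𝐝 ⊕ 𝐞 ⊕ 𝐟) (𝐠 ⊕ 𝐡) 𝐑 12 14 12 8 16 i)
even-steps = decided (Fin.all? λ i → _ ≟Q _)

-- With n = 7 + q, the exponents 4n - 16, 4n - 10, 4n - 14, 4n - 16, 4n - 12 are 4q plus 12, 18, 14,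
-- 12, 16.
odd-steps : ∀ i → stepsQuadratic 12 1 0F i
  ≡ quadratic 0ℤ (combination 𝟐 (𝐝 ⊕ 𝐞) (𝐚 ⊕ 𝐛 ⊕ 𝐠 ⊕ 𝐡) (𝐜 ⊕ 𝐟) 𝐑 4 4 4 4 4 i)
                 (combination 𝟐 (𝐝 ⊕ 𝐞) (𝐚 ⊕ 𝐛 ⊕ 𝐠 ⊕ 𝐡) (𝐜 ⊕ 𝐟) 𝐑 12 18 14 12 16 i)
odd-steps = decided (Fin.all? λ i → _ ≟Q _)

ab≐ : a * b ≐ 𝐚 ⊕ 𝐛
ab≐ = a≐ *≐ b≐

de≐ : d * e ≐ 𝐝 ⊕ 𝐞
de≐ = d≐ *≐ e≐

gh≐ : g * h ≐ 𝐠 ⊕ 𝐡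
gh≐ = g≐ *≐ h≐

cf≐ : c * f ≐ 𝐜 ⊕ 𝐟
cf≐ = c≐ *≐ f≐

abgh≐ : a * b * g * h ≐ 𝐚 ⊕ 𝐛 ⊕ 𝐠 ⊕ 𝐡
abgh≐ = a≐ *≐ b≐ *≐ g≐ *≐ h≐

cdef≐ : c * d * e * f ≐ 𝐜 ⊕ 𝐝 ⊕ 𝐞 ⊕ 𝐟
cdef≐ = c≐ *≐ d≐ *≐ e≐ *≐ f≐

difference : ∀ {m n k} → m ≡ n ℕ.+ k → m ∸ k ≡ n
difference {n = n} {k} ≡.refl = ℕ.m+n∸n≡m n k

m≤n∸1⇒m<n : ∀ {m n} → suc m ≤ n ∸ 1 → suc (suc m) ≤ n
m≤n∸1⇒m<n {n = suc n} = ℕ.s≤s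

-- Writing n as 6 + q makes every truncated difference exact, since 2n ≥ 12 and 4n ≥ 24.
total-even : ∀ q → let n = 6 ℕ.+ q in
  total (2 · n) 0F
  ≗ (combination 𝟐 (𝐚 ⊕ 𝐛) (𝐜 ⊕ 𝐝 ⊕ 𝐞 ⊕ 𝐟) (𝐠 ⊕ 𝐡) 𝐑
       (4 · n ∸ 12) (4 · n ∸ 10) (4 · n ∸ 12) (4 · n ∸ 16) (4 · n ∸ 8)
     ⊕ total (2 · n ∸ 12) 0F)
total-even q = recurrence q 0 𝟐 (𝐚 ⊕ 𝐛) (𝐜 ⊕ 𝐝 ⊕ 𝐞 ⊕ 𝐟) (𝐠 ⊕ 𝐡) 𝐑 12 14 12 8 16 even-steps
  (s₁ q) (difference (s₂ q)) (difference (s₃ q)) (difference (s₄ q))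
  (difference (s₃ q)) (difference (s₅ q)) (difference (s₆ q))
  where
  s₁ : ∀ q → 2 · (6 ℕ.+ q) ≡ 12 ℕ.+ (q · 2 ℕ.+ 0)
  s₁ = ℕ-Solver.solve-∀
  s₂ : ∀ q → 2 · (6 ℕ.+ q) ≡ (q · 2 ℕ.+ 0) ℕ.+ 12
  s₂ = ℕ-Solver.solve-∀
  s₃ : ∀ q → 4 · (6 ℕ.+ q) ≡ (4 · q ℕ.+ 12) ℕ.+ 12
  s₃ = ℕ-Solver.solve-∀
  s₄ : ∀ q → 4 · (6 ℕ.+ q) ≡ (4 · q ℕ.+ 14) ℕ.+ 10
  s₄ = ℕ-Solver.solve-∀
  s₅ : ∀ q → 4 · (6 ℕ.+ q) ≡ (4 · q ℕ.+ 8) ℕ.+ 16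
  s₅ = ℕ-Solver.solve-∀
  s₆ : ∀ q → 4 · (6 ℕ.+ q) ≡ (4 · q ℕ.+ 16) ℕ.+ 8
  s₆ = ℕ-Solver.solve-∀

total-odd : ∀ q → let n = 7 ℕ.+ q in
  total (2 · n ∸ 1) 0F
  ≗ (combination 𝟐 (𝐝 ⊕ 𝐞) (𝐚 ⊕ 𝐛 ⊕ 𝐠 ⊕ 𝐡) (𝐜 ⊕ 𝐟) 𝐑
       (4 · n ∸ 16) (4 · n ∸ 10) (4 · n ∸ 14) (4 · n ∸ 16) (4 · n ∸ 12)
     ⊕ total (2 · n ∸ 13) 0F)
total-odd q = recurrence q 1 𝟐 (𝐝 ⊕ 𝐞) (𝐚 ⊕ 𝐛 ⊕ 𝐠 ⊕ 𝐡) (𝐜 ⊕ 𝐟) 𝐑 12 18 14 12 16 odd-steps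
  (difference (s₁ q)) (difference (s₂ q)) (difference (s₃ q)) (difference (s₄ q))
  (difference (s₅ q)) (difference (s₃ q)) (difference (s₆ q))
  where
  s₁ : ∀ q → 2 · (7 ℕ.+ q) ≡ (12 ℕ.+ (q · 2 ℕ.+ 1)) ℕ.+ 1
  s₁ = ℕ-Solver.solve-∀
  s₂ : ∀ q → 2 · (7 ℕ.+ q) ≡ (q · 2 ℕ.+ 1) ℕ.+ 13
  s₂ = ℕ-Solver.solve-∀
  s₃ : ∀ q → 4 · (7 ℕ.+ q) ≡ (4 · q ℕ.+ 12) ℕ.+ 16
  s₃ = ℕ-Solver.solve-∀
  s₄ : ∀ q → 4 · (7 ℕ.+ q) ≡ (4 · q ℕ.+ 18) ℕ.+ 10
  s₄ = ℕ-Solver.solve-∀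
  s₅ : ∀ q → 4 · (7 ℕ.+ q) ≡ (4 · q ℕ.+ 14) ℕ.+ 14
  s₅ = ℕ-Solver.solve-∀
  s₆ : ∀ q → 4 · (7 ℕ.+ q) ≡ (4 · q ℕ.+ 16) ℕ.+ 12
  s₆ = ℕ-Solver.solve-∀

even-form : ∀ n₁ n₂ n₃ n₄ n₅ →
  2# ^ n₁ * (a * b) ^ n₂ * (c * d * e * f) ^ n₃ * (g * h) ^ n₄ * R ^ n₅
  ≐ combination 𝟐 (𝐚 ⊕ 𝐛) (𝐜 ⊕ 𝐝 ⊕ 𝐞 ⊕ 𝐟) (𝐠 ⊕ 𝐡) 𝐑 n₁ n₂ n₃ n₄ n₅
even-form = powers≐ 2# (a * b) (c * d * e * f) (g * h) R 2≐ ab≐ cdef≐ gh≐ R≐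

odd-form : ∀ n₁ n₂ n₃ n₄ n₅ →
  2# ^ n₁ * (d * e) ^ n₂ * (a * b * g * h) ^ n₃ * (c * f) ^ n₄ * R ^ n₅
  ≐ combination 𝟐 (𝐝 ⊕ 𝐞) (𝐚 ⊕ 𝐛 ⊕ 𝐠 ⊕ 𝐡) (𝐜 ⊕ 𝐟) 𝐑 n₁ n₂ n₃ n₄ n₅
odd-form = powers≐ 2# (d * e) (a * b * g * h) (c * f) R 2≐ de≐ abgh≐ cf≐ R≐

M-even : ∀ n → 12 ≤ 2 · n → M (AD (2 · n)) (wt matrixM)
  ≈ 2# ^ (4 · n ∸ 12) * (a * b) ^ (4 · n ∸ 10) * (c * d * e * f) ^ (4 · n ∸ 12)
    * (g * h) ^ (4 · n ∸ 16) * R ^ (4 · n ∸ 8) * M (AD (2 · n ∸ 12)) (wt matrixM)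
M-even n 12≤2n = ≐⇒≈ (M≐ (2 · n))
  (2≐ ^≐ (4 · n ∸ 12) *≐ ab≐ ^≐ (4 · n ∸ 10) *≐ cdef≐ ^≐ (4 · n ∸ 12)
   *≐ gh≐ ^≐ (4 · n ∸ 16) *≐ R≐ ^≐ (4 · n ∸ 8) *≐ M≐ (2 · n ∸ 12))
  (exponents (ℕ.m+[n∸m]≡n (ℕ.*-cancelˡ-≤ {6} 2 12≤2n)))
  where
  exponents : 6 ℕ.+ (n ∸ 6) ≡ n → _
  exponents eq = ≡.subst (λ n → total (2 · n) 0F
    ≗ (combination 𝟐 (𝐚 ⊕ 𝐛) (𝐜 ⊕ 𝐝 ⊕ 𝐞 ⊕ 𝐟) (𝐠 ⊕ 𝐡) 𝐑
         (4 · n ∸ 12) (4 · n ∸ 10) (4 · n ∸ 12) (4 · n ∸ 16) (4 · n ∸ 8)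
       ⊕ total (2 · n ∸ 12) 0F)) eq (total-even (n ∸ 6))

M-odd : ∀ n → 13 ≤ 2 · n ∸ 1 → M (AD (2 · n ∸ 1)) (wt matrixM)
  ≈ 2# ^ (4 · n ∸ 16) * (d * e) ^ (4 · n ∸ 10) * (a * b * g * h) ^ (4 · n ∸ 14)
    * (c * f) ^ (4 · n ∸ 16) * R ^ (4 · n ∸ 12) * M (AD (2 · n ∸ 13)) (wt matrixM)
M-odd n 13≤2n-1 = ≐⇒≈ (M≐ (2 · n ∸ 1))
  (2≐ ^≐ (4 · n ∸ 16) *≐ de≐ ^≐ (4 · n ∸ 10) *≐ abgh≐ ^≐ (4 · n ∸ 14)
   *≐ cf≐ ^≐ (4 · n ∸ 16) *≐ R≐ ^≐ (4 · n ∸ 12) *≐ M≐ (2 · n ∸ 13))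
  (exponents (ℕ.m+[n∸m]≡n (ℕ.*-cancelˡ-≤ {7} 2 14≤2n)))
  where
  14≤2n : 2 · 7 ≤ 2 · n
  14≤2n = m≤n∸1⇒m<n 13≤2n-1
  exponents : 7 ℕ.+ (n ∸ 7) ≡ n → _
  exponents eq = ≡.subst (λ n → total (2 · n ∸ 1) 0F
    ≗ (combination 𝟐 (𝐝 ⊕ 𝐞) (𝐚 ⊕ 𝐛 ⊕ 𝐠 ⊕ 𝐡) (𝐜 ⊕ 𝐟) 𝐑
         (4 · n ∸ 16) (4 · n ∸ 10) (4 · n ∸ 14) (4 · n ∸ 16) (4 · n ∸ 12)
       ⊕ total (2 · n ∸ 13) 0F)) eq (total-odd (n ∸ 7))

theorem3p8 :
      Irreducible R
    × M (AD 0) (wt matrixM) ≈ 1#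
    × M (AD 1) (wt matrixM) ≈ d * e
    × M (AD 2) (wt matrixM) ≈ a * b * R
    × M (AD 3) (wt matrixM) ≈ (d * e) ^ 2 * (a * b * g * h) * R
    × M (AD 4) (wt matrixM) ≈ 2# * (a * b) ^ 2 * (c * d * e * f) * R ^ 3
    × M (AD 5) (wt matrixM) ≈ 2# * (d * e) ^ 4 * (a * b * g * h) ^ 2 * (c * f) * R ^ 3
    × M (AD 6) (wt matrixM) ≈ 2# ^ 3 * (a * b) ^ 4 * (c * d * e * f) ^ 3 * (g * h) * R ^ 5
    × M (AD 7) (wt matrixM) ≈ 2# ^ 3 * (d * e) ^ 7 * (a * b * g * h) ^ 4 * (c * f) ^ 3 * R ^ 5
    × M (AD 8) (wt matrixM) ≈ 2# ^ 5 * (a * b) ^ 7 * (c * d * e * f) ^ 5 * (g * h) ^ 3 * R ^ 8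
    × M (AD 9) (wt matrixM) ≈ 2# ^ 5 * (d * e) ^ 10 * (a * b * g * h) ^ 7 * (c * f) ^ 5 * R ^ 8
    × M (AD 10) (wt matrixM) ≈ 2# ^ 8 * (a * b) ^ 10 * (c * d * e * f) ^ 8 * (g * h) ^ 5 * R ^ 12
    × M (AD 11) (wt matrixM) ≈ 2# ^ 8 * (d * e) ^ 14 * (a * b * g * h) ^ 10 * (c * f) ^ 8 * R ^ 12
    × (∀ (n : ℕ) → 12 ≤ 2 · n →
         M (AD (2 · n)) (wt matrixM)
           ≈ 2# ^ (4 · n ∸ 12) * (a * b) ^ (4 · n ∸ 10) * (c * d * e * f) ^ (4 · n ∸ 12)
             * (g * h) ^ (4 · n ∸ 16) * R ^ (4 · n ∸ 8) * M (AD (2 · n ∸ 12)) (wt matrixM))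
    × (∀ (n : ℕ) → 13 ≤ 2 · n ∸ 1 →
         M (AD (2 · n ∸ 1)) (wt matrixM)
           ≈ 2# ^ (4 · n ∸ 16) * (d * e) ^ (4 · n ∸ 10) * (a * b * g * h) ^ (4 · n ∸ 14)
             * (c * f) ^ (4 · n ∸ 16) * R ^ (4 · n ∸ 12) * M (AD (2 · n ∸ 13)) (wt matrixM))
theorem3p8 = R-irreducible
  , M-value 0 1≐
  , M-value 1 de≐
  , M-value 2 (ab≐ *≐ R≐)
  , M-value 3 (de≐ ^≐ 2 *≐ abgh≐ *≐ R≐)
  , M-value 4 (2≐ *≐ ab≐ ^≐ 2 *≐ cdef≐ *≐ R≐ ^≐ 3)
  , M-value 5 (2≐ *≐ de≐ ^≐ 4 *≐ abgh≐ ^≐ 2 *≐ cf≐ *≐ R≐ ^≐ 3)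
  , M-value 6 (2≐ ^≐ 3 *≐ ab≐ ^≐ 4 *≐ cdef≐ ^≐ 3 *≐ gh≐ *≐ R≐ ^≐ 5)
  , M-value 7 (2≐ ^≐ 3 *≐ de≐ ^≐ 7 *≐ abgh≐ ^≐ 4 *≐ cf≐ ^≐ 3 *≐ R≐ ^≐ 5)
  , M-value 8  (even-form 5 7 5 3 8)
  , M-value 9  (odd-form 5 10 7 5 8)
  , M-value 10 (even-form 8 10 8 5 12)
  , M-value 11 (odd-form 8 14 10 8 12)
  , M-even
  , M-odd
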